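{- Let $\mathbb{P}$ be the forcing poset whose conditions are triples $(a,x,A)$ satisfying: (1) $a$ is a finite subset of $\{\xi<\omega_2:\mathrm{cf}(\xi)=\omega\}$; (2) $x$ is a finite set of triples $\langle\alpha,\gamma,\beta\rangle$, where $\alpha\in\Gamma$ and $\gamma<\beta<\alpha$; (3) $A$ is a finite adequate set; (4) if $\langle\alpha,\gamma,\beta\rangle$ and $\langle\alpha,\gamma',\beta'\rangle$ are distinct triples in $x$, then $[\gamma,\beta)\cap[\gamma',\beta')=\emptyset$; (5) if $\xi\in a$, $M\in A$, $\sup(M\cap\xi)=\xi$, and $M\setminus\xi\neq\emptyset$, then $\xi\in M$; (6) whenever $M\in A$, $\alpha\in M$, and $\langle\alpha,\gamma,\beta\rangle\in x$: if $M\cap[\gamma,\beta]\neq\emptyset$ then $\gamma,\beta\in M$; and if $M\cap[\gamma,\beta]=\emptyset$ then $\sup(M\cap\alpha)<\gamma$; ordered by $(b,y,B)\le(a,x,A)$ iff $a\subseteq b$, $x\subseteq y$ and $A\subseteq B$. Then $\mathbb{P}$ is $\omega_2$-c.c.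
   Context: Standing assumptions and notation. Assume $2^{\omega_1}=\omega_2$ and fix a bijection $\pi:\omega_2\to H(\omega_2)$. $P_{\omega_1}(\omega_2)$ is the set of countable subsets of $\omega_2$. Assume there is a stationary set $\mathcal{Y}\subseteq P_{\omega_1}(\omega_2)$ which is thin, i.e. for all $\beta<\omega_2$ the set $\{a\cap\beta: a\in\mathcal{Y}\}$ has size at most $\omega_1$; fix such a $\mathcal{Y}$ which is moreover closed under initial segments ($a\in\mathcal{Y}$, $\beta<\omega_2$ imply $a\cap\beta\in\mathcal{Y}$). Let $\mathcal{A}$ be the structure $(H(\omega_2),\in,\pi,\mathcal{Y})$, which has definable Skolem functions (via the well-ordering induced by $\pi$). For $a\subseteq H(\omega_2)$, $Sk(a)$ is the closure of $a$ under a fixed set of definable Skolem functions for $\mathcal{A}$. Let $C$ be the (club) set of $\beta<\omega_2$ with $Sk(\beta)\cap\omega_2=\beta$, and let $\Lambda$ be the set of $\beta<\omega_2$ of cofinality $\omega_1$ which are limit points of $C$. Let $\mathcal{X}$ be the set of $M\in\mathcal{Y}$ such that $Sk(M)\cap\omega_2=M$ and for all $\gamma\in M$, $\sup(C\cap\gamma)\in M$. Comparison points and adequacy. Fix a set $\Gamma\subseteq\Lambda$ which is stationary in $\omega_2$. For $M\in\mathcal{X}$, $\Gamma_M$ is the set of $\beta\in\Gamma$ such that $\beta=\min(\Gamma\setminus\sup(M\cap\beta))$, i.e. $\Gamma\cap[\sup(M\cap\beta),\beta)=\emptyset$. For $M,N\in\mathcal{X}$, $\Gamma_M\cap\Gamma_N$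 has a largest element, denoted $\beta_{M,N}$. A set $A\subseteq\mathcal{X}$ is adequate if for all $M,N\in A$, either $M\cap\beta_{M,N}=N\cap\beta_{M,N}$, or $M\cap\beta_{M,N}\in Sk(N)$, or $N\cap\beta_{M,N}\in Sk(M)$. A poset is $\omega_2$-c.c. if every antichain has size less than $\omega_2$. -}

module Defs where

open import Level using (Level; 0ℓ; _⊔_) renaming (suc to lsuc)
open import Data.Bool.Base using (Bool)
open import Data.Fin.Base using (Fin)
open import Data.List.Base using (List)
import Data.List.Relation.Unary.Any as List
open import Data.Nat.Base using (ℕ; zero; suc)
open import Data.Product using (Σ; Σ-syntax; ∃; ∃-syntax; _×_; _,_; proj₁; proj₂)
open import Data.Sum.Base using (_⊎_)
open import Data.Empty using (⊥)
open import Data.Vec.Base using (Vec; _∷_; lookup)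
open import Data.Vec.Relation.Unary.All using (All)
open import Function.Bundles using (Func; Injection; Bijection; _⇔_)
import Function.Relation.Binary.Setoid.Equality as FunctionSetoid
open import Relation.Binary.Bundles using (Setoid; Poset)
import Relation.Binary.Construct.On as On
open import Relation.Binary.Construct.Closure.Transitive using (TransClosure)
import Relation.Binary.PropositionalEquality.Properties as ≡
open import Relation.Nullary.Negation.Core using (¬_)
open import Relation.Unary using (Pred)

private
  variable
    u v ℓ ℓ₁ ℓ₂ : Level

------------------------------------------------------------------------
-- The universe of sets

-- Aczel's iterative sets.  Together with excluded middle and `Choice` below
-- they satisfy ZFC, and they are the universe in which everything else is
-- formulated.  Equality of sets is `_≈_`.  Classes are predicates on V.

data V : Set₁ where
  set : (I : Set) → (I → V) → V

infix 4 _≈_ _∈_ _∉_ _⊆_ _≤_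

_≈_ : V → V → Set
set I f ≈ set J g = (∀ i → ∃[ j ] f i ≈ g j) × (∀ j → ∃[ i ] f i ≈ g j)

_∈_ : V → V → Set
x ∈ set J g = ∃[ j ] x ≈ g j

_∉_ : V → V → Set
x ∉ y = ¬ (x ∈ y)

_⊆_ : V → V → Set₁
x ⊆ y = ∀ z → z ∈ x → z ∈ y

≈-refl : ∀ {x} → x ≈ x
≈-refl {set I f} = (λ i → i , ≈-refl) , (λ i → i , ≈-refl)

≈-sym : ∀ {x y} → x ≈ y → y ≈ x
≈-sym {set I f} {set J g} (p , q) =
  (λ j → proj₁ (q j) , ≈-sym (proj₂ (q j))) ,
  (λ i → proj₁ (p i) , ≈-sym (proj₂ (p i)))

≈-trans : ∀ {x y z} → x ≈ y → y ≈ z → x ≈ z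
≈-trans {set I f} {set J g} {set K h} (p , q) (r , s) =
  (λ i → let (j , e) = p i ; (k , e′) = r j in k , ≈-trans e e′) ,
  (λ k → let (j , e′) = s k ; (i , e) = q j in i , ≈-trans e e′)

∈-respʳ : ∀ {z x y} → x ≈ y → z ∈ x → z ∈ y
∈-respʳ {x = set I f} {set J g} (p , _) (i , e) =
  let (j , e′) = p i in j , ≈-trans e e′

⊆-reflexive : ∀ {x y} → x ≈ y → x ⊆ y
⊆-reflexive x≈y z = ∈-respʳ {z} x≈y

⊆-antisym : ∀ {x y} → x ⊆ y → y ⊆ x → x ≈ y
⊆-antisym {set I f} {set J g} p q =
  (λ i → p (f i) (i , ≈-refl)) ,
  (λ j → let (i , e) = q (g j) (j , ≈-refl) in i , ≈-sym e)

V-setoid : Setoid (lsuc 0ℓ) 0ℓ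
V-setoid = record
  { Carrier       = V
  ; _≈_           = _≈_
  ; isEquivalence = record
    { refl  = λ {x} → ≈-refl {x}
    ; sym   = λ {x} {y} → ≈-sym {x} {y}
    ; trans = λ {x} {y} {z} → ≈-trans {x} {y} {z}
    }
  }

-- Every set of nonempty sets has a choice function (extensional in the
-- sense of `_≈_`, hence not a consequence of the choice built into Σ).

Choice : Set₁
Choice = (X : V) → (∀ x → x ∈ X → ∃[ y ] y ∈ x) →
         Σ[ f ∈ (V → V) ] (∀ x y → x ∈ X → x ≈ y → f x ≈ f y)
                        × (∀ x → x ∈ X → f x ∈ x)

∅ : V
∅ = set ⊥ λ ()

infixr 7 _∩_
_∩_ : V → V → V
set I f ∩ y = set (Σ[ i ∈ I ] f i ∈ y) λ (i , _) → f i

⋃ : V → V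
⋃ (set I f) = set (Σ[ i ∈ I ] index (f i)) λ (i , j) → member (f i) j
  where
  index : V → Set
  index (set J _) = J
  member : (x : V) → index x → V
  member (set _ g) = g

-- Kuratowski pairs and triples.

⟅_,_⟆ : V → V → V
⟅ x , y ⟆ = set Bool λ { Bool.false → x ; Bool.true → y }

⟨_,_,_⟩ : V → V → V → V
⟨ x , y , z ⟩ = pair x (pair y z)
  where
  pair : V → V → V
  pair u v = ⟅ ⟅ u , u ⟆ , ⟅ u , v ⟆ ⟆

------------------------------------------------------------------------
-- Cardinality

-- Sizes are compared between setoids, so that sets, classes and subsets of
-- a poset can all be measured.

subset : (S : Setoid u v) → Pred (Setoid.Carrier S) ℓ → Setoid (u ⊔ ℓ) v
subset S P = On.setoid S (proj₁ {B = P})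

class : Pred V ℓ → Setoid (lsuc 0ℓ ⊔ ℓ) 0ℓ
class = subset V-setoid

elems : V → Setoid (lsuc 0ℓ) 0ℓ
elems x = class (_∈ x)

infix 4 _≼_ _≺_

_≼_ : Setoid u ℓ₁ → Setoid v ℓ₂ → Set (u ⊔ v ⊔ ℓ₁ ⊔ ℓ₂)
S ≼ T = Injection S T

_≺_ : Setoid u ℓ₁ → Setoid v ℓ₂ → Set (u ⊔ v ⊔ ℓ₁ ⊔ ℓ₂)
S ≺ T = (S ≼ T) × ¬ (T ≼ S)

Finite : V → Set₁
Finite x = Σ[ zs ∈ List V ] ∀ z → z ∈ x ⇔ List.Any (z ≈_) zs

------------------------------------------------------------------------
-- Ordinals

Transitive : V → Set₁
Transitive x = ∀ y → y ∈ x → y ⊆ x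

-- By foundation, a transitive set of transitive sets is well ordered by ∈.

Ordinal : V → Set₁
Ordinal α = Transitive α × (∀ β → β ∈ α → Transitive β)

_≤_ : V → V → Set
α ≤ β = (α ∈ β) ⊎ (α ≈ β)

ω : V
ω = set ℕ numeral
  where
  numeral : ℕ → V
  numeral zero    = ∅
  numeral (suc n) = ⋃ ⟅ numeral n , ⟅ numeral n , numeral n ⟆ ⟆

-- κ⁺ is the least ordinal of size greater than κ.

_IsSuccessorCardinalOf_ : V → V → Set₁
κ⁺ IsSuccessorCardinalOf κ =
  Ordinal κ⁺ × ¬ (elems κ⁺ ≼ elems κ) × (∀ α → α ∈ κ⁺ → elems α ≼ elems κ)

-- Functions from κ to a two-element set.

2^ : V → Setoid (lsuc 0ℓ) (lsuc 0ℓ)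
2^ κ = elems κ ⇨ ≡.setoid Bool
  where open FunctionSetoid using (_⇨_)

-- s is the supremum of the class P of ordinals, i.e. its union.  For the
-- supremum of a set of ordinals, `⋃` is used directly.

IsSup : Pred V ℓ → V → Set (lsuc 0ℓ ⊔ ℓ)
IsSup P s = ∀ z → z ∈ s ⇔ (∃[ y ] P y × z ∈ y)

LimitPoint : Pred V ℓ → V → Set (lsuc 0ℓ ⊔ ℓ)
LimitPoint P δ =
  (∃[ η ] η ∈ δ) × (∀ η → η ∈ δ → ∃[ ζ ] P ζ × ζ ∈ δ × η ∈ ζ)

Cofinal : V → V → Set₁
Cofinal κ ξ = Σ[ f ∈ Func (elems κ) (elems ξ) ]
  ∀ η → η ∈ ξ → ∃[ i ] η ≤ proj₁ (Func.to f i)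

-- cf(ξ) = κ

Cf : V → V → Set₁
Cf ξ κ = Ordinal κ × Cofinal κ ξ × (∀ μ → μ ∈ κ → ¬ Cofinal μ ξ)

Club : V → V → Set₁
Club κ D = D ⊆ κ
         × (∀ α → α ∈ κ → ∃[ β ] β ∈ D × α ∈ β)
         × (∀ δ → δ ∈ κ → LimitPoint (_∈ D) δ → δ ∈ D)

Stationary : V → V → Set₁
Stationary κ S = S ⊆ κ × (∀ D → Club κ D → ∃[ β ] β ∈ D × β ∈ S)

------------------------------------------------------------------------
-- Countable subsets

-- a ∈ P_{ω₁}(κ)

CountableSubset : V → V → Set₁
CountableSubset κ a = a ⊆ κ × (elems a ≼ elems ω)

ClubCountable : V → V → Set₁
ClubCountable κ D =
    (∀ a → a ∈ D → CountableSubset κ a)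
  × (∀ a → CountableSubset κ a → ∃[ b ] b ∈ D × a ⊆ b)
  × ((F : ℕ → V) → (∀ n → F n ∈ D) → (∀ n → F n ⊆ F (suc n)) → ⋃ (set ℕ F) ∈ D)

StationaryCountable : V → V → Set₁
StationaryCountable κ S =
    (∀ a → a ∈ S → CountableSubset κ a)
  × (∀ D → ClubCountable κ D → ∃[ a ] a ∈ D × a ∈ S)

Thin : (ω₁ ω₂ 𝒴 : V) → Set₁
Thin ω₁ ω₂ 𝒴 = ∀ β → β ∈ ω₂ →
  class (λ b → ∃[ a ] a ∈ 𝒴 × b ≈ a ∩ β) ≼ elems ω₁

ClosedUnderInitialSegments : (ω₂ 𝒴 : V) → Set₁
ClosedUnderInitialSegments ω₂ 𝒴 = ∀ a β → a ∈ 𝒴 → β ∈ ω₂ → a ∩ β ∈ 𝒴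

------------------------------------------------------------------------
-- H(κ), the sets whose transitive closure has size less than κ

H : V → Pred V (lsuc 0ℓ)
H κ x = class (λ z → TransClosure _∈_ z x) ≺ elems κ

------------------------------------------------------------------------
-- Chain conditions

module _ {c ℓ₁ ℓ₂} (ℙ : Poset c ℓ₁ ℓ₂) where
  private module ℙ = Poset ℙ

  Compatible : ℙ.Carrier → ℙ.Carrier → Set (c ⊔ ℓ₂)
  Compatible p q = ∃[ r ] r ℙ.≤ p × r ℙ.≤ q

  Antichain : Pred ℙ.Carrier ℓ → Set (c ⊔ ℓ₁ ⊔ ℓ₂ ⊔ ℓ)
  Antichain P = ∀ p q → P p → P q → ¬ (p ℙ.≈ q) → ¬ Compatible p q

  -- Antichains range over predicates at the level of the carrier.

  ChainCondition : V → Set (lsuc 0ℓ ⊔ lsuc c ⊔ ℓ₁ ⊔ ℓ₂)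
  ChainCondition κ = (P : Pred ℙ.Carrier c) → Antichain P →
                     subset ℙ.Eq.setoid P ≺ elems κ

------------------------------------------------------------------------
-- First-order formulas in the language of (H(ω₂), ∈, π, 𝒴)

-- Variables are de Bruijn indices; π is a binary relation symbol
-- interpreted by the graph of π, and 𝒴 a unary one.

data Formula : ℕ → Set where
  _∈′_ _≐_ _π↦_ : ∀ {n} → Fin n → Fin n → Formula n
  𝒴′            : ∀ {n} → Fin n → Formula n
  ¬′_           : ∀ {n} → Formula n → Formula n
  _∧′_          : ∀ {n} → Formula n → Formula n → Formula n
  ∃′_           : ∀ {n} → Formula (suc n) → Formula n

module Structure (ω₁ ω₂ : V) (π : Bijection (elems ω₂) (class (H ω₂))) (𝒴 : V) where

  infix 4 _π↦ⱽ_ _<π_ _⊨_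

  _π↦ⱽ_ : V → V → Set
  α π↦ⱽ x = Σ[ α∈ω₂ ∈ α ∈ ω₂ ] proj₁ (Bijection.to π (α , α∈ω₂)) ≈ x

  _<π_ : V → V → Set₁
  x <π y = ∃[ α ] ∃[ β ] α π↦ⱽ x × β π↦ⱽ y × α ∈ β

  _⊨_ : ∀ {n} → Vec V n → Formula n → Set₁
  ρ ⊨ (i ∈′ j)  = Level.Lift (lsuc 0ℓ) (lookup ρ i ∈ lookup ρ j)
  ρ ⊨ (i ≐ j)   = Level.Lift (lsuc 0ℓ) (lookup ρ i ≈ lookup ρ j)
  ρ ⊨ (i π↦ j)  = Level.Lift (lsuc 0ℓ) (lookup ρ i π↦ⱽ lookup ρ j)
  ρ ⊨ 𝒴′ i      = Level.Lift (lsuc 0ℓ) (lookup ρ i ∈ 𝒴)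
  ρ ⊨ (¬′ φ)    = ¬ (ρ ⊨ φ)
  ρ ⊨ (φ ∧′ ψ)  = (ρ ⊨ φ) × (ρ ⊨ ψ)
  ρ ⊨ (∃′ φ)    = ∃[ x ] H ω₂ x × (x ∷ ρ ⊨ φ)

  -- The graph of the Skolem function of φ(x, ρ): its value is the <π-least
  -- witness x, or ∅ if there is none.

  Skolem : ∀ {n} → Formula (suc n) → Vec V n → V → Set₁
  Skolem φ ρ x =
      (H ω₂ x × (x ∷ ρ ⊨ φ) × (∀ z → H ω₂ z → (z ∷ ρ ⊨ φ) → ¬ (z <π x)))
    ⊎ (¬ (ρ ⊨ (∃′ φ)) × x ≈ ∅)

  data Sk (a : V) : Pred V (lsuc 0ℓ) where
    base : ∀ {x} → x ∈ a → Sk a x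
    step : ∀ {n x} (φ : Formula (suc n)) (ρ : Vec V n) →
           All (Sk a) ρ → Skolem φ ρ x → Sk a x

  -- Sk(a) ∩ ω₂ = a

  SkClosed : V → Set₁
  SkClosed a = ∀ ξ → (Sk a ξ × ξ ∈ ω₂) ⇔ ξ ∈ a

  C : Pred V (lsuc 0ℓ)
  C β = β ∈ ω₂ × SkClosed β

  Λ : Pred V (lsuc 0ℓ)
  Λ β = β ∈ ω₂ × Cf β ω₁ × LimitPoint C β

  𝒳 : Pred V (lsuc 0ℓ)
  𝒳 M = M ∈ 𝒴 × SkClosed M
      × (∀ γ → γ ∈ M → ∃[ s ] s ∈ M × IsSup (λ β → C β × β ∈ γ) s)

  module Forcing (Γ : V) where

    Γ[_] : V → Pred V (lsuc 0ℓ)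
    Γ[ M ] β = β ∈ Γ × (∀ ζ → ζ ∈ Γ → ⋃ (M ∩ β) ≤ ζ → ζ ∉ β)

    -- β = β_{M,N}

    ComparisonPoint : V → V → V → Set₁
    ComparisonPoint M N β = (Γ[ M ] β × Γ[ N ] β)
                          × (∀ ζ → Γ[ M ] ζ → Γ[ N ] ζ → ζ ≤ β)

    Adequate : V → Set₁
    Adequate A =
        (∀ M → M ∈ A → 𝒳 M)
      × (∀ M N → M ∈ A → N ∈ A → ∃[ β ] ComparisonPoint M N β
           × ((M ∩ β ≈ N ∩ β) ⊎ Sk N (M ∩ β) ⊎ Sk M (N ∩ β)))

    -- M ∩ [γ, β] ≠ ∅

    Meets : V → V → V → Set₁
    Meets M γ β = ∃[ ζ ] ζ ∈ M × γ ≤ ζ × ζ ≤ β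

    record Condition : Set₁ where
      field
        a x A : V
        a-finite   : Finite a
        a-cof      : ∀ ξ → ξ ∈ a → ξ ∈ ω₂ × Cf ξ ω
        x-finite   : Finite x
        x-triples  : ∀ t → t ∈ x → ∃[ α ] ∃[ γ ] ∃[ β ]
                     t ≈ ⟨ α , γ , β ⟩ × α ∈ Γ × γ ∈ β × β ∈ α
        A-finite   : Finite A
        A-adequate : Adequate A
        x-disjoint : ∀ α γ β γ′ β′ →
                     ⟨ α , γ , β ⟩ ∈ x → ⟨ α , γ′ , β′ ⟩ ∈ x →
                     ¬ (⟨ α , γ , β ⟩ ≈ ⟨ α , γ′ , β′ ⟩) →
                     ∀ ζ → ¬ ((γ ≤ ζ × ζ ∈ β) × (γ′ ≤ ζ × ζ ∈ β′))
        a-A        : ∀ ξ M → ξ ∈ a → M ∈ A → ⋃ (M ∩ ξ) ≈ ξ →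
                     (∃[ ζ ] ζ ∈ M × ζ ∉ ξ) → ξ ∈ M
        x-A        : ∀ M α γ β → M ∈ A → α ∈ M → ⟨ α , γ , β ⟩ ∈ x →
                     (Meets M γ β → γ ∈ M × β ∈ M)
                   × (¬ Meets M γ β → ⋃ (M ∩ α) ∈ γ)

    ℙ : Poset (lsuc 0ℓ) 0ℓ (lsuc 0ℓ)
    ℙ = record
      { Carrier        = Condition
      ; _≈_            = λ p q → a p ≈ a q × x p ≈ x q × A p ≈ A q
      ; _≤_            = λ q p → a p ⊆ a q × x p ⊆ x q × A p ⊆ A q
      ; isPartialOrder = record
        { isPreorder = record
          { isEquivalence = record
            { refl  = λ {p} → ≈-refl {a p} , ≈-refl {x p} , ≈-refl {A p}
            ; sym   = λ {p} {q} (e , f , g) →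
                ≈-sym {a p} {a q} e , ≈-sym {x p} {x q} f , ≈-sym {A p} {A q} g
            ; trans = λ {p} {q} {r} (e , f , g) (e′ , f′ , g′) →
                ≈-trans {a p} {a q} {a r} e e′ ,
                ≈-trans {x p} {x q} {x r} f f′ ,
                ≈-trans {A p} {A q} {A r} g g′
            }
          ; reflexive = λ {p} {q} (e , f , g) →
              ⊆-reflexive (≈-sym {a p} {a q} e) ,
              ⊆-reflexive (≈-sym {x p} {x q} f) ,
              ⊆-reflexive (≈-sym {A p} {A q} g)
          ; trans = λ (i , j , k) (i′ , j′ , k′) →
              (λ z m → i z (i′ z m)) , (λ z m → j z (j′ z m)) , (λ z m → k z (k′ z m))
          }
        ; antisym = λ (i , j , k) (i′ , j′ , k′) →
            ⊆-antisym i′ i , ⊆-antisym j′ j , ⊆-antisym k′ k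
        }
      }
      where open Condition

module Submission where

-- Suppose that ω₂ many conditions p_i were pairwise incompatible.  For i in Γ
-- let the trace of p_i consist of a ∩ i, the triples of x with first
-- coordinate below i, and the sets M ∩ i for M in A.  As cf(i) = ω₁, each M ∩ i
-- is bounded in i, so by thinness the π-codes of these sets are below i for club
-- many i; since Sk(i) ∩ ω₂ = i, the code of the trace is then below i as well.
-- By pressing down, many i share one trace.  Pick two of them, i < j, where j is
-- above everything occurring in p_i.  The union of p_i and p_j is a condition:
-- all requirements relating the two parts refer to the common trace, except for
-- the adequacy of M from p_i and N from p_j.  If N′ from p_i has the same trace
-- as N, then Γ_M ∩ Γ_N has a largest element β ≤ i, which is at most β_{M,N′}, and
-- the comparison of M with N′ restricts to β and transfers to N.

open import Axiom.ExcludedMiddle using (ExcludedMiddle)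
open import Data.Bool.Base using (true; false; T)
open import Data.Empty using (⊥; ⊥-elim)
open import Data.Fin.Base using (Fin; zero; suc)
open import Data.List.Base using ([]; _∷_; map; _++_)
import Data.List.Relation.Unary.Any as Any
import Data.List.Relation.Unary.Any.Properties as Any
import Data.Nat.Base as ℕ
open import Data.Nat.Base using (ℕ; zero; suc)
import Data.Nat.Properties as ℕ
open import Data.Product using (Σ; Σ-syntax; ∃-syntax; _×_; _,_; proj₁; proj₂)
open import Data.Sum.Base using (_⊎_; inj₁; inj₂; [_,_]′; reduce)
open import Data.Unit.Base using (⊤)
open import Data.Vec.Base using (Vec; []; _∷_; lookup)
open import Data.Vec.Relation.Unary.All using (All; []; _∷_)
open import Function.Bundles using (Injection; Func; mk⇔; Equivalence; Bijection)
import Function.Construct.Composition as Composition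
open import Level using (Level; 0ℓ; Lift; lift; lower) renaming (suc to lsuc)
open import Relation.Binary.Bundles using (Poset)
open import Relation.Binary.Construct.Closure.Transitive using (TransClosure; [_]; _∷_; _∷ʳ_)
open import Relation.Binary.Definitions using (tri<; tri≈; tri>)
open import Relation.Binary.PropositionalEquality.Core using (_≡_; refl; cong; sym)
open import Relation.Nullary using (¬_; Dec; yes; no; does)
open import Relation.Unary using (Pred)
open import Defs

-- Two models with the same trace agree only below i, so a set cannot be moved directly from Sk(N′)
-- to Sk(N); only ordinals below i can. Sets are therefore exchanged for their `π`-codes. This is
-- why the traced i are asked to bound codes of cuts and why i should be a limit point of `C`: a
-- hull is generated finitarily, so Sk(i) adds no new ordinals. Restricting a comparison from
-- β_{M,N′} to β cuts a countable element of a hull at an ordinal that the hull may lack. This rests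
-- on countable elements of a hull being subsets of it, which is proved from explicit first-order
-- definitions of ω and of enumerations, since hulls are closed only under Skolem functions of
-- formulas. Adequacy asks for the comparison point as a witness, so for the new pairs its existence
-- has to be proved too. Pressing down is carried out by hand. It needs only regularity of ω₂, which
-- is derived from the definition of successor cardinals through an injection of ω₁ × ω₁ into ω₁.

-- Elementary set theory of iterative sets up to `≈`.

module Sets where

  private
    variable
      ℓ : Level
      x x′ y y′ z z′ : V

  idx : V → Set
  idx (set I _) = I

  mem : (x : V) → idx x → V
  mem (set _ f) = f

  mem-∈ : ∀ x i → mem x i ∈ x
  mem-∈ (set I f) i = i , ≈-refl

  ∈-respˡ : ∀ z → x ≈ y → x ∈ z → y ∈ z
  ∈-respˡ (set J g) x≈y (j , e) = j , ≈-trans (≈-sym x≈y) e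

  -- Members of a set are only `≈` to its indexed values, so the structural recursion on `x` carries
  -- every `y ≈ x` along; `P` itself is not assumed to respect `≈`.
  ∈-ind : (P : Pred V ℓ) → (∀ x → (∀ y → y ∈ x → P y) → P x) → ∀ x → P x
  ∈-ind P h x = go x x ≈-refl
    where
    go : ∀ x y → y ≈ x → P y
    go (set I f) y y≈x = h y λ z z∈y →
      let (i , e) = ∈-respʳ y≈x z∈y in go (f i) z e

  ∈-irrefl : ∀ x → x ∉ x
  ∈-irrefl = ∈-ind (λ x → x ∉ x) λ x ih x∈x → ih x x∈x x∈x

  ∈-asym : ∀ x y → x ∈ y → y ∉ x
  ∈-asym = ∈-ind _ λ x ih y x∈y y∈x → ih y y∈x x y∈x x∈y

  ∉∅ : ∀ z → z ∉ ∅
  ∉∅ z (() , _)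

  module _ {I : Set} (f : I → V) where

    ∈-⋃set⁻ : z ∈ ⋃ (set I f) → ∃[ i ] z ∈ f i
    ∈-⋃set⁻ {z} ((i , j) , e) = i , go j e
      where
      go : ∀ j → z ≈ mem (⋃ (set I f)) (i , j) → z ∈ f i
      go with f i
      ... | set K g = λ j e → j , e

    ∈-⋃set⁺ : ∀ i → z ∈ f i → z ∈ ⋃ (set I f)
    ∈-⋃set⁺ {z} i z∈fi = let (j , e) = go z∈fi in (i , j) , e
      where
      go : z ∈ f i → ∃[ j ] z ≈ mem (⋃ (set I f)) (i , j)
      go with f i
      ... | set K g = λ p → p

  ∈-⋃⁻ : ∀ x → z ∈ ⋃ x → ∃[ y ] z ∈ y × y ∈ x
  ∈-⋃⁻ (set I f) p = let (i , q) = ∈-⋃set⁻ f p in f i , q , i , ≈-refl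

  ∈-⋃⁺ : ∀ x → z ∈ y → y ∈ x → z ∈ ⋃ x
  ∈-⋃⁺ (set I f) z∈y (i , e) = ∈-⋃set⁺ f i (∈-respʳ e z∈y)

  ⋃-cong : x ≈ y → ⋃ x ≈ ⋃ y
  ⋃-cong {x} {y} e = ⊆-antisym
    (λ z p → let (w , a , b) = ∈-⋃⁻ x p in ∈-⋃⁺ y a (∈-respʳ e b))
    (λ z p → let (w , a , b) = ∈-⋃⁻ y p in ∈-⋃⁺ x a (∈-respʳ (≈-sym e) b))

  ∈-∩⁻ : ∀ x y → z ∈ x ∩ y → z ∈ x × z ∈ y
  ∈-∩⁻ (set I f) y ((i , q) , e) = (i , e) , ∈-respˡ y (≈-sym e) q

  ∈-∩⁺ : ∀ x y → z ∈ x → z ∈ y → z ∈ x ∩ y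
  ∈-∩⁺ (set I f) y (i , e) q = (i , ∈-respˡ y e q) , e

  ∩-cong : x ≈ x′ → y ≈ y′ → x ∩ y ≈ x′ ∩ y′
  ∩-cong {x} {x′} {y} {y′} e e′ = ⊆-antisym
    (λ z p → let (a , b) = ∈-∩⁻ x y p in ∈-∩⁺ x′ y′ (∈-respʳ e a) (∈-respʳ e′ b))
    (λ z p → let (a , b) = ∈-∩⁻ x′ y′ p in
      ∈-∩⁺ x y (∈-respʳ (≈-sym e) a) (∈-respʳ (≈-sym e′) b))

  ∈-⟅⟆⁻ : ∀ x y → z ∈ ⟅ x , y ⟆ → z ≈ x ⊎ z ≈ y
  ∈-⟅⟆⁻ x y (false , e) = inj₁ e
  ∈-⟅⟆⁻ x y (true , e)  = inj₂ e

  ∈-⟅⟆ˡ : ∀ x y → z ≈ x → z ∈ ⟅ x , y ⟆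
  ∈-⟅⟆ˡ x y e = false , e

  ∈-⟅⟆ʳ : ∀ x y → z ≈ y → z ∈ ⟅ x , y ⟆
  ∈-⟅⟆ʳ x y e = true , e

  ⟅⟆-cong : x ≈ x′ → y ≈ y′ → ⟅ x , y ⟆ ≈ ⟅ x′ , y′ ⟆
  ⟅⟆-cong e e′ = (λ { false → false , e ; true → true , e′ })
               , (λ { false → false , e ; true → true , e′ })

  abstract
    infixr 6 _∪_
    _∪_ : V → V → V
    x ∪ y = ⋃ ⟅ x , y ⟆

    ∈-∪⁻ : ∀ x y → z ∈ x ∪ y → z ∈ x ⊎ z ∈ y
    ∈-∪⁻ x y p with ∈-⋃⁻ ⟅ x , y ⟆ p
    ... | w , a , (false , e) = inj₁ (∈-respʳ e a)
    ... | w , a , (true , e)  = inj₂ (∈-respʳ e a)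

    ∈-∪ˡ : ∀ x y → z ∈ x → z ∈ x ∪ y
    ∈-∪ˡ x y p = ∈-⋃⁺ ⟅ x , y ⟆ p (false , ≈-refl {x})

    ∈-∪ʳ : ∀ x y → z ∈ y → z ∈ x ∪ y
    ∈-∪ʳ x y p = ∈-⋃⁺ ⟅ x , y ⟆ p (true , ≈-refl {y})

    -- Adjunction of the single element `y` to `x`. Finite sets, pairs, triples and numerals all
    -- arise from `∅` by it, so a property of sets is checked for `∅` and `cons` and then extends to
    -- all of these.
    cons : V → V → V
    cons x y = x ∪ ⟅ y , y ⟆

    ∈-cons⁻ : ∀ x y → z ∈ cons x y → z ∈ x ⊎ z ≈ y
    ∈-cons⁻ x y p with ∈-∪⁻ x ⟅ y , y ⟆ p
    ... | inj₁ q = inj₁ q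
    ... | inj₂ q = inj₂ (reduce (∈-⟅⟆⁻ y y q))

    ∈-consˡ : ∀ x y → z ∈ x → z ∈ cons x y
    ∈-consˡ x y = ∈-∪ˡ x ⟅ y , y ⟆

    ∈-consʳ : ∀ x y → z ≈ y → z ∈ cons x y
    ∈-consʳ x y e = ∈-∪ʳ x ⟅ y , y ⟆ (∈-⟅⟆ˡ y y e)

    numeral-suc : ∀ n → mem ω (suc n) ≈ cons (mem ω n) (mem ω n)
    numeral-suc n = ≈-refl {mem ω (suc n)}

  cons-cong : x ≈ x′ → y ≈ y′ → cons x y ≈ cons x′ y′
  cons-cong {x} {x′} {y} {y′} e f = ⊆-antisym
    (λ z p → [ (λ q → ∈-consˡ x′ y′ (∈-respʳ e q)) , (λ q → ∈-consʳ x′ y′ (≈-trans q f)) ]′ (∈-cons⁻ x y p))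
    (λ z p → [ (λ q → ∈-consˡ x y (∈-respʳ (≈-sym e) q)) , (λ q → ∈-consʳ x y (≈-trans q (≈-sym f))) ]′
               (∈-cons⁻ x′ y′ p))

  ⟅⟆≈cons : ∀ x y → ⟅ x , y ⟆ ≈ cons (cons ∅ x) y
  ⟅⟆≈cons x y = ⊆-antisym {⟅ x , y ⟆}
    (λ z p → [ (λ e → ∈-consˡ (cons ∅ x) y (∈-consʳ ∅ x e)) , ∈-consʳ (cons ∅ x) y ]′ (∈-⟅⟆⁻ x y p))
    (λ z p → [ (λ q → [ (λ m → ⊥-elim (∉∅ z m)) , ∈-⟅⟆ˡ x y ]′ (∈-cons⁻ ∅ x q)) , ∈-⟅⟆ʳ x y ]′
               (∈-cons⁻ (cons ∅ x) y p))

  S : V → V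
  S x = cons x x

  S-cong : x ≈ y → S x ≈ S y
  S-cong e = cons-cong e e

  ∈-S : ∀ x → x ∈ S x
  ∈-S x = ∈-consʳ x x ≈-refl

  abstract
    opair : V → V → V
    opair x y = ⟅ ⟅ x , x ⟆ , ⟅ x , y ⟆ ⟆

    opair-def : ∀ x y → opair x y ≈ ⟅ ⟅ x , x ⟆ , ⟅ x , y ⟆ ⟆
    opair-def x y = ≈-refl {opair x y}

    ⟨⟩-def : ∀ x y z → ⟨ x , y , z ⟩ ≈ opair x (opair y z)
    ⟨⟩-def x y z = ≈-refl {⟨ x , y , z ⟩}

    opair-cong : x ≈ x′ → y ≈ y′ → opair x y ≈ opair x′ y′
    opair-cong {x} {x′} {y} {y′} e f =
      ⟅⟆-cong {⟅ x , x ⟆} {⟅ x′ , x′ ⟆} (⟅⟆-cong e e) (⟅⟆-cong e f)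

    private
      ∈-opair⁻ : ∀ x y → z ∈ opair x y → ∀ w → w ∈ z → w ≈ x ⊎ w ≈ y
      ∈-opair⁻ {z} x y (false , e) w p = inj₁ (reduce (∈-⟅⟆⁻ x x (∈-respʳ {w} {z} {⟅ x , x ⟆} e p)))
      ∈-opair⁻ {z} x y (true , e) w p = ∈-⟅⟆⁻ x y (∈-respʳ {w} {z} {⟅ x , y ⟆} e p)

    opair-injˡ : ∀ x y x′ y′ → opair x y ≈ opair x′ y′ → x ≈ x′
    opair-injˡ x y x′ y′ (p , _) with p false
    ... | false , (_ , q) with q false
    ...   | false , e = e
    ...   | true  , e = e
    opair-injˡ x y x′ y′ (p , _) | true , (_ , q) with q false
    ...   | false , e = e
    ...   | true  , e = e

    opair-injʳ : ∀ x y x′ y′ → opair x y ≈ opair x′ y′ → y ≈ y′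
    opair-injʳ x y x′ y′ e = [ left , (λ a → a) ]′ yin
      where
      x≈x′ : x ≈ x′
      x≈x′ = opair-injˡ x y x′ y′ e
      yin : y ≈ x′ ⊎ y ≈ y′
      yin = ∈-opair⁻ {⟅ x , y ⟆} x′ y′ (proj₁ e true) y (true , ≈-refl {y})
      y′in : y′ ≈ x ⊎ y′ ≈ y
      y′in = ∈-opair⁻ {⟅ x′ , y′ ⟆} x y (let (b , q) = proj₂ e true in b , ≈-sym {mem (opair x y) b} q)
               y′ (true , ≈-refl {y′})
      left : y ≈ x′ → y ≈ y′
      left a with y′in
      ... | inj₁ b = ≈-trans a (≈-trans (≈-sym x≈x′) (≈-sym b))
      ... | inj₂ b = ≈-sym b

  ⟨⟩-cong : x ≈ x′ → y ≈ y′ → z ≈ z′ → ⟨ x , y , z ⟩ ≈ ⟨ x′ , y′ , z′ ⟩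
  ⟨⟩-cong {x} {x′} {y} {y′} {z} {z′} e f g =
    ≈-trans {⟨ x , y , z ⟩} {opair x (opair y z)} {⟨ x′ , y′ , z′ ⟩} (⟨⟩-def x y z)
      (≈-trans {y = opair x′ (opair y′ z′)} (opair-cong e (opair-cong f g))
        (≈-sym {⟨ x′ , y′ , z′ ⟩} (⟨⟩-def x′ y′ z′)))

  ⟨⟩-inj : ∀ x y z x′ y′ z′ → ⟨ x , y , z ⟩ ≈ ⟨ x′ , y′ , z′ ⟩ → x ≈ x′ × y ≈ y′ × z ≈ z′
  ⟨⟩-inj x y z x′ y′ z′ e =
      opair-injˡ x (opair y z) x′ (opair y′ z′) f
    , opair-injˡ y z y′ z′ g , opair-injʳ y z y′ z′ g
    where
    f : opair x (opair y z) ≈ opair x′ (opair y′ z′)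
    f = ≈-trans (≈-sym {⟨ x , y , z ⟩} (⟨⟩-def x y z))
          (≈-trans {⟨ x , y , z ⟩} {⟨ x′ , y′ , z′ ⟩} e (⟨⟩-def x′ y′ z′))
    g : opair y z ≈ opair y′ z′
    g = opair-injʳ x (opair y z) x′ (opair y′ z′) f

  img : (V → V) → V → V
  img h (set I f) = set I λ i → h (f i)

  ∈-img⁻ : ∀ h x → z ∈ img h x → ∃[ y ] y ∈ x × z ≈ h y
  ∈-img⁻ h (set I f) (i , e) = f i , (i , ≈-refl) , e

  ∈-img⁺ : ∀ h x → (∀ {y y′} → y ∈ x → y′ ∈ x → y ≈ y′ → h y ≈ h y′) →
           y ∈ x → z ≈ h y → z ∈ img h x
  ∈-img⁺ h (set I f) ext (i , e) e′ = i , ≈-trans e′ (ext (i , e) (i , ≈-refl) e)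

  infix 4 _∈⁺_
  _∈⁺_ : V → V → Set₁
  _∈⁺_ = TransClosure _∈_

  ∈⁺⁻ : z ∈⁺ x → z ∈ x ⊎ (∃[ y ] z ∈⁺ y × y ∈ x)
  ∈⁺⁻ [ p ] = inj₁ p
  ∈⁺⁻ (p ∷ q) with ∈⁺⁻ q
  ... | inj₁ r = inj₂ (_ , [ p ] , r)
  ... | inj₂ (y , r , s) = inj₂ (y , p ∷ r , s)

  Transitive-∈⁺ : Transitive x → z ∈⁺ x → z ∈ x
  Transitive-∈⁺ t [ p ] = p
  Transitive-∈⁺ t (p ∷ q) = t _ (Transitive-∈⁺ t q) _ p

  Transitive-resp : x ≈ y → Transitive x → Transitive y
  Transitive-resp e t z z∈y w w∈z = ∈-respʳ e (t z (∈-respʳ (≈-sym e) z∈y) w w∈z)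

  numeral : ℕ → V
  numeral n = mem ω n

  numeral∈ω : ∀ n → numeral n ∈ ω
  numeral∈ω n = n , ≈-refl {numeral n}

-- Separation, ordinals, least elements and finite sets under excluded middle.

module Ordinals (lem : ExcludedMiddle (lsuc 0ℓ)) where

  open Sets

  private
    variable
      a : Level
      x y z α β γ κ : V

  em : (P : Set₁) → P ⊎ ¬ P
  em P with lem {P}
  ... | yes p = inj₁ p
  ... | no ¬p = inj₂ ¬p

  em₀ : (P : Set) → P ⊎ ¬ P
  em₀ P with em (Lift (lsuc 0ℓ) P)
  ... | inj₁ (lift p) = inj₁ p
  ... | inj₂ ¬p = inj₂ λ p → ¬p (lift p)

  dne : {P : Set₁} → ¬ ¬ P → P
  dne {P} ¬¬p = [ (λ p → p) , (λ ¬p → ⊥-elim (¬¬p ¬p)) ]′ (em P)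

  dne₀ : {P : Set} → ¬ ¬ P → P
  dne₀ {P} ¬¬p = [ (λ p → p) , (λ ¬p → ⊥-elim (¬¬p ¬p)) ]′ (em₀ P)

  Resp : Pred V a → Set _
  Resp P = ∀ {x y} → x ≈ y → P x → P y

  abstract
    -- A `Set₁`-valued predicate cannot index a small set; excluded middle first reduces it to a
    -- Boolean.
    sep : V → Pred V (lsuc 0ℓ) → V
    sep (set I f) P = set (Σ[ i ∈ I ] T (does (lem {P (f i)}))) λ (i , _) → f i

    ∈-sep⁻ : ∀ x (P : Pred V (lsuc 0ℓ)) → Resp P → z ∈ sep x P → z ∈ x × P z
    ∈-sep⁻ (set I f) P rP ((i , t) , e) with lem {P (f i)} | t
    ... | yes p | _ = (i , e) , rP (≈-sym e) p

    ∈-sep⁺ : ∀ x (P : Pred V (lsuc 0ℓ)) → Resp P → z ∈ x → P z → z ∈ sep x P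
    ∈-sep⁺ (set I f) P rP (i , e) p = (i , does-true lem (rP e p)) , e
      where
      does-true : {A : Set₁} (d : Dec A) → A → T (does d)
      does-true (yes _) _ = _
      does-true (no ¬a) x = ¬a x

  -- The union of the singleton { x ∈ X ∣ P x }; junk if that is not a singleton.
  ι : V → Pred V (lsuc 0ℓ) → V
  ι X P = ⋃ (sep X P)

  module _ (X : V) (P : Pred V (lsuc 0ℓ)) (rP : Resp P) where

    ι-spec : z ∈ X → P z → (∀ w → w ∈ X → P w → w ≈ z) → ι X P ≈ z
    ι-spec {z} z∈X pz uniq = ⊆-antisym
      (λ v v∈ → let (w , v∈w , w∈) = ∈-⋃⁻ (sep X P) v∈
                    (w∈X , pw) = ∈-sep⁻ X P rP w∈
                in ∈-respʳ (uniq w w∈X pw) v∈w)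
      (λ v v∈z → ∈-⋃⁺ (sep X P) v∈z (∈-sep⁺ X P rP z∈X pz))

  ι-cong : ∀ X (P Q : Pred V (lsuc 0ℓ)) → Resp P → Resp Q →
           (∀ z → P z → Q z) → (∀ z → Q z → P z) → ι X P ≈ ι X Q
  ι-cong X P Q rP rQ f g = ⋃-cong (⊆-antisym
    (λ z m → let (p , q) = ∈-sep⁻ X P rP m in ∈-sep⁺ X Q rQ p (f z q))
    (λ z m → let (p , q) = ∈-sep⁻ X Q rQ m in ∈-sep⁺ X P rP p (g z q)))

  Ordinal-∈ : Ordinal α → β ∈ α → Ordinal β
  Ordinal-∈ (t , h) β∈α = h _ β∈α , λ γ γ∈β → h γ (t _ β∈α γ γ∈β)

  Ordinal-resp : x ≈ y → Ordinal x → Ordinal y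
  Ordinal-resp e (t , h) = Transitive-resp e t , λ β β∈y → h β (∈-respʳ (≈-sym e) β∈y)

  trichotomy : ∀ α β → Ordinal α → Ordinal β → α ∈ β ⊎ α ≈ β ⊎ β ∈ α
  trichotomy = ∈-ind _ λ α ihα → ∈-ind _ λ β ihβ oα oβ → step α β ihα ihβ oα oβ
    where
    step : ∀ α β →
      (∀ γ → γ ∈ α → ∀ β → Ordinal γ → Ordinal β → γ ∈ β ⊎ γ ≈ β ⊎ β ∈ γ) →
      (∀ δ → δ ∈ β → Ordinal α → Ordinal δ → α ∈ δ ⊎ α ≈ δ ⊎ δ ∈ α) →
      Ordinal α → Ordinal β → α ∈ β ⊎ α ≈ β ⊎ β ∈ α
    step α β ihα ihβ oα oβ with em (∃[ γ ] γ ∈ α × γ ∉ β)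
    ... | inj₁ (γ , γ∈α , γ∉β) with ihα γ γ∈α β (Ordinal-∈ oα γ∈α) oβ
    ...   | inj₁ p = ⊥-elim (γ∉β p)
    ...   | inj₂ (inj₁ p) = inj₂ (inj₂ (∈-respˡ α p γ∈α))
    ...   | inj₂ (inj₂ p) = inj₂ (inj₂ (proj₁ oα γ γ∈α β p))
    step α β ihα ihβ oα oβ | inj₂ α⊆β with em (∃[ δ ] δ ∈ β × δ ∉ α)
    ... | inj₁ (δ , δ∈β , δ∉α) with ihβ δ δ∈β oα (Ordinal-∈ oβ δ∈β)
    ...   | inj₁ p = inj₁ (proj₁ oβ δ δ∈β α p)
    ...   | inj₂ (inj₁ p) = inj₁ (∈-respˡ β (≈-sym p) δ∈β)
    ...   | inj₂ (inj₂ p) = ⊥-elim (δ∉α p)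
    step α β ihα ihβ oα oβ | inj₂ α⊆β | inj₂ β⊆α = inj₂ (inj₁ (⊆-antisym
      (λ z z∈α → dne₀ λ z∉β → α⊆β (z , z∈α , z∉β))
      (λ z z∈β → dne₀ λ z∉α → β⊆α (z , z∈β , z∉α))))

  ≤⇒⊆ : Ordinal β → α ≤ β → α ⊆ β
  ≤⇒⊆ (t , _) (inj₁ p) = t _ p
  ≤⇒⊆ _       (inj₂ e) = ⊆-reflexive e

  ≮⇒≥ : Ordinal α → Ordinal β → α ∉ β → β ≤ α
  ≮⇒≥ {α} {β} oα oβ α∉β with trichotomy α β oα oβ
  ... | inj₁ p = ⊥-elim (α∉β p)
  ... | inj₂ (inj₁ e) = inj₂ (≈-sym e)
  ... | inj₂ (inj₂ p) = inj₁ p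

  ⊆⇒≤ : Ordinal α → Ordinal β → α ⊆ β → α ≤ β
  ⊆⇒≤ {α} {β} oα oβ α⊆β = ≮⇒≥ oβ oα λ β∈α → ∈-irrefl β (α⊆β β β∈α)

  ≤⇒≯ : Ordinal β → α ≤ β → β ∉ α
  ≤⇒≯ {β} {α} oβ α≤β β∈α = ∈-irrefl β (≤⇒⊆ oβ α≤β β β∈α)

  ∈-≤-trans : Ordinal γ → α ∈ β → β ≤ γ → α ∈ γ
  ∈-≤-trans oγ p q = ≤⇒⊆ oγ q _ p

  ≤-∈-trans : Ordinal γ → α ≤ β → β ∈ γ → α ∈ γ
  ≤-∈-trans (t , _) (inj₁ p) q = t _ q _ p
  ≤-∈-trans {γ} _   (inj₂ e) q = ∈-respˡ γ (≈-sym e) q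

  ⋃-Ordinal : ∀ x → (∀ y → y ∈ x → Ordinal y) → Ordinal (⋃ x)
  ⋃-Ordinal x h =
      (λ y y∈ w w∈y → let (v , y∈v , v∈x) = ∈-⋃⁻ x y∈ in ∈-⋃⁺ x (proj₁ (h v v∈x) y y∈v w w∈y) v∈x)
    , (λ y y∈ → let (v , y∈v , v∈x) = ∈-⋃⁻ x y∈ in proj₂ (h v v∈x) y y∈v)

  S≉∅ : ∀ x → ¬ (S x ≈ ∅)
  S≉∅ x e = ∉∅ x (∈-respʳ {x} {S x} {∅} e (∈-S x))

  S-injective : ∀ x y → S x ≈ S y → x ≈ y
  S-injective x y e with ∈-cons⁻ y y (∈-respʳ e (∈-S x)) | ∈-cons⁻ x x (∈-respʳ (≈-sym e) (∈-S y))
  ... | inj₂ p | _ = p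
  ... | inj₁ _ | inj₂ q = ≈-sym q
  ... | inj₁ p | inj₁ q = ⊥-elim (∈-asym x y p q)

  S-Transitive : Transitive x → Transitive (S x)
  S-Transitive {x} t y y∈ w w∈y with ∈-cons⁻ x x y∈
  ... | inj₁ p = ∈-consˡ x x (t y p w w∈y)
  ... | inj₂ e = ∈-consˡ x x (∈-respʳ e w∈y)

  S-Ordinal : Ordinal x → Ordinal (S x)
  S-Ordinal {x} (t , h) = S-Transitive t ,
    λ y y∈ → [ h y , (λ e → Transitive-resp (≈-sym e) t) ]′ (∈-cons⁻ x x y∈)

  upper-bound : Ordinal κ → (∀ {x} → x ∈ κ → S x ∈ κ) →
                α ∈ κ → β ∈ κ → ∃[ γ ] γ ∈ κ × α ∈ γ × β ∈ γ
  upper-bound {κ} {α} {β} oκ Sκ α∈κ β∈κ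
    with trichotomy α β (Ordinal-∈ {κ} {α} oκ α∈κ) (Ordinal-∈ {κ} {β} oκ β∈κ)
  ... | inj₁ p        = S β , Sκ β∈κ , ∈-consˡ β β p , ∈-S β
  ... | inj₂ (inj₁ e) = S β , Sκ β∈κ , ∈-consʳ β β e , ∈-S β
  ... | inj₂ (inj₂ p) = S α , Sκ α∈κ , ∈-S α , ∈-consˡ α α p

  ∈-minimal : ∀ X (P : Pred V (lsuc 0ℓ)) → Transitive X → x ∈ X → P x →
              ∃[ m ] m ∈ X × P m × (∀ z → z ∈ m → ¬ P z)
  ∈-minimal {x} X P tX = ∈-ind
    (λ x → x ∈ X → P x → ∃[ m ] m ∈ X × P m × (∀ z → z ∈ m → ¬ P z))
    (λ x ih x∈X px → [ (λ (z , z∈x , pz) → ih z z∈x (tX x x∈X z z∈x) pz)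
                     , (λ none → x , x∈X , px , λ z z∈x pz → none (z , z∈x , pz))
                     ]′ (em (∃[ z ] z ∈ x × P z))) x

  Least : Pred V (lsuc 0ℓ) → Pred V (lsuc 0ℓ)
  Least P m = P m × (∀ z → z ∈ m → ¬ P z)

  Least-resp : ∀ {P} → Resp P → Resp (Least P)
  Least-resp rP e (p , h) = rP e p , λ z z∈ → h z (∈-respʳ (≈-sym e) z∈)

  -- Definite description of the least ordinal below `κ` with property `P`. Values chosen this way
  -- depend only on the extension of `P` (`μ-cong`), so they respect `≈`; the value is junk when
  -- there is no such ordinal.
  μ : V → Pred V (lsuc 0ℓ) → V
  μ κ P = ι κ (Least P)

  module _ {κ} (oκ : Ordinal κ) (P : Pred V (lsuc 0ℓ)) (rP : Resp P) where

    Least-unique : ∀ {m m′} → m ∈ κ → m′ ∈ κ → Least P m → Least P m′ → m ≈ m′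
    Least-unique {m} {m′} m∈κ m′∈κ (p , h) (p′ , h′)
      with trichotomy m m′ (Ordinal-∈ oκ m∈κ) (Ordinal-∈ oκ m′∈κ)
    ... | inj₁ q = ⊥-elim (h′ m q p)
    ... | inj₂ (inj₁ e) = e
    ... | inj₂ (inj₂ q) = ⊥-elim (h m′ q p′)

    μ-spec : x ∈ κ → P x → μ κ P ∈ κ × Least P (μ κ P)
    μ-spec x∈κ px =
      let (m , m∈κ , l) = ∈-minimal κ P (proj₁ oκ) x∈κ px
          e = ι-spec κ (Least P) (Least-resp rP) m∈κ l
                (λ w w∈κ l′ → Least-unique w∈κ m∈κ l′ l)
      in ∈-respˡ κ (≈-sym e) m∈κ , Least-resp rP (≈-sym e) l

  μ-cong : ∀ κ (P Q : Pred V (lsuc 0ℓ)) → Resp P → Resp Q →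
           (∀ z → P z → Q z) → (∀ z → Q z → P z) → μ κ P ≈ μ κ Q
  μ-cong κ P Q rP rQ f g = ι-cong κ (Least P) (Least Q) (Least-resp rP) (Least-resp rQ)
    (λ z (p , h) → f z p , λ w w∈ q → h w w∈ (g w q))
    (λ z (p , h) → g z p , λ w w∈ q → h w w∈ (f w q))

  S^ : ℕ → V → V
  S^ zero    x = x
  S^ (suc n) x = S (S^ n x)

  S^-cong : ∀ n → x ≈ y → S^ n x ≈ S^ n y
  S^-cong zero    e = e
  S^-cong (suc n) e = S-cong (S^-cong n e)

  S^-mono : ∀ {m n} → m ℕ.<′ n → S^ m x ∈ S^ n x
  S^-mono {x} {m} (ℕ.≤′-reflexive refl) = ∈-S (S^ m x)
  S^-mono {x} (ℕ.≤′-step {n} p) = ∈-consˡ (S^ n x) (S^ n x) (S^-mono p)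

  S^-injective : ∀ m n → S^ m x ≈ S^ n x → m ≡ n
  S^-injective {x} m n e with ℕ.<-cmp m n
  ... | tri< p _ _ = ⊥-elim (∈-irrefl _ (∈-respˡ (S^ n x) e (S^-mono (ℕ.≤⇒≤′ p))))
  ... | tri≈ _ p _ = p
  ... | tri> _ _ p = ⊥-elim (∈-irrefl _ (∈-respˡ (S^ m x) (≈-sym e) (S^-mono (ℕ.≤⇒≤′ p))))

  ∈-S^⁻ : ∀ n → z ∈ S^ n x → z ∈ x ⊎ (∃[ k ] z ≈ S^ k x)
  ∈-S^⁻ zero p = inj₁ p
  ∈-S^⁻ {z} {x} (suc n) p with ∈-cons⁻ (S^ n x) (S^ n x) p
  ... | inj₁ q = ∈-S^⁻ n q
  ... | inj₂ e = inj₂ (n , e)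

  S^-⊇ : ∀ n → x ⊆ S^ n x
  S^-⊇ zero z p = p
  S^-⊇ {x} (suc n) z p = ∈-consˡ (S^ n x) (S^ n x) (S^-⊇ n z p)

  S^-Transitive : ∀ n → Transitive x → Transitive (S^ n x)
  S^-Transitive zero t = t
  S^-Transitive (suc n) t = S-Transitive (S^-Transitive n t)

  numeral≈S^ : ∀ n → numeral n ≈ S^ n ∅
  numeral≈S^ zero = ≈-refl {∅}
  numeral≈S^ (suc n) = ≈-trans {numeral (suc n)} (numeral-suc n) (S-cong (numeral≈S^ n))

  numeral-injective : ∀ {m n} → numeral m ≈ numeral n → m ≡ n
  numeral-injective {m} {n} e = S^-injective m n
    (≈-trans (≈-sym (numeral≈S^ m)) (≈-trans e (numeral≈S^ n)))

  ∅-Ordinal : Ordinal ∅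
  ∅-Ordinal = (λ y m → ⊥-elim (∉∅ y m)) , (λ y m → ⊥-elim (∉∅ y m))

  ∅∈ω : ∅ ∈ ω
  ∅∈ω = numeral∈ω 0

  ω-S : x ∈ ω → S x ∈ ω
  ω-S (n , e) = suc n , ≈-trans (S-cong e) (≈-sym {numeral (suc n)} (numeral-suc n))

  ∈-S^∅⁻ : ∀ n → z ∈ S^ n ∅ → z ∈ ω
  ∈-S^∅⁻ {z} n p with ∈-S^⁻ n p
  ... | inj₁ q = ⊥-elim (∉∅ z q)
  ... | inj₂ (k , e) = k , ≈-trans e (≈-sym {numeral k} (numeral≈S^ k))

  ω-Ordinal : Ordinal ω
  ω-Ordinal =
      (λ y (n , e) w w∈y → ∈-S^∅⁻ n (∈-respʳ (≈-trans e (numeral≈S^ n)) w∈y))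
    , (λ y (n , e) → Transitive-resp (≈-sym (≈-trans e (numeral≈S^ n)))
                       (S^-Transitive n (proj₁ ∅-Ordinal)))

  module _ {q r : Level} (Q : Pred V q) (R : Pred V r) (Q-resp : Resp Q)
           (Q-∅ : Q ∅) (Q-cons : ∀ x y → Q x → R y → Q (cons x y)) where

    -- The list only has to cover `X`, so a listing of a finite set also serves for its subsets.
    -- Entries outside `X` are dropped; an entry inside is removed from `X` and adjoined again by
    -- `cons`.
    listed-ind : ∀ zs X → (∀ z → z ∈ X → Any.Any (z ≈_) zs) → (∀ z → z ∈ X → R z) → Q X
    listed-ind [] X h _ = Q-resp (⊆-antisym {∅} {X} (λ z m → ⊥-elim (∉∅ z m))
      (λ z m → ⊥-elim ([]-empty (h z m)))) Q-∅
      where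
      []-empty : ∀ {z} → ¬ Any.Any (z ≈_) []
      []-empty ()
    listed-ind (w ∷ zs) X h rX with em₀ (w ∈ X)
    ... | inj₂ w∉X = listed-ind zs X (λ z m → Any.tail (λ e → w∉X (∈-respˡ X e m)) (h z m)) rX
    ... | inj₁ w∈X = Q-resp (⊆-antisym back forth)
          (Q-cons Y w (listed-ind zs Y
            (λ z m → let (z∈X , lift ne) = ∈-sep⁻ X D D-resp m in Any.tail ne (h z z∈X))
            (λ z m → rX z (proj₁ (∈-sep⁻ X D D-resp m)))) (rX w w∈X))
      where
      D : Pred V (lsuc 0ℓ)
      D z = Lift (lsuc 0ℓ) (¬ (z ≈ w))
      D-resp : Resp D
      D-resp e (lift p) = lift λ e′ → p (≈-trans e e′)
      Y = sep X D
      back : cons Y w ⊆ X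
      back z m with ∈-cons⁻ Y w m
      ... | inj₁ p = proj₁ (∈-sep⁻ X D D-resp p)
      ... | inj₂ e = ∈-respˡ X (≈-sym e) w∈X
      forth : X ⊆ cons Y w
      forth z m with em₀ (z ≈ w)
      ... | inj₁ e = ∈-consʳ Y w e
      ... | inj₂ ne = ∈-consˡ Y w (∈-sep⁺ X D D-resp m (lift ne))

    finite-ind : ∀ X → Finite X → (∀ z → z ∈ X → R z) → Q X
    finite-ind X (zs , h) = listed-ind zs X λ z → Equivalence.to (h z)

-- Injections into ordinals, extensional choice and successor cardinals.

module Cardinals (lem : ExcludedMiddle (lsuc 0ℓ)) (choice : Choice) where

  open Sets
  open Ordinals lem

  private
    variable
      a : Level
      x x′ α κ : V
      P Q : Pred V a

  infix 4 _↪_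

  -- In contrast to `Injection`, the value does not depend on the proof of `P x`, so the same map
  -- can be restricted to subclasses.
  record _↪_ (P : Pred V a) (κ : V) : Set (lsuc 0ℓ Level.⊔ a) where
    field
      fun  : V → V
      into : ∀ {x} → P x → fun x ∈ κ
      ext  : ∀ {x y} → P x → P y → x ≈ y → fun x ≈ fun y
      inj  : ∀ {x y} → P x → P y → fun x ≈ fun y → x ≈ y

  open _↪_

  ↪⇒≼ : P ↪ κ → class P ≼ elems κ
  ↪⇒≼ F = record
    { to        = λ (x , p) → fun F x , into F p
    ; cong      = λ { {_ , p} {_ , q} e → ext F p q e }
    ; injective = λ { {_ , p} {_ , q} e → inj F p q e }
    }

  ↪-⊆ : (∀ x → P x → Q x) → Q ↪ κ → P ↪ κ
  ↪-⊆ P⊆Q F = record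
    { fun  = fun F
    ; into = λ p → into F (P⊆Q _ p)
    ; ext  = λ p q → ext F (P⊆Q _ p) (P⊆Q _ q)
    ; inj  = λ p q → inj F (P⊆Q _ p) (P⊆Q _ q)
    }

  ↪-codomain : ∀ {κ λ′} → κ ⊆ λ′ → P ↪ κ → P ↪ λ′
  ↪-codomain κ⊆λ F = record
    { fun = fun F ; into = λ p → κ⊆λ _ (into F p) ; ext = ext F ; inj = inj F }

  ↪-refl : ∀ κ → (_∈ κ) ↪ κ
  ↪-refl κ = record { fun = λ x → x ; into = λ p → p ; ext = λ _ _ e → e ; inj = λ _ _ e → e }

  abstract
    -- The function takes the least related value.
    relation⇒↪ : {P : Pred V a} → Ordinal κ → (R : V → V → Set₁) →
      (∀ x → P x → ∃[ c ] c ∈ κ × R x c) →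
      (∀ {x x′ c c′} → R x c → R x′ c′ → c ≈ c′ → x ≈ x′) →
      P ↪ κ
    relation⇒↪ {κ = κ} {P} oκ R total unique = record
      { fun  = λ x → μ κ (R′ x)
      ; into = λ p → proj₁ (spec p)
      ; ext  = λ _ _ e → μ-cong κ (R′ _) (R′ _) R′-resp R′-resp (λ _ → R′-resp₁ e) (λ _ → R′-resp₁ (≈-sym e))
      ; inj  = λ p q e →
          let (y , c , y≈x , c≈ , r) = proj₁ (proj₂ (spec p))
              (y′ , c′ , y′≈x′ , c′≈ , r′) = proj₁ (proj₂ (spec q))
          in ≈-trans (≈-sym y≈x) (≈-trans (unique r r′ (≈-trans c≈ (≈-trans e (≈-sym c′≈)))) y′≈x′)
      }
      where
      -- `R` need not respect `≈`; its saturation does, which makes the least value extensional in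
      -- `x`.
      R′ : V → Pred V (lsuc 0ℓ)
      R′ x c = ∃[ y ] ∃[ d ] y ≈ x × d ≈ c × R y d
      R′-resp : ∀ {x} → Resp (R′ x)
      R′-resp e (y , d , f , g , r) = y , d , f , ≈-trans g e , r
      R′-resp₁ : ∀ {x x′ c} → x ≈ x′ → R′ x c → R′ x′ c
      R′-resp₁ e (y , d , f , g , r) = y , d , ≈-trans f e , g , r
      spec : ∀ {x} → P x → μ κ (R′ x) ∈ κ × Least (R′ x) (μ κ (R′ x))
      spec {x} p = let (c , c∈κ , r) = total x p in
        μ-spec oκ (R′ x) R′-resp c∈κ (x , c , ≈-refl , ≈-refl , r)

  class≼⇒↪ : {P : Pred V (lsuc 0ℓ)} → Ordinal κ → class P ≼ elems κ → P ↪ κ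
  class≼⇒↪ {P = P} oκ F = relation⇒↪ oκ (λ x c → Σ[ p ∈ P x ] proj₁ (Injection.to F (x , p)) ≈ c)
    (λ x p → _ , proj₂ (Injection.to F (x , p)) , p , ≈-refl)
    (λ (p , e) (p′ , e′) c≈c′ → Injection.injective F (≈-trans e (≈-trans c≈c′ (≈-sym e′))))

  elems≼⇒↪ : Ordinal κ → elems x ≼ elems κ → (_∈ x) ↪ κ
  elems≼⇒↪ {x = x} oκ F = relation⇒↪ oκ
    (λ z c → Σ[ p ∈ z ∈ x ] Lift (lsuc 0ℓ) (proj₁ (Injection.to F (z , p)) ≈ c))
    (λ z p → _ , proj₂ (Injection.to F (z , p)) , p , lift ≈-refl)
    (λ (p , lift e) (p′ , lift e′) c≈c′ → Injection.injective F (≈-trans e (≈-trans c≈c′ (≈-sym e′))))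

  abstract
    -- `Choice` selects from sets, while the `y` related to `x` may form a proper class. `W x`
    -- collects one value for each index whose element is `≈ x`; it is a set and depends on `x` only
    -- up to `≈`.
    choice-function : ∀ X (R : V → V → Set₁) →
      (∀ {x x′ y y′} → x ≈ x′ → y ≈ y′ → R x y → R x′ y′) →
      (∀ x → x ∈ X → ∃[ y ] R x y) →
      Σ[ G ∈ (V → V) ] (∀ x x′ → x ∈ X → x ≈ x′ → G x ≈ G x′) × (∀ x → x ∈ X → R x (G x))
    choice-function (set I f) R R-resp total =
        (λ x → c (W x))
      , (λ x x′ x∈X e → c-ext (W x) (W x′) (W∈ x∈X) (W-cong e))
      , (λ x x∈X → let ((i , fi≈x) , e) = c-∈ (W x) (W∈ x∈X) in
           R-resp fi≈x (≈-sym e) (proj₂ (total (f i) (mem-∈ (set I f) i))))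
      where
      y₀ : I → V
      y₀ i = proj₁ (total (f i) (mem-∈ (set I f) i))
      W : V → V
      W x = set (Σ[ i ∈ I ] f i ≈ x) λ (i , _) → y₀ i
      W-cong : ∀ {x x′} → x ≈ x′ → W x ≈ W x′
      W-cong e = (λ (i , p) → (i , ≈-trans p e) , ≈-refl)
               , (λ (i , p) → (i , ≈-trans p (≈-sym e)) , ≈-refl)
      𝓦 : V
      𝓦 = set I λ i → W (f i)
      W∈ : ∀ {x} → x ∈ set I f → W x ∈ 𝓦
      W∈ (i , e) = i , W-cong e
      nonempty : ∀ w → w ∈ 𝓦 → ∃[ y ] y ∈ w
      nonempty w (i , e) = y₀ i ,
        ∈-respʳ {y₀ i} {W (f i)} {w} (≈-sym {w} {W (f i)} e) ((i , ≈-refl) , ≈-refl {y₀ i})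
      c : V → V
      c = proj₁ (choice 𝓦 nonempty)
      c-ext : ∀ x y → x ∈ 𝓦 → x ≈ y → c x ≈ c y
      c-ext = proj₁ (proj₂ (choice 𝓦 nonempty))
      c-∈ : ∀ x → x ∈ 𝓦 → c x ∈ x
      c-∈ = proj₂ (proj₂ (choice 𝓦 nonempty))

  module Successor {κ κ⁺ : V} (oκ : Ordinal κ) (succ : κ⁺ IsSuccessorCardinalOf κ) where

    oκ⁺ : Ordinal κ⁺
    oκ⁺ = proj₁ succ

    ⋠ : ¬ ((_∈ κ⁺) ↪ κ)
    ⋠ F = proj₁ (proj₂ succ) (↪⇒≼ F)

    small⇒∈ : Ordinal α → (_∈ α) ↪ κ → α ∈ κ⁺
    small⇒∈ {α} oα F = dne₀ λ α∉κ⁺ → ⋠ (↪-⊆ (≤⇒⊆ oα (≮⇒≥ oα oκ⁺ α∉κ⁺)) F)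

    ∈⇒small : α ∈ κ⁺ → (_∈ α) ↪ κ
    ∈⇒small α∈κ⁺ = elems≼⇒↪ oκ (proj₂ (proj₂ succ) _ α∈κ⁺)

    κ∈κ⁺ : κ ∈ κ⁺
    κ∈κ⁺ = small⇒∈ oκ (↪-refl κ)

    -- The injections α ↪ κ can be chosen uniformly in α.
    abstract
      -- `G` is the graph of a possibly multivalued injection of `α` into `κ`. Holding it as a set
      -- makes it a value that `choice-function` can select; `code` then takes the least value.
      Codes : V → V → Set₁
      Codes α G = (∀ ξ → ξ ∈ α → ∃[ c ] c ∈ κ × opair ξ c ∈ G)
                × (∀ ξ ξ′ c → opair ξ c ∈ G → opair ξ′ c ∈ G → ξ ≈ ξ′)

      Codes-resp : ∀ {α α′ G G′} → α ≈ α′ → G ≈ G′ → Codes α G → Codes α′ G′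
      Codes-resp e g (t , u) =
          (λ ξ ξ∈ → let (c , c∈ , p) = t ξ (∈-respʳ (≈-sym e) ξ∈) in c , c∈ , ∈-respʳ {opair ξ c} g p)
        , (λ ξ ξ′ c p q → u ξ ξ′ c (∈-respʳ {opair ξ c} (≈-sym g) p) (∈-respʳ {opair ξ′ c} (≈-sym g) q))

      graph : ∀ α → α ∈ κ⁺ → ∃[ G ] Codes α G
      graph α α∈κ⁺ = img h α
        , (λ ξ ξ∈α → fun F ξ , into F ξ∈α ,
             ∈-img⁺ {ξ} {opair ξ (fun F ξ)} h α h-ext ξ∈α (≈-refl {opair ξ (fun F ξ)}))
        , (λ ξ ξ′ c p q →
             let (y , y∈ , e) = ∈-img⁻ {opair ξ c} h α p
                 (y′ , y′∈ , e′) = ∈-img⁻ {opair ξ′ c} h α q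
                 ξ≈y = opair-injˡ ξ c y (fun F y) e
                 ξ′≈y′ = opair-injˡ ξ′ c y′ (fun F y′) e′
                 c≈ = opair-injʳ ξ c y (fun F y) e
                 c≈′ = opair-injʳ ξ′ c y′ (fun F y′) e′
             in ≈-trans ξ≈y (≈-trans (inj F y∈ y′∈ (≈-trans (≈-sym c≈) c≈′)) (≈-sym ξ′≈y′)))
        where
        F : (_∈ α) ↪ κ
        F = ∈⇒small α∈κ⁺
        h : V → V
        h ξ = opair ξ (fun F ξ)
        h-ext : ∀ {ξ ξ′} → ξ ∈ α → ξ′ ∈ α → ξ ≈ ξ′ → h ξ ≈ h ξ′
        h-ext p q e = opair-cong e (ext F p q e)

      codes : Σ[ G ∈ (V → V) ] (∀ α α′ → α ∈ κ⁺ → α ≈ α′ → G α ≈ G α′) × (∀ α → α ∈ κ⁺ → Codes α (G α))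
      codes = choice-function κ⁺ Codes Codes-resp graph

      G : V → V
      G = proj₁ codes

      Code : V → V → Pred V (lsuc 0ℓ)
      Code α ξ c = Lift (lsuc 0ℓ) (opair ξ c ∈ G α)

      Code-resp : ∀ {α ξ} → Resp (Code α ξ)
      Code-resp {α} e (lift p) = lift (∈-respˡ (G α) (opair-cong ≈-refl e) p)

      code : V → V → V
      code α ξ = μ κ (Code α ξ)

      code-spec : ∀ {α ξ} → α ∈ κ⁺ → ξ ∈ α → code α ξ ∈ κ × Least (Code α ξ) (code α ξ)
      code-spec {α} {ξ} α∈ ξ∈ = let (c , c∈ , p) = proj₁ (proj₂ (proj₂ codes) α α∈) ξ ξ∈ in
        μ-spec oκ (Code α ξ) (Code-resp {α} {ξ}) c∈ (lift p)

      code-∈ : ∀ {α ξ} → α ∈ κ⁺ → ξ ∈ α → code α ξ ∈ κ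
      code-∈ α∈ ξ∈ = proj₁ (code-spec α∈ ξ∈)

      code-cong : ∀ {α α′ ξ ξ′} → α ∈ κ⁺ → α ≈ α′ → ξ ≈ ξ′ → code α ξ ≈ code α′ ξ′
      code-cong {α} {α′} {ξ} {ξ′} α∈ e f =
        μ-cong κ (Code α ξ) (Code α′ ξ′) (Code-resp {α} {ξ}) (Code-resp {α′} {ξ′})
          (λ c (lift p) → lift (∈-respʳ {opair ξ′ c} g (∈-respˡ (G α) (opair-cong f ≈-refl) p)))
          (λ c (lift p) → lift (∈-respˡ (G α) (opair-cong (≈-sym f) ≈-refl) (∈-respʳ {opair ξ′ c} (≈-sym g) p)))
        where
        g : G α ≈ G α′
        g = proj₁ (proj₂ codes) α α′ α∈ e

      code-inj : ∀ {α ξ ξ′} → α ∈ κ⁺ → ξ ∈ α → ξ′ ∈ α → code α ξ ≈ code α ξ′ → ξ ≈ ξ′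
      code-inj {α} {ξ} {ξ′} α∈ ξ∈ ξ′∈ e =
        proj₂ (proj₂ (proj₂ codes) α α∈) ξ ξ′ (code α ξ′)
          (∈-respˡ (G α) (opair-cong ≈-refl e) (lower (proj₁ (proj₂ (code-spec α∈ ξ∈)))))
          (lower (proj₁ (proj₂ (code-spec α∈ ξ′∈))))

    -- Shifting the codes of the members of `α` by one frees `∅` as the code of `α` itself.
    S-closed : ∅ ∈ κ → (∀ {x} → x ∈ κ → S x ∈ κ) → α ∈ κ⁺ → S α ∈ κ⁺
    S-closed {α} ∅∈κ Sκ α∈ = small⇒∈ {S α} (S-Ordinal {α} (Ordinal-∈ {κ⁺} oκ⁺ α∈)) (relation⇒↪ oκ R total unique)
      where
      R : V → V → Set₁
      R z c = Lift (lsuc 0ℓ) ((z ≈ α × c ≈ ∅) ⊎ (z ∈ α × c ≈ S (code α z)))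
      total : ∀ z → z ∈ S α → ∃[ c ] c ∈ κ × R z c
      total z m with ∈-cons⁻ α α m
      ... | inj₁ p = S (code α z) , Sκ (code-∈ α∈ p) , lift (inj₂ (p , ≈-refl))
      ... | inj₂ e = ∅ , ∅∈κ , lift (inj₁ (e , ≈-refl {∅}))
      clash : ∀ {x c c′} → c ≈ S x → c′ ≈ ∅ → c ≈ c′ → ⊥
      clash {x} {c} {c′} e e′ f = S≉∅ x (≈-trans {S x} {c} {∅} (≈-sym {c} {S x} e) (≈-trans {c} {c′} {∅} f e′))
      unique : ∀ {x x′ c c′} → R x c → R x′ c′ → c ≈ c′ → x ≈ x′
      unique (lift (inj₁ (e , _))) (lift (inj₁ (e′ , _))) _ = ≈-trans e (≈-sym e′)
      unique (lift (inj₁ (_ , e))) (lift (inj₂ (_ , e′))) f = ⊥-elim (clash e′ e (≈-sym f))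
      unique (lift (inj₂ (_ , e′))) (lift (inj₁ (_ , e))) f = ⊥-elim (clash e′ e f)
      unique (lift (inj₂ (p , e))) (lift (inj₂ (p′ , e′))) f = code-inj α∈ p p′
        (S-injective _ _ (≈-trans (≈-sym e) (≈-trans f e′)))

-- Regularity of ω₂ and clubs of closure points.

module Regularity (lem : ExcludedMiddle (lsuc 0ℓ)) (choice : Choice)
  {ω₁ ω₂ : V} (succ₁ : ω₁ IsSuccessorCardinalOf ω) (succ₂ : ω₂ IsSuccessorCardinalOf ω₁) where

  open Sets
  open Ordinals lem
  open Cardinals lem choice

  private
    variable
      x y z α : V

  module ω₁ = Successor ω-Ordinal succ₁
  module ω₂ = Successor ω₁.oκ⁺ succ₂

  double : ℕ → ℕ
  double zero    = zero
  double (suc n) = suc (suc (double n))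

  double-injective : ∀ m n → double m ≡ double n → m ≡ n
  double-injective zero    zero    _ = refl
  double-injective (suc m) (suc n) e = cong suc (double-injective m n (ℕ.suc-injective (ℕ.suc-injective e)))

  double≢suc-double : ∀ m n → ¬ (double m ≡ suc (double n))
  double≢suc-double (suc m) (suc n) e = double≢suc-double m n (ℕ.suc-injective (ℕ.suc-injective e))

  -- 2ᵐ (2n + 1)
  pair : ℕ → ℕ → ℕ
  pair zero    n = suc (double n)
  pair (suc m) n = double (pair m n)

  pair-injective : ∀ m n m′ n′ → pair m n ≡ pair m′ n′ → m ≡ m′ × n ≡ n′
  pair-injective zero n zero n′ e = refl , double-injective n n′ (ℕ.suc-injective e)
  pair-injective zero n (suc m′) n′ e = ⊥-elim (double≢suc-double (pair m′ n′) n (sym e))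
  pair-injective (suc m) n zero n′ e = ⊥-elim (double≢suc-double (pair m n) n′ e)
  pair-injective (suc m) n (suc m′) n′ e =
    let (p , q) = pair-injective m n m′ n′ (double-injective (pair m n) (pair m′ n′) e) in cong suc p , q

  abstract
    -- The ordinal product ω · μ, as the set of all ω · ν + n with ν below μ.
    ω·_ : V → V
    ω· (set I f) = set (I × ℕ) λ (i , n) → S^ n (ω· (f i))

    ω·-cong : x ≈ y → ω· x ≈ ω· y
    ω·-cong {set I f} {set J g} (p , q) =
        (λ (i , n) → (proj₁ (p i) , n) , S^-cong n (ω·-cong (proj₂ (p i))))
      , (λ (j , n) → (proj₁ (q j) , n) , S^-cong n (ω·-cong (proj₂ (q j))))

    ∈-ω·⁻ : ∀ μ → z ∈ ω· μ → ∃[ ν ] ∃[ n ] ν ∈ μ × z ≈ S^ n (ω· ν)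
    ∈-ω·⁻ (set I f) ((i , n) , e) = f i , n , (i , ≈-refl) , e

    ∈-ω·⁺ : ∀ μ n → y ∈ μ → z ≈ S^ n (ω· y) → z ∈ ω· μ
    ∈-ω·⁺ (set I f) n (i , e) e′ = (i , n) , ≈-trans e′ (S^-cong n (ω·-cong e))

  ω·-Transitive : ∀ μ → Transitive μ → (∀ ν → ν ∈ μ → Transitive ν) → Transitive (ω· μ)
  ω·-Transitive μ t h y y∈ w w∈y with ∈-ω·⁻ μ y∈
  ... | ν , n , ν∈μ , e with ∈-S^⁻ n (∈-respʳ e w∈y)
  ...   | inj₂ (k , e′) = ∈-ω·⁺ μ k ν∈μ e′
  ...   | inj₁ w∈ with ∈-ω·⁻ ν w∈
  ...     | ν′ , k , ν′∈ν , e′ = ∈-ω·⁺ μ k (t ν ν∈μ ν′ ν′∈ν) e′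

  ω·-Ordinal : ∀ μ → Ordinal μ → Ordinal (ω· μ)
  ω·-Ordinal μ oμ@(t , h) = ω·-Transitive μ t h , λ y y∈ →
    let (ν , n , ν∈μ , e) = ∈-ω·⁻ μ y∈
        (tν , hν) = Ordinal-∈ {μ} {ν} oμ ν∈μ
    in Transitive-resp {S^ n (ω· ν)} {y} (≈-sym e) (S^-Transitive n (ω·-Transitive ν tν hν))

  ω₁-code : ∀ α ξ → α ∈ ω₁ → ξ ∈ α → ∃[ n ] ω₁.code α ξ ≈ numeral n
  ω₁-code α ξ α∈ ξ∈ = ω₁.code-∈ α∈ ξ∈

  ω·-∈ω₁ : ∀ μ → μ ∈ ω₁ → ω· μ ∈ ω₁
  ω·-∈ω₁ μ μ∈ω₁ = ω₁.small⇒∈ {ω· μ} (ω·-Ordinal μ (Ordinal-∈ {ω₁} {μ} ω₁.oκ⁺ μ∈ω₁))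
      (relation⇒↪ {P = _∈ ω· μ} ω-Ordinal R total unique)
    where
    R : V → V → Set₁
    R z c = ∃[ ν ] ∃[ n ] ∃[ m ] ν ∈ μ × z ≈ S^ n (ω· ν) × ω₁.code μ ν ≈ numeral m × c ≈ numeral (pair m n)
    total : ∀ z → z ∈ ω· μ → ∃[ c ] c ∈ ω × R z c
    total z z∈ =
      let (ν , n , ν∈μ , e) = ∈-ω·⁻ μ z∈
          (m , e′) = ω₁-code μ ν μ∈ω₁ ν∈μ
      in numeral (pair m n) , numeral∈ω (pair m n) , ν , n , m , ν∈μ , e , e′ , ≈-refl {numeral (pair m n)}
    unique : ∀ {x x′ c c′} → R x c → R x′ c′ → c ≈ c′ → x ≈ x′
    unique (ν , n , m , ν∈ , e , f , g) (ν′ , n′ , m′ , ν′∈ , e′ , f′ , g′) c≈c′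
      with pair-injective m n m′ n′ (numeral-injective {pair m n} {pair m′ n′}
             (≈-trans (≈-sym g) (≈-trans c≈c′ g′)))
    ... | refl , refl = ≈-trans e (≈-trans (S^-cong n (ω·-cong
            (ω₁.code-inj μ∈ω₁ ν∈ ν′∈ (≈-trans f (≈-sym f′))))) (≈-sym e′))

  ω₁-S : α ∈ ω₁ → S α ∈ ω₁
  ω₁-S = ω₁.S-closed ∅∈ω ω-S

  ω∈ω₁ : ω ∈ ω₁
  ω∈ω₁ = ω₁.κ∈κ⁺

  ω₁∈ω₂ : ω₁ ∈ ω₂
  ω₁∈ω₂ = ω₂.κ∈κ⁺

  ω⊆ω₁ : ω ⊆ ω₁
  ω⊆ω₁ = proj₁ ω₁.oκ⁺ ω ω∈ω₁

  ω₁⊆ω₂ : ω₁ ⊆ ω₂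
  ω₁⊆ω₂ = proj₁ ω₂.oκ⁺ ω₁ ω₁∈ω₂

  ∅∈ω₁ : ∅ ∈ ω₁
  ∅∈ω₁ = ω⊆ω₁ ∅ ∅∈ω

  ω₂-S : α ∈ ω₂ → S α ∈ ω₂
  ω₂-S = ω₂.S-closed ∅∈ω₁ ω₁-S

  S^-∈ω₁ : ∀ n → α ∈ ω₁ → S^ n α ∈ ω₁
  S^-∈ω₁ zero    p = p
  S^-∈ω₁ (suc n) p = ω₁-S (S^-∈ω₁ n p)

  -- Uniqueness of division by ω: if μ were below ν, then ω · μ + m would already be a member of ω ·
  -- ν, and the equation would put a set into itself.
  S^-ω·-injective : ∀ m n μ ν → μ ∈ ω₁ → ν ∈ ω₁ → S^ m (ω· μ) ≈ S^ n (ω· ν) → m ≡ n × μ ≈ ν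
  S^-ω·-injective m n μ ν μ∈ ν∈ e
    with trichotomy μ ν (Ordinal-∈ {ω₁} {μ} ω₁.oκ⁺ μ∈) (Ordinal-∈ {ω₁} {ν} ω₁.oκ⁺ ν∈)
  ... | inj₁ p = ⊥-elim (∈-irrefl (S^ m (ω· μ))
          (∈-respʳ (≈-sym e) (S^-⊇ n _ (∈-ω·⁺ ν m p ≈-refl))))
  ... | inj₂ (inj₂ p) = ⊥-elim (∈-irrefl (S^ n (ω· ν))
          (∈-respʳ e (S^-⊇ m _ (∈-ω·⁺ μ n p ≈-refl))))
  ... | inj₂ (inj₁ p) = S^-injective m n (≈-trans e (S^-cong n (ω·-cong (≈-sym p)))) , p

  -- A multivalued injection ω₁ × ω₁ → ω₁: countable codes of γ and δ below some
  -- μ > γ, δ are stored in the μ-th interval [ω · μ, ω · (μ + 1)).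
  Pairing : V → V → V → Set₁
  Pairing γ δ c = ∃[ μ ] ∃[ m ] ∃[ n ] Lift (lsuc 0ℓ) (μ ∈ ω₁ × γ ∈ μ × δ ∈ μ ×
    ω₁.code μ γ ≈ numeral m × ω₁.code μ δ ≈ numeral n × c ≈ S^ (pair m n) (ω· μ))

  Pairing-total : ∀ γ δ → γ ∈ ω₁ → δ ∈ ω₁ → ∃[ c ] c ∈ ω₁ × Pairing γ δ c
  Pairing-total γ δ γ∈ δ∈ =
    let (μ , μ∈ , γ∈μ , δ∈μ) = upper-bound ω₁.oκ⁺ ω₁-S γ∈ δ∈
        (m , em) = ω₁-code μ γ μ∈ γ∈μ
        (n , en) = ω₁-code μ δ μ∈ δ∈μ
    in S^ (pair m n) (ω· μ) , S^-∈ω₁ (pair m n) (ω·-∈ω₁ μ μ∈)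
       , μ , m , n , lift (μ∈ , γ∈μ , δ∈μ , em , en , ≈-refl)

  Pairing-injective : ∀ {γ δ c γ′ δ′ c′} → Pairing γ δ c → Pairing γ′ δ′ c′ → c ≈ c′ → γ ≈ γ′ × δ ≈ δ′
  Pairing-injective (μ , m , n , lift (μ∈ , γ∈ , δ∈ , e , f , g))
                    (μ′ , m′ , n′ , lift (μ′∈ , γ′∈ , δ′∈ , e′ , f′ , g′)) c≈c′
    with S^-ω·-injective (pair m n) (pair m′ n′) μ μ′ μ∈ μ′∈ (≈-trans (≈-sym g) (≈-trans c≈c′ g′))
  ... | p , μ≈μ′ with pair-injective m n m′ n′ p
  ...   | refl , refl =
      ω₁.code-inj μ∈ γ∈ (∈-respʳ (≈-sym μ≈μ′) γ′∈)
        (≈-trans e (≈-trans (≈-sym e′) (≈-sym (ω₁.code-cong μ∈ μ≈μ′ ≈-refl))))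
    , ω₁.code-inj μ∈ δ∈ (∈-respʳ (≈-sym μ≈μ′) δ′∈)
        (≈-trans f (≈-trans (≈-sym f′) (≈-sym (ω₁.code-cong μ∈ μ≈μ′ ≈-refl))))

  module _ {P Q : Pred V (lsuc 0ℓ)} (F : P ↪ ω₁) (G : Q ↪ ω₁) where
    private
      module F = _↪_ F
      module G = _↪_ G

      R : V → V → Set₁
      R z c = (P z × Pairing ∅ (F.fun z) c) ⊎ (Q z × Pairing (S ∅) (G.fun z) c)

      total : ∀ z → P z ⊎ Q z → ∃[ c ] c ∈ ω₁ × R z c
      total z (inj₁ p) = let (c , c∈ , r) = Pairing-total ∅ (F.fun z) ∅∈ω₁ (F.into p) in c , c∈ , inj₁ (p , r)
      total z (inj₂ q) = let (c , c∈ , r) = Pairing-total (S ∅) (G.fun z) (ω₁-S ∅∈ω₁) (G.into q) in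
        c , c∈ , inj₂ (q , r)

      unique : ∀ {x x′ c c′} → R x c → R x′ c′ → c ≈ c′ → x ≈ x′
      unique (inj₁ (p , r)) (inj₁ (p′ , r′)) e = F.inj p p′ (proj₂ (Pairing-injective {∅} {_} {_} {∅} r r′ e))
      unique (inj₂ (p , r)) (inj₂ (p′ , r′)) e = G.inj p p′ (proj₂ (Pairing-injective r r′ e))
      unique (inj₁ (p , r)) (inj₂ (p′ , r′)) e =
        ⊥-elim (S≉∅ ∅ (≈-sym {∅} {S ∅} (proj₁ (Pairing-injective {∅} {_} {_} {S ∅} r r′ e))))
      unique (inj₂ (p , r)) (inj₁ (p′ , r′)) e =
        ⊥-elim (S≉∅ ∅ (proj₁ (Pairing-injective {S ∅} {_} {_} {∅} r r′ e)))

    -- The tags `∅` and `S ∅`, paired with the codes, keep the two sides apart.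
    ↪-⊎ : (λ z → P z ⊎ Q z) ↪ ω₁
    ↪-⊎ = relation⇒↪ ω₁.oκ⁺ R total unique

  -- `B x b` reads: b bounds x. Leaving the notion of bound abstract lets one regularity argument
  -- serve for sets of ordinals, codes of cuts, first coordinates of triples and families of
  -- countable sets.
  module _ {P : Pred V (lsuc 0ℓ)} (F : P ↪ ω₁) (B : V → V → Set₁)
    (B-resp : ∀ {x x′ b b′} → x ≈ x′ → b ≈ b′ → B x b → B x′ b′)
    (B-mono : ∀ {x b b′} → b′ ∈ ω₂ → b ∈ b′ → B x b → B x b′)
    (bounded : ∀ x → P x → ∃[ b ] b ∈ ω₂ × B x b) where

    private
      module F = _↪_ F

      h : V → V
      h x = μ ω₂ (B x)

      h-spec : ∀ {x} → P x → h x ∈ ω₂ × Least (B x) (h x)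
      h-spec {x} p = let (b , b∈ , q) = bounded x p in μ-spec ω₂.oκ⁺ (B x) (B-resp ≈-refl) b∈ q

      h-cong : ∀ {x x′} → x ≈ x′ → h x ≈ h x′
      h-cong {x} {x′} e = μ-cong ω₂ (B x) (B x′) (B-resp ≈-refl) (B-resp ≈-refl)
        (λ _ → B-resp e ≈-refl) (λ _ → B-resp (≈-sym e) ≈-refl)

      R : V → V → Set₁
      R η c = ∃[ x ] P x × η ∈ h x × Pairing (F.fun x) (ω₂.code (h x) η) c

      unique : ∀ {x x′ c c′} → R x c → R x′ c′ → c ≈ c′ → x ≈ x′
      unique (x , p , η∈ , r) (x′ , p′ , η′∈ , r′) e =
        let (e₁ , e₂) = Pairing-injective r r′ e
            h≈ = h-cong (F.inj p p′ e₁)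
            hx∈ = proj₁ (h-spec p)
        in ω₂.code-inj hx∈ η∈ (∈-respʳ (≈-sym h≈) η′∈)
             (≈-trans e₂ (≈-sym (ω₂.code-cong hx∈ h≈ ≈-refl)))

    abstract
      -- Were the bounds unbounded, every η < ω₂ would be coded by an x with
      -- η < h x together with the position of η in h x, and so ω₂ ↪ ω₁ × ω₁.
      uniform-bound : ∃[ b ] b ∈ ω₂ × (∀ x → P x → B x b)
      uniform-bound = dne λ none → ω₂.⋠ (relation⇒↪ ω₁.oκ⁺ R
        (λ η η∈ω₂ →
          let (x , p , ¬B) = dne {∃[ x ] P x × ¬ B x η} λ all →
                none (η , η∈ω₂ , λ x p → dne λ ¬B → all (x , p , ¬B))
              (hx∈ , Bh , _) = h-spec p
              η∈hx : η ∈ h x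
              η∈hx = dne₀ λ η∉ → [ (λ q → ¬B (B-mono η∈ω₂ q Bh)) , (λ e → ¬B (B-resp ≈-refl e Bh)) ]′
                (≮⇒≥ (Ordinal-∈ {ω₂} {η} ω₂.oκ⁺ η∈ω₂) (Ordinal-∈ {ω₂} {h x} ω₂.oκ⁺ hx∈) η∉)
              (c , c∈ , r) = Pairing-total (F.fun x) (ω₂.code (h x) η) (F.into p) (ω₂.code-∈ hx∈ η∈hx)
          in c , c∈ , x , p , η∈hx , r)
        unique)

  countable⇒↪ω₁ : (F : ℕ → V) → (_∈ set ℕ F) ↪ ω₁
  countable⇒↪ω₁ F = ↪-codomain ω⊆ω₁ (relation⇒↪ ω-Ordinal
    (λ z c → ∃[ n ] Lift (lsuc 0ℓ) (z ≈ F n × c ≈ numeral n))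
    (λ z (n , e) → numeral n , numeral∈ω n , n , lift (e , ≈-refl {numeral n}))
    (λ { (n , lift (e , f)) (n′ , lift (e′ , f′)) c≈c′ →
      same (numeral-injective {n} {n′} (≈-trans (≈-sym f) (≈-trans c≈c′ f′))) e e′ }))
    where
    same : ∀ {n n′ x x′} → n ≡ n′ → x ≈ F n → x′ ≈ F n′ → x ≈ x′
    same refl e e′ = ≈-trans e (≈-sym e′)

  abstract
    ↪ω₁-bounded : ∀ {X} → (_∈ X) ↪ ω₁ → X ⊆ ω₂ → ∃[ b ] b ∈ ω₂ × X ⊆ b
    ↪ω₁-bounded {X} F X⊆ω₂ =
      let (b , b∈ , h) = uniform-bound {P = λ x → Lift (lsuc 0ℓ) (x ∈ X)}
            (↪-⊆ (λ _ → lower) F) (λ x b → Lift (lsuc 0ℓ) (x ∈ b))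
            (λ { {x} {x′} {b} {b′} e f (lift p) → lift (∈-respʳ f (∈-respˡ b e p)) })
            (λ { {x} {b} {b′} b′∈ b∈b′ (lift p) → lift (proj₁ (Ordinal-∈ {ω₂} {b′} ω₂.oκ⁺ b′∈) b b∈b′ x p) })
            (λ { x (lift x∈X) → S x , ω₂-S (X⊆ω₂ x x∈X) , lift (∈-S x) })
      in b , b∈ , λ x x∈X → lower (h x (lift x∈X))

  ⋃-∈ω₂ : (F : ℕ → V) → (∀ n → F n ∈ ω₂) → ⋃ (set ℕ F) ∈ ω₂
  ⋃-∈ω₂ F F∈ =
    let (b , b∈ , F⊆b) = ↪ω₁-bounded (countable⇒↪ω₁ F) (λ { x (n , e) → ∈-respˡ ω₂ (≈-sym e) (F∈ n) })
        ob = Ordinal-∈ {ω₂} {b} ω₂.oκ⁺ b∈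
        o⋃ : Ordinal (⋃ (set ℕ F))
        o⋃ = ⋃-Ordinal (set ℕ F) λ { y (n , e) →
               Ordinal-resp {F n} {y} (≈-sym e) (Ordinal-∈ {ω₂} {F n} ω₂.oκ⁺ (F∈ n)) }
    in ≤-∈-trans ω₂.oκ⁺ (⊆⇒≤ o⋃ ob λ z z∈ → let (n , z∈Fn) = ∈-⋃set⁻ F z∈ in
         proj₁ ob (F n) (F⊆b (F n) (n , ≈-refl)) z z∈Fn) b∈

  module ClosurePoints (B : V → V → Set₁)
    (B-resp : ∀ {x x′ b b′} → x ≈ x′ → b ≈ b′ → B x b → B x′ b′)
    (B-mono : ∀ {x b b′} → b′ ∈ ω₂ → b ∈ b′ → B x b → B x b′)
    (bounded : ∀ x → x ∈ ω₂ → ∃[ b ] b ∈ ω₂ × B x b) where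

    Closed : Pred V (lsuc 0ℓ)
    Closed δ = ∀ γ → γ ∈ δ → B γ δ

    Closed-resp : Resp Closed
    Closed-resp e h γ γ∈ = B-resp ≈-refl e (h γ (∈-respʳ (≈-sym e) γ∈))

    E : V
    E = sep ω₂ Closed

    private
      next : Σ V (_∈ ω₂) → Σ V (_∈ ω₂)
      next-spec : ∀ α → proj₁ α ∈ proj₁ (next α) × (∀ γ → γ ∈ proj₁ α → B γ (proj₁ (next α)))

      bound : (α : Σ V (_∈ ω₂)) → ∃[ b ] b ∈ ω₂ × (∀ x → Lift (lsuc 0ℓ) (x ∈ proj₁ α) → B x b)
      bound (α , α∈) = uniform-bound {P = λ x → Lift (lsuc 0ℓ) (x ∈ α)}
        (↪-⊆ (λ _ → lower) (ω₂.∈⇒small α∈)) B B-resp B-mono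
        (λ { x (lift x∈) → bounded x (proj₁ ω₂.oκ⁺ α α∈ x x∈) })

      upper : (α : Σ V (_∈ ω₂)) → ∃[ c ] c ∈ ω₂ × proj₁ α ∈ c × proj₁ (bound α) ∈ c
      upper α = upper-bound ω₂.oκ⁺ ω₂-S (proj₂ α) (proj₁ (proj₂ (bound α)))

      next α = proj₁ (upper α) , proj₁ (proj₂ (upper α))
      next-spec α = let (c , c∈ , α∈c , b∈c) = upper α in
        α∈c , λ γ γ∈ → B-mono c∈ b∈c (proj₂ (proj₂ (bound α)) γ (lift γ∈))

      iterate : Σ V (_∈ ω₂) → ℕ → Σ V (_∈ ω₂)
      iterate α zero    = α
      iterate α (suc n) = next (iterate α n)

    -- Unbounded: ω many steps of `next` lead to a supremum that is still below ω₂ and contains a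
    -- bound for each of its members. Closed: a bound reached at a smaller point of `E` persists by
    -- `B-mono`.
    E-club : Club ω₂ E
    E-club = (λ z z∈ → proj₁ (∈-sep⁻ ω₂ Closed Closed-resp z∈)) , unbounded , closed
      where
      unbounded : ∀ α → α ∈ ω₂ → ∃[ β ] β ∈ E × α ∈ β
      unbounded α α∈ = ⋃ (set ℕ F) , ∈-sep⁺ ω₂ Closed Closed-resp sup∈ closed , F⊆ 1 (proj₁ (next-spec (s 0)))
        where
        s : ℕ → Σ V (_∈ ω₂)
        s = iterate (α , α∈)
        F : ℕ → V
        F n = proj₁ (s n)
        F⊆ : ∀ n {z} → z ∈ F n → z ∈ ⋃ (set ℕ F)
        F⊆ n = ∈-⋃set⁺ F n
        sup∈ : ⋃ (set ℕ F) ∈ ω₂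
        sup∈ = ⋃-∈ω₂ F (λ n → proj₂ (s n))
        closed : Closed (⋃ (set ℕ F))
        closed γ γ∈ = let (n , γ∈Fn) = ∈-⋃set⁻ F γ∈ in
          -- The bound for `γ` is F (n + 1). `B-mono` wants it as a member of the supremum, which
          -- takes one more stage.
          B-mono sup∈ (F⊆ (suc (suc n)) (proj₁ (next-spec (s (suc n))))) (proj₂ (next-spec (s n)) γ γ∈Fn)
      closed : ∀ δ → δ ∈ ω₂ → LimitPoint (_∈ E) δ → δ ∈ E
      closed δ δ∈ (_ , lim) = ∈-sep⁺ ω₂ Closed Closed-resp δ∈ λ γ γ∈ →
        let (ζ , ζ∈E , ζ∈δ , γ∈ζ) = lim γ γ∈
        in B-mono δ∈ ζ∈δ (proj₂ (∈-sep⁻ ω₂ Closed Closed-resp ζ∈E) γ γ∈ζ)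

-- Sets of hereditary size at most ω₁ and boundedness of countable sets.

module Hereditary (lem : ExcludedMiddle (lsuc 0ℓ)) (choice : Choice)
  {ω₁ ω₂ : V} (succ₁ : ω₁ IsSuccessorCardinalOf ω) (succ₂ : ω₂ IsSuccessorCardinalOf ω₁) where

  open Sets
  open Ordinals lem
  open Cardinals lem choice
  open Regularity lem choice succ₁ succ₂

  private
    variable
      x y z α κ : V

  -- The form in which membership in `H ω₂` gets verified: injections into ω₁ combine under unions
  -- by `↪-⊎`, while `H` is stated by the strict comparison `≺`.
  Small : Pred V (lsuc 0ℓ)
  Small x = (_∈⁺ x) ↪ ω₁

  Small⇒H : Small x → H ω₂ x
  Small⇒H F = ↪⇒≼ (↪-codomain ω₁⊆ω₂ F) , λ G →
    ω₂.⋠ (elems≼⇒↪ ω₁.oκ⁺ (Composition.injection G (↪⇒≼ F)))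

  ∈⁺-respʳ : x ≈ y → z ∈⁺ x → z ∈⁺ y
  ∈⁺-respʳ e [ p ] = [ ∈-respʳ e p ]
  ∈⁺-respʳ e (p ∷ q) = p ∷ ∈⁺-respʳ e q

  Small-resp : Resp Small
  Small-resp e = ↪-⊆ (λ z → ∈⁺-respʳ (≈-sym e))

  lift↪ : (_∈ x) ↪ κ → (λ z → Lift (lsuc 0ℓ) (z ∈ x)) ↪ κ
  lift↪ = ↪-⊆ λ _ → lower

  ∈ω₂⇒↪ω₁ : α ∈ ω₂ → (λ z → Lift (lsuc 0ℓ) (z ∈ α)) ↪ ω₁
  ∈ω₂⇒↪ω₁ α∈ = lift↪ (ω₂.∈⇒small α∈)

  ∈ω₂-Ordinal : α ∈ ω₂ → Ordinal α
  ∈ω₂-Ordinal {α} = Ordinal-∈ {ω₂} {α} ω₂.oκ⁺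

  ⊆∈ω₂⇒Small : ∀ {x} → α ∈ ω₂ → x ⊆ α → Small x
  ⊆∈ω₂⇒Small {α} {x} α∈ x⊆α = ↪-⊆ (λ z p → lift (trcl p)) (∈ω₂⇒↪ω₁ α∈)
    where
    trcl : ∀ {z} → z ∈⁺ x → z ∈ α
    trcl [ p ] = x⊆α _ p
    trcl (p ∷ q) = proj₁ (∈ω₂-Ordinal α∈) _ (trcl q) _ p

  ∈ω₂⇒Small : α ∈ ω₂ → Small α
  ∈ω₂⇒Small α∈ = ⊆∈ω₂⇒Small α∈ λ _ p → p

  ∅∈ω₂ : ∅ ∈ ω₂
  ∅∈ω₂ = ω₁⊆ω₂ ∅ ∅∈ω₁

  ω∈ω₂ : ω ∈ ω₂
  ω∈ω₂ = ω₁⊆ω₂ ω ω∈ω₁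

  Small-∅ : Small ∅
  Small-∅ = ∈ω₂⇒Small ∅∈ω₂

  Small-∈ω : x ∈ ω → Small x
  Small-∈ω x∈ω = ∈ω₂⇒Small (proj₁ ω₂.oκ⁺ ω ω∈ω₂ _ x∈ω)

  singleton-↪ω₁ : ∀ v → (λ z → Lift (lsuc 0ℓ) (z ≈ v)) ↪ ω₁
  singleton-↪ω₁ v = record
    { fun  = λ _ → ∅
    ; into = λ _ → ∅∈ω₁
    ; ext  = λ _ _ _ → ≈-refl {∅}
    ; inj  = λ (lift e) (lift e′) _ → ≈-trans e (≈-sym e′)
    }

  Small-cons : ∀ x y → Small x → Small y → Small (cons x y)
  Small-cons x y F G = ↪-⊆ (λ _ → trcl) (↪-⊎ F (↪-⊎ G (singleton-↪ω₁ y)))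
    where
    trcl : ∀ {z} → z ∈⁺ cons x y → z ∈⁺ x ⊎ z ∈⁺ y ⊎ Lift (lsuc 0ℓ) (z ≈ y)
    trcl p with ∈⁺⁻ p
    trcl p | inj₁ q with ∈-cons⁻ x y q
    ... | inj₁ r = inj₁ [ r ]
    ... | inj₂ e = inj₂ (inj₂ (lift e))
    trcl p | inj₂ (w , z∈⁺w , w∈) with ∈-cons⁻ x y w∈
    ... | inj₁ r = inj₁ (z∈⁺w ∷ʳ r)
    ... | inj₂ e = inj₂ (inj₁ (∈⁺-respʳ e z∈⁺w))

  module Cons-closed {ℓ} (Q : Pred V ℓ) (Q-resp : Resp Q) (Q-∅ : Q ∅)
                     (Q-cons : ∀ x y → Q x → Q y → Q (cons x y)) where

    Q-⟅⟆ : ∀ x y → Q x → Q y → Q ⟅ x , y ⟆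
    Q-⟅⟆ x y qx qy = Q-resp {_} {⟅ x , y ⟆} (≈-sym {⟅ x , y ⟆} (⟅⟆≈cons x y))
      (Q-cons (cons ∅ x) y (Q-cons ∅ x Q-∅ qx) qy)

    Q-opair : ∀ x y → Q x → Q y → Q (opair x y)
    Q-opair x y qx qy = Q-resp {_} {opair x y} (≈-sym {opair x y} (opair-def x y))
      (Q-⟅⟆ ⟅ x , x ⟆ ⟅ x , y ⟆ (Q-⟅⟆ x x qx qx) (Q-⟅⟆ x y qx qy))

    Q-⟨⟩ : ∀ x y z → Q x → Q y → Q z → Q ⟨ x , y , z ⟩
    Q-⟨⟩ x y z qx qy qz = Q-resp {_} {⟨ x , y , z ⟩} (≈-sym {⟨ x , y , z ⟩} (⟨⟩-def x y z))
      (Q-opair x (opair y z) qx (Q-opair y z qy qz))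

  module Small-closed = Cons-closed Small Small-resp Small-∅ Small-cons

  H-resp : Resp (H ω₂)
  H-resp e (F , G) =
      Composition.injection (include e) F
    , λ K → G (Composition.injection K (include e))
    where
    include : ∀ {x y} → x ≈ y → class (_∈⁺ y) ≼ class (_∈⁺ x)
    include e = record
      { to = λ (z , p) → z , ∈⁺-respʳ (≈-sym e) p ; cong = λ p → p ; injective = λ p → p }

  H-∈ : x ∈ y → H ω₂ y → H ω₂ x
  H-∈ {x} {y} x∈y (F , G) =
      Composition.injection include F
    , λ K → G (Composition.injection K include)
    where
    include : class (_∈⁺ x) ≼ class (_∈⁺ y)
    include = record
      { to = λ (z , p) → z , p ∷ʳ x∈y ; cong = λ p → p ; injective = λ p → p }

  countable-bounded : ∀ {a} → a ⊆ ω₂ → (_∈ a) ↪ ω → ∃[ b ] b ∈ ω₂ × a ⊆ b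
  countable-bounded a⊆ω₂ F = ↪ω₁-bounded (↪-codomain ω⊆ω₁ F) a⊆ω₂

  countable⇒Small : ∀ {a} → a ⊆ ω₂ → (_∈ a) ↪ ω → Small a
  countable⇒Small a⊆ω₂ F = let (b , b∈ , a⊆b) = countable-bounded a⊆ω₂ F in ⊆∈ω₂⇒Small b∈ a⊆b

  -- If no η below `i` contained `M ∩ i`, then inverting the enumeration of `M` would give a map
  -- from ω cofinal in `i`, against cf(i) = ω₁.
  countable-bounded-below : ∀ {M i} → i ∈ ω₂ → Cf i ω₁ → (_∈ M) ↪ ω → ∃[ η ] η ∈ i × M ∩ i ⊆ η
  countable-bounded-below {M} {i} i∈ω₂ (_ , (f₁ , _) , ¬cofinal) F = dne λ none →
      ¬cofinal ω ω∈ω₁ (cofinal-map , λ η η∈i →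
        let (z , z∈M∩i , z∉η) = escape none η η∈i
            z∈M = proj₁ (∈-∩⁻ M i z∈M∩i)
            z∈i = proj₂ (∈-∩⁻ M i z∈M∩i)
        in (F.fun z , F.into z∈M) , hit η η∈i z z∈M z∈i z∉η)
    where
    module F = _↪_ F
    -- Default value at the numbers that code no element of `M ∩ i`.
    i₀ : Σ V (_∈ i)
    i₀ = Func.to f₁ (∅ , ∅∈ω₁)
    Hit : V → Set₁
    Hit n = ∃[ z ] z ∈ M × z ∈ i × F.fun z ≈ n
    pick : ∀ {n} → Hit n ⊎ ¬ Hit n → Σ V (_∈ i)
    pick (inj₁ (z , _ , z∈i , _)) = z , z∈i
    pick (inj₂ _) = i₀
    pick-cong : ∀ {m n} → m ≈ n → (p : Hit m ⊎ ¬ Hit m) (q : Hit n ⊎ ¬ Hit n) → proj₁ (pick p) ≈ proj₁ (pick q)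
    pick-cong e (inj₁ (z , z∈M , z∈i , p)) (inj₁ (w , w∈M , w∈i , q)) =
      F.inj z∈M w∈M (≈-trans p (≈-trans e (≈-sym q)))
    pick-cong e (inj₁ (z , z∈M , z∈i , p)) (inj₂ absurd) = ⊥-elim (absurd (z , z∈M , z∈i , ≈-trans p e))
    pick-cong e (inj₂ absurd) (inj₁ (w , w∈M , w∈i , q)) = ⊥-elim (absurd (w , w∈M , w∈i , ≈-trans q (≈-sym e)))
    pick-cong e (inj₂ _) (inj₂ _) = ≈-refl
    cofinal-map : Func (elems ω) (elems i)
    cofinal-map = record
      { to   = λ (n , _) → pick (em (Hit n))
      ; cong = λ { {m , _} {n , _} e → pick-cong e (em (Hit m)) (em (Hit n)) }
      }
    escape : ¬ (∃[ η ] η ∈ i × M ∩ i ⊆ η) → ∀ η → η ∈ i → ∃[ z ] z ∈ M ∩ i × z ∉ η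
    escape none η η∈i = dne λ all → none (η , η∈i , λ z z∈ → dne₀ λ z∉η → all (z , z∈ , z∉η))
    oi : Ordinal i
    oi = ∈ω₂-Ordinal i∈ω₂
    hit : ∀ η → η ∈ i → ∀ z → z ∈ M → z ∈ i → z ∉ η → η ≤ proj₁ (pick (em (Hit (F.fun z))))
    hit η η∈i z z∈M z∈i z∉η with em (Hit (F.fun z))
    ... | inj₂ absurd = ⊥-elim (absurd (z , z∈M , z∈i , ≈-refl))
    ... | inj₁ (w , w∈M , w∈i , e) =
      ≮⇒≥ (Ordinal-∈ {i} {w} oi w∈i) (Ordinal-∈ {i} {η} oi η∈i)
        λ w∈η → z∉η (∈-respˡ η (F.inj w∈M z∈M e) w∈η)

-- Definability and Skolem hulls.

module Hulls (lem : ExcludedMiddle (lsuc 0ℓ)) (choice : Choice)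
  {ω₁ ω₂ : V} (succ₁ : ω₁ IsSuccessorCardinalOf ω) (succ₂ : ω₂ IsSuccessorCardinalOf ω₁)
  (π : Bijection (elems ω₂) (class (H ω₂))) (𝒴 : V) where

  open Sets
  open Ordinals lem
  open Cardinals lem choice
  open Regularity lem choice succ₁ succ₂
  open Hereditary lem choice succ₁ succ₂
  open Structure ω₁ ω₂ π 𝒴

  private
    variable
      ℓ ℓ′ : Level
      n : ℕ
      a b x y ξ β : V

  π-index : ∀ u → H ω₂ u → ∃[ ξ ] ξ π↦ⱽ u
  π-index u Hu = let ((ξ , ξ∈) , e) = Bijection.surjective π (u , Hu) in ξ , ξ∈ , e (≈-refl {ξ})

  π-injective : ∀ {ξ ξ′ u u′} → ξ π↦ⱽ u → ξ′ π↦ⱽ u′ → u ≈ u′ → ξ ≈ ξ′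
  π-injective (_ , e) (_ , e′) u≈u′ = Bijection.injective π (≈-trans e (≈-trans u≈u′ (≈-sym e′)))

  π-functional : ∀ {ξ ξ′ u u′} → ξ π↦ⱽ u → ξ′ π↦ⱽ u′ → ξ ≈ ξ′ → u ≈ u′
  π-functional (_ , e) (_ , e′) ξ≈ξ′ = ≈-trans (≈-sym e) (≈-trans (Bijection.cong π ξ≈ξ′) e′)

  π-resp : ∀ {ξ ξ′ u u′} → ξ ≈ ξ′ → u ≈ u′ → ξ π↦ⱽ u → ξ′ π↦ⱽ u′
  π-resp ξ≈ξ′ u≈u′ (ξ∈ , e) =
    ∈-respˡ ω₂ ξ≈ξ′ ξ∈ , ≈-trans (Bijection.cong π (≈-sym ξ≈ξ′)) (≈-trans e u≈u′)

  ⊨-resp : ∀ {ρ ρ′ : Vec V n} (φ : Formula n) → (∀ i → lookup ρ i ≈ lookup ρ′ i) → ρ ⊨ φ → ρ′ ⊨ φ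
  ⊨-resp {ρ = ρ} {ρ′} (i ∈′ j) e (lift p) = lift (∈-respʳ (e j) (∈-respˡ (lookup ρ j) (e i) p))
  ⊨-resp (i ≐ j)  e (lift p) = lift (≈-trans (≈-sym (e i)) (≈-trans p (e j)))
  ⊨-resp (i π↦ j) e (lift p) = lift (π-resp (e i) (e j) p)
  ⊨-resp (𝒴′ i)   e (lift p) = lift (∈-respˡ 𝒴 (e i) p)
  ⊨-resp (¬′ φ)   e ¬p p     = ¬p (⊨-resp φ (λ i → ≈-sym (e i)) p)
  ⊨-resp (φ ∧′ ψ) e (p , q)  = ⊨-resp φ e p , ⊨-resp ψ e q
  ⊨-resp (∃′ φ)   e (x , Hx , p) = x , Hx , ⊨-resp φ (λ { zero → ≈-refl ; (suc i) → e i }) p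

  ⊨-resp₀ : ∀ {ρ : Vec V n} (φ : Formula (suc n)) → x ≈ y → (x ∷ ρ) ⊨ φ → (y ∷ ρ) ⊨ φ
  ⊨-resp₀ φ e = ⊨-resp φ λ { zero → e ; (suc i) → ≈-refl }

  Skolem-resp : ∀ (φ : Formula (suc n)) ρ → x ≈ y → Skolem φ ρ x → Skolem φ ρ y
  Skolem-resp φ ρ e (inj₁ (Hx , p , least)) =
    inj₁ (H-resp e Hx , ⊨-resp₀ φ e p , λ z Hz q (α , β , r , s , t) →
      least z Hz q (α , β , r , π-resp ≈-refl (≈-sym e) s , t))
  Skolem-resp φ ρ e (inj₂ (absurd , e′)) = inj₂ (absurd , ≈-trans (≈-sym e) e′)

  Sk-resp : Resp (Sk a)
  Sk-resp {a} e (base p) = base (∈-respˡ a e p)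
  Sk-resp e (step φ ρ ρ∈ s) = step φ ρ ρ∈ (Skolem-resp φ ρ e s)

  Sk-mono : a ⊆ b → Sk a x → Sk b x
  Sk-mono* : ∀ {ρ : Vec V n} → a ⊆ b → All (Sk a) ρ → All (Sk b) ρ
  Sk-mono a⊆b (base p) = base (a⊆b _ p)
  Sk-mono a⊆b (step φ ρ ρ∈ s) = step φ ρ (Sk-mono* a⊆b ρ∈) s
  Sk-mono* a⊆b [] = []
  Sk-mono* a⊆b (p ∷ ps) = Sk-mono a⊆b p ∷ Sk-mono* a⊆b ps

  -- A property of assignments together with a formula that defines it over H(ω₂). Arguments about
  -- hulls can then use the meaning of a formula; the connectives missing from `Formula` are
  -- supplied classically.
  record Definable {n} (D : Vec V n → Set ℓ) : Set (lsuc 0ℓ Level.⊔ ℓ) where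
    field
      formula  : Formula n
      sound    : ∀ {ρ} → ρ ⊨ formula → D ρ
      complete : ∀ {ρ} → D ρ → ρ ⊨ formula

  open Definable

  module _ {n} {D : Vec V n → Set ℓ} {D′ : Vec V n → Set ℓ′} where

    infixr 6 _∧ᵈ_
    infixr 5 _∨ᵈ_
    infixr 4 _⇒ᵈ_

    _∧ᵈ_ : Definable D → Definable D′ → Definable (λ ρ → D ρ × D′ ρ)
    d ∧ᵈ d′ = record
      { formula  = formula d ∧′ formula d′
      ; sound    = λ (p , q) → sound d p , sound d′ q
      ; complete = λ (p , q) → complete d p , complete d′ q
      }

    _∨ᵈ_ : Definable D → Definable D′ → Definable (λ ρ → D ρ ⊎ D′ ρ)
    d ∨ᵈ d′ = record
      { formula  = ¬′ ((¬′ formula d) ∧′ (¬′ formula d′))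
      ; sound    = λ {ρ} h → [ (λ p → inj₁ (sound d p))
                             , (λ ¬p → [ (λ q → inj₂ (sound d′ q)) , (λ ¬q → ⊥-elim (h (¬p , ¬q))) ]′
                                 (em (ρ ⊨ formula d′)))
                             ]′ (em (ρ ⊨ formula d))
      ; complete = λ p (¬p , ¬q) → [ (λ r → ¬p (complete d r)) , (λ r → ¬q (complete d′ r)) ]′ p
      }

    _⇒ᵈ_ : Definable D → Definable D′ → Definable (λ ρ → D ρ → D′ ρ)
    d ⇒ᵈ d′ = record
      { formula  = ¬′ (formula d ∧′ (¬′ formula d′))
      ; sound    = λ h p → sound d′ (dne λ ¬q → h (complete d p , ¬q))
      ; complete = λ h (p , ¬q) → ¬q (complete d′ (h (sound d p)))
      }

    mapᵈ : (∀ ρ → D ρ → D′ ρ) → (∀ ρ → D′ ρ → D ρ) → Definable D → Definable D′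
    mapᵈ f g d = record
      { formula = formula d ; sound = λ p → f _ (sound d p) ; complete = λ p → complete d (g _ p) }

  ¬ᵈ : {D : Vec V n → Set ℓ} → Definable D → Definable (λ ρ → ¬ D ρ)
  ¬ᵈ d = record
    { formula = ¬′ formula d ; sound = λ h p → h (complete d p) ; complete = λ h p → h (sound d p) }

  ∃ᵈ : {D : Vec V (suc n) → Set ℓ} → Definable D → Definable (λ ρ → ∃[ x ] H ω₂ x × D (x ∷ ρ))
  ∃ᵈ d = record
    { formula  = ∃′ formula d
    ; sound    = λ (x , Hx , p) → x , Hx , sound d p
    ; complete = λ (x , Hx , p) → x , Hx , complete d p
    }

  ∀ᵈ : {D : Vec V (suc n) → Set ℓ} → Definable D → Definable (λ ρ → ∀ x → H ω₂ x → D (x ∷ ρ))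
  ∀ᵈ d = record
    { formula  = ¬′ (∃′ (¬′ formula d))
    ; sound    = λ h x Hx → sound d (dne λ ¬p → h (x , Hx , ¬p))
    ; complete = λ h (x , Hx , ¬p) → ¬p (complete d (h x Hx))
    }

  infix 7 _∈ᵈ_ _≈ᵈ_ _π↦ᵈ_

  _∈ᵈ_ : (i j : Fin n) → Definable (λ ρ → lookup ρ i ∈ lookup ρ j)
  i ∈ᵈ j = record { formula = i ∈′ j ; sound = lower ; complete = lift }

  _≈ᵈ_ : (i j : Fin n) → Definable (λ ρ → lookup ρ i ≈ lookup ρ j)
  i ≈ᵈ j = record { formula = i ≐ j ; sound = lower ; complete = lift }

  _π↦ᵈ_ : (i j : Fin n) → Definable (λ ρ → lookup ρ i π↦ⱽ lookup ρ j)
  i π↦ᵈ j = record { formula = i π↦ j ; sound = lower ; complete = lift }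

  module _ {n} {D : Vec V (suc n) → Set ℓ} (d : Definable D) {a} (ρ : Vec V n) (ρ∈ : All (Sk a) ρ) where

    abstract
      -- This is the elementarity of hulls. Among the `π`-indices of witnesses there is a least one,
      -- and the set it codes is the `<π`-least witness, that is, the value of the Skolem function.
      Sk-witness : ∀ y → H ω₂ y → D (y ∷ ρ) → ∃[ x ] Sk a x × H ω₂ x × D (x ∷ ρ)
      Sk-witness y Hy Dy =
        let (η , η↦y@(η∈ , _)) = π-index y Hy
            (m , m∈ , (z , m↦z , Hz , Dz) , least) =
              ∈-minimal ω₂ Coded (proj₁ ω₂.oκ⁺) η∈ (y , η↦y , Hy , complete d Dy)
        in z , step (formula d) ρ ρ∈ (inj₁ (Hz , Dz , λ w Hw Dw (α , β , α↦w , β↦z , α∈β) →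
                 least α (∈-respʳ (π-injective β↦z m↦z ≈-refl) α∈β) (w , α↦w , Hw , Dw)))
             , Hz , sound d Dz
        where
        Coded : Pred V (lsuc 0ℓ)
        Coded ξ = ∃[ z ] ξ π↦ⱽ z × H ω₂ z × (z ∷ ρ) ⊨ formula d

      Sk-define : ∀ y → H ω₂ y → D (y ∷ ρ) → (∀ z → H ω₂ z → D (z ∷ ρ) → z ≈ y) → Sk a y
      Sk-define y Hy Dy uniq = let (x , x∈ , Hx , Dx) = Sk-witness y Hy Dy in Sk-resp (uniq x Hx Dx) x∈

  IsCons : V → V → V → Set₁
  IsCons x y z = ∀ w → H ω₂ w → (w ∈ x → w ∈ y ⊎ w ≈ z) × (w ∈ y ⊎ w ≈ z → w ∈ x)

  IsConsᵈ : (i j k : Fin n) → Definable (λ ρ → IsCons (lookup ρ i) (lookup ρ j) (lookup ρ k))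
  IsConsᵈ i j k = ∀ᵈ ((zero ∈ᵈ suc i ⇒ᵈ zero ∈ᵈ suc j ∨ᵈ zero ≈ᵈ suc k)
                   ∧ᵈ (zero ∈ᵈ suc j ∨ᵈ zero ≈ᵈ suc k ⇒ᵈ zero ∈ᵈ suc i))

  IsCons-cons : ∀ y z → IsCons (cons y z) y z
  IsCons-cons y z w _ = ∈-cons⁻ y z , [ ∈-consˡ y z , ∈-consʳ y z ]′

  -- H(ω₂) is transitive, so extensionality needs to test only its elements, over which the
  -- quantifier in `IsCons` ranges.
  IsCons-unique : ∀ {x y z} → H ω₂ x → H ω₂ (cons y z) → IsCons x y z → x ≈ cons y z
  IsCons-unique {x} {y} {z} Hx Hc h = ⊆-antisym
    (λ w w∈ → proj₂ (IsCons-cons y z w (H-∈ w∈ Hx)) (proj₁ (h w (H-∈ w∈ Hx)) w∈))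
    (λ w w∈ → proj₂ (h w (H-∈ w∈ Hc)) (∈-cons⁻ y z w∈))

  Sk-cons : ∀ y z → H ω₂ (cons y z) → Sk a y → Sk a z → Sk a (cons y z)
  Sk-cons y z Hc y∈ z∈ = Sk-define (IsConsᵈ zero (suc zero) (suc (suc zero))) (y ∷ z ∷ []) (y∈ ∷ z∈ ∷ [])
    (cons y z) Hc (IsCons-cons y z) λ x Hx → IsCons-unique Hx Hc

  -- The formula x ≠ x has no witness, so its Skolem function takes the default value `∅`.
  Sk-∅ : Sk a ∅
  Sk-∅ = step (¬′ (zero ≐ zero)) [] [] (inj₂ ((λ (x , _ , ne) → ne (lift ≈-refl)) , ≈-refl {∅}))

  Sk-∩ : ∀ u v → H ω₂ (u ∩ v) → Sk a u → Sk a v → Sk a (u ∩ v)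
  Sk-∩ u v Huv u∈ v∈ = Sk-define
    (∀ᵈ ((zero ∈ᵈ suc zero ⇒ᵈ zero ∈ᵈ suc (suc zero) ∧ᵈ zero ∈ᵈ suc (suc (suc zero)))
      ∧ᵈ (zero ∈ᵈ suc (suc zero) ∧ᵈ zero ∈ᵈ suc (suc (suc zero)) ⇒ᵈ zero ∈ᵈ suc zero)))
    (u ∷ v ∷ []) (u∈ ∷ v∈ ∷ []) (u ∩ v) Huv
    (λ w _ → ∈-∩⁻ u v , λ (p , q) → ∈-∩⁺ u v p q)
    λ x Hx h → ⊆-antisym
      (λ w w∈ → let (p , q) = proj₁ (h w (H-∈ w∈ Hx)) w∈ in ∈-∩⁺ u v p q)
      (λ w w∈ → proj₂ (h w (H-∈ w∈ Huv)) (∈-∩⁻ u v w∈))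

  Sk-π : ξ π↦ⱽ x → Sk a ξ → Sk a x
  Sk-π {ξ} {x} ξ↦x@(ξ∈ , e) ξ∈Sk = Sk-define (suc zero π↦ᵈ zero) (ξ ∷ []) (ξ∈Sk ∷ []) x
    (H-resp e (proj₂ (Bijection.to π (ξ , ξ∈)))) ξ↦x
    λ z _ ξ↦z → π-functional ξ↦z ξ↦x ≈-refl

  Sk-π⁻¹ : ξ π↦ⱽ x → Sk a x → Sk a ξ
  Sk-π⁻¹ {ξ} {x} ξ↦x@(ξ∈ , e) x∈Sk = Sk-define (zero π↦ᵈ suc zero) (x ∷ []) (x∈Sk ∷ []) ξ
    (Small⇒H (∈ω₂⇒Small ξ∈)) ξ↦x
    λ ζ _ ζ↦x → π-injective ζ↦x ξ↦x ≈-refl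

  H-numeral : ∀ m → H ω₂ (numeral m)
  H-numeral m = Small⇒H (Small-∈ω (numeral∈ω m))

  Sk-numeral : ∀ m → Sk a (numeral m)
  Sk-numeral zero = Sk-∅
  Sk-numeral (suc m) = Sk-resp {_} {_} {numeral (suc m)} (≈-sym {numeral (suc m)} (numeral-suc m))
    (Sk-cons (numeral m) (numeral m) (Small⇒H (Small-cons (numeral m) (numeral m) s s))
      (Sk-numeral m) (Sk-numeral m))
    where
    s : Small (numeral m)
    s = Small-∈ω (numeral∈ω m)

  Inductive : V → Set₁
  Inductive w = (∀ e → H ω₂ e → (∀ z → H ω₂ z → ¬ z ∈ e) → e ∈ w)
              × (∀ y → H ω₂ y → y ∈ w → ∀ s → H ω₂ s → IsCons s y y → s ∈ w)

  ω-Inductive : Inductive ω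
  ω-Inductive = (λ e He h → ∈-respˡ ω (⊆-antisym {∅} {e} (λ z p → ⊥-elim (∉∅ z p))
                    (λ z z∈e → ⊥-elim (h z (H-∈ z∈e He) z∈e))) ∅∈ω)
              , (λ y Hy y∈ω s Hs h → ∈-respˡ ω (≈-sym (IsCons-unique Hs
                    (Small⇒H (Small-cons y y (Small-∈ω y∈ω) (Small-∈ω y∈ω))) h)) (ω-S y∈ω))

  numeral-∈-Inductive : ∀ m w → Inductive w → numeral m ∈ w
  numeral-∈-Inductive zero w (h , _) = h ∅ (H-numeral 0) λ z _ → ∉∅ z
  numeral-∈-Inductive (suc m) w ind@(_ , h) =
    h (numeral m) (H-numeral m) (numeral-∈-Inductive m w ind) (numeral (suc m)) (H-numeral (suc m))
      λ z Hz → (λ p → ∈-cons⁻ (numeral m) (numeral m) (∈-respʳ {z} {numeral (suc m)} (numeral-suc m) p))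
             , (λ p → ∈-respʳ {z} {_} {numeral (suc m)} (≈-sym {numeral (suc m)} (numeral-suc m))
                        (proj₂ (IsCons-cons (numeral m) (numeral m) z Hz) p))

  -- ω is the least inductive set, and this is absolute for H(ω₂).
  ∈ωᵈ : (i : Fin n) → Definable (λ ρ → lookup ρ i ∈ ω)
  ∈ωᵈ i = mapᵈ
    (λ ρ h → h ω (Small⇒H (∈ω₂⇒Small ω∈ω₂)) ω-Inductive)
    (λ ρ (m , e) w _ ind → ∈-respˡ w (≈-sym e) (numeral-∈-Inductive m w ind))
    (∀ᵈ ((∀ᵈ (∀ᵈ (¬ᵈ (zero ∈ᵈ suc zero)) ⇒ᵈ zero ∈ᵈ suc zero)
       ∧ᵈ ∀ᵈ (zero ∈ᵈ suc zero ⇒ᵈ ∀ᵈ (IsConsᵈ zero (suc zero) (suc zero) ⇒ᵈ zero ∈ᵈ suc (suc zero))))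
       ⇒ᵈ suc i ∈ᵈ zero))

  -- An enumeration n ↦ y of a countable set is represented by the set of the
  -- unordered pairs {n, y}, which determine it as long as no y is in ω.
  Linked : V → V → V → Set₁
  Linked f m y = ∃[ p ] H ω₂ p × p ∈ f × m ∈ p × y ∈ p × ¬ y ≈ m

  Linkedᵈ : (i j k : Fin n) → Definable (λ ρ → Linked (lookup ρ i) (lookup ρ j) (lookup ρ k))
  Linkedᵈ i j k = ∃ᵈ (zero ∈ᵈ suc i ∧ᵈ suc j ∈ᵈ zero ∧ᵈ suc k ∈ᵈ zero ∧ᵈ ¬ᵈ (suc k ≈ᵈ suc j))

  -- The elements of `u` in ω are left out because unordered pairs cannot tell them from indices;
  -- numerals belong to every hull by `Sk-numeral`.
  Enumerates : V → V → Set₁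
  Enumerates f u = ∀ y → H ω₂ y → y ∈ u × ¬ y ∈ ω → ∃[ m ] H ω₂ m × m ∈ ω ×
    (∀ z → H ω₂ z → (Linked f m z → z ≈ y) × (z ≈ y → Linked f m z))

  Enumeratesᵈ : (i j : Fin n) → Definable (λ ρ → Enumerates (lookup ρ i) (lookup ρ j))
  Enumeratesᵈ i j = ∀ᵈ (zero ∈ᵈ suc j ∧ᵈ ¬ᵈ (∈ωᵈ zero) ⇒ᵈ ∃ᵈ (∈ωᵈ zero ∧ᵈ
    ∀ᵈ ((Linkedᵈ (suc (suc (suc i))) (suc zero) zero ⇒ᵈ zero ≈ᵈ suc (suc zero))
     ∧ᵈ (zero ≈ᵈ suc (suc zero) ⇒ᵈ Linkedᵈ (suc (suc (suc i))) (suc zero) zero))))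

  module _ {u} (u⊆ω₂ : u ⊆ ω₂) (F : (_∈ u) ↪ ω) where
    private
      module F = _↪_ F

      Pair : Pred V (lsuc 0ℓ)
      Pair p = ∃[ y ] Lift (lsuc 0ℓ) (y ∈ u × y ∉ ω × p ≈ ⟅ F.fun y , y ⟆)

      Pair-resp : Resp Pair
      Pair-resp e (y , lift (p , q , r)) = y , lift (p , q , ≈-trans (≈-sym e) r)

    abstract
      enumeration : V
      enumeration = sep (img (λ y → ⟅ F.fun y , y ⟆) u) Pair

      ∈-enumeration⁻ : ∀ {p} → p ∈ enumeration → Pair p
      ∈-enumeration⁻ p∈ = proj₂ (∈-sep⁻ _ Pair Pair-resp p∈)

      ∈-enumeration⁺ : ∀ y → y ∈ u → y ∉ ω → ⟅ F.fun y , y ⟆ ∈ enumeration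
      ∈-enumeration⁺ y y∈u y∉ω = ∈-sep⁺ {⟅ F.fun y , y ⟆} (img h u) Pair Pair-resp
        (∈-img⁺ {y} {⟅ F.fun y , y ⟆} h u (λ p q e → ⟅⟆-cong (F.ext p q e) e) y∈u (≈-refl {⟅ F.fun y , y ⟆}))
        (y , lift (y∈u , y∉ω , ≈-refl {⟅ F.fun y , y ⟆}))
        where
        h : V → V
        h y = ⟅ F.fun y , y ⟆

    private
      Small-pair : ∀ y → y ∈ u → Small ⟅ F.fun y , y ⟆
      Small-pair y y∈u = Small-closed.Q-⟅⟆ (F.fun y) y (Small-∈ω (F.into y∈u)) (∈ω₂⇒Small (u⊆ω₂ y y∈u))

      pairs : Pair ↪ ω₁
      pairs = relation⇒↪ ω₁.oκ⁺ (λ p c → ∃[ y ] Lift (lsuc 0ℓ) (y ∈ u × p ≈ ⟅ F.fun y , y ⟆ × c ≈ F.fun y))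
        (λ p (y , lift (y∈u , _ , e)) → F.fun y , ω⊆ω₁ _ (F.into y∈u) , y , lift (y∈u , e , ≈-refl))
        λ { {p} {p′} (y , lift (y∈u , e , f)) (y′ , lift (y′∈u , e′ , f′)) c≈c′ →
            let Fy≈ = ≈-trans (≈-sym f) (≈-trans c≈c′ f′)
            in ≈-trans {p} {⟅ F.fun y , y ⟆} {p′} e (≈-trans {⟅ F.fun y , y ⟆} {⟅ F.fun y′ , y′ ⟆} {p′}
                 (⟅⟆-cong Fy≈ (F.inj y∈u y′∈u Fy≈)) (≈-sym {p′} {⟅ F.fun y′ , y′ ⟆} e′)) }

    -- Its transitive closure contains only the pairs themselves, ordinals below a bound of `u`, and
    -- natural numbers.
    Small-enumeration : Small enumeration
    Small-enumeration = ↪-⊆ trcl (↪-⊎ pairs (↪-⊎ (∈ω₂⇒↪ω₁ top∈) (∈ω₂⇒↪ω₁ ω∈ω₂)))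
      where
      top : V
      top = proj₁ (countable-bounded u⊆ω₂ F)
      top∈ : top ∈ ω₂
      top∈ = proj₁ (proj₂ (countable-bounded u⊆ω₂ F))
      u⊆top : u ⊆ top
      u⊆top = proj₂ (proj₂ (countable-bounded u⊆ω₂ F))
      members : ∀ y v → y ∈ u → v ∈ ⟅ F.fun y , y ⟆ → v ∈ top ⊎ v ∈ ω
      members y v y∈u v∈ with ∈-⟅⟆⁻ {v} (F.fun y) y v∈
      ... | inj₁ e = inj₂ (∈-respˡ ω (≈-sym e) (F.into y∈u))
      ... | inj₂ e = inj₁ (∈-respˡ top (≈-sym e) (u⊆top y y∈u))
      transfer : ∀ {z v} → z ∈⁺ v → v ∈ top ⊎ v ∈ ω → Lift (lsuc 0ℓ) (z ∈ top) ⊎ Lift (lsuc 0ℓ) (z ∈ ω)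
      transfer p (inj₁ q) = inj₁ (lift (Transitive-∈⁺ (proj₁ (∈ω₂-Ordinal top∈)) (p ∷ʳ q)))
      transfer p (inj₂ q) = inj₂ (lift (Transitive-∈⁺ (proj₁ ω-Ordinal) (p ∷ʳ q)))
      trcl : ∀ z → z ∈⁺ enumeration → Pair z ⊎ Lift (lsuc 0ℓ) (z ∈ top) ⊎ Lift (lsuc 0ℓ) (z ∈ ω)
      trcl z p with ∈⁺⁻ p
      ... | inj₁ q = inj₁ (∈-enumeration⁻ q)
      ... | inj₂ (w , z∈⁺w , w∈) with ∈-enumeration⁻ w∈
      ...   | y , lift (y∈u , _ , e) with ∈⁺⁻ (∈⁺-respʳ {_} {⟅ F.fun y , y ⟆} e z∈⁺w)
      ...     | inj₁ q = inj₂ ([ (λ r → inj₁ (lift r)) , (λ r → inj₂ (lift r)) ]′ (members y z y∈u q))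
      ...     | inj₂ (v , z∈⁺v , v∈) = inj₂ (transfer z∈⁺v (members y v y∈u v∈))

    enumeration-Enumerates : Enumerates enumeration u
    enumeration-Enumerates y Hy (y∈u , y∉ω) =
      F.fun y , Small⇒H (Small-∈ω (F.into y∈u)) , F.into y∈u , λ z Hz → unlink z , link z
      where
      m : V
      m = F.fun y
      unlink : ∀ z → Linked enumeration m z → z ≈ y
      unlink z (p , _ , p∈ , m∈p , z∈p , z≉m) with ∈-enumeration⁻ p∈
      ... | y′ , lift (y′∈u , y′∉ω , e)
        with ∈-⟅⟆⁻ (F.fun y′) y′ (∈-respʳ {m} {p} {⟅ F.fun y′ , y′ ⟆} e m∈p)
           | ∈-⟅⟆⁻ (F.fun y′) y′ (∈-respʳ {z} {p} {⟅ F.fun y′ , y′ ⟆} e z∈p)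
      ...   | inj₂ m≈y′ | _ = ⊥-elim (y′∉ω (∈-respˡ ω m≈y′ (F.into y∈u)))
      ...   | inj₁ m≈Fy′ | inj₁ z≈Fy′ = ⊥-elim (z≉m (≈-trans z≈Fy′ (≈-sym m≈Fy′)))
      ...   | inj₁ m≈Fy′ | inj₂ z≈y′ = ≈-trans z≈y′ (≈-sym (F.inj y∈u y′∈u m≈Fy′))
      link : ∀ z → z ≈ y → Linked enumeration m z
      link z e = ⟅ m , y ⟆ , Small⇒H (Small-pair y y∈u) , ∈-enumeration⁺ y y∈u y∉ω
        , ∈-⟅⟆ˡ m y ≈-refl , ∈-⟅⟆ʳ m y e , λ z≈m → y∉ω (∈-respˡ ω (≈-trans (≈-sym z≈m) e) (F.into y∈u))

    -- By elementarity the hull of `a` contains some enumeration `f` of `u`. Each `y` in `u` outside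
    -- ω is definable from `f` and its index, which is a numeral and hence in the hull.
    Sk-countable : Sk a u → ∀ y → y ∈ u → Sk a y
    Sk-countable {a} u∈ y y∈u = [ natural , (λ y∉ω → linked (enum y Hy (y∈u , y∉ω))) ]′ (em₀ (y ∈ ω))
      where
      Hy : H ω₂ y
      Hy = Small⇒H (∈ω₂⇒Small (u⊆ω₂ y y∈u))
      natural : y ∈ ω → Sk a y
      natural (m , e) = Sk-resp {a} {numeral m} (≈-sym e) (Sk-numeral m)
      witness : ∃[ f ] Sk a f × H ω₂ f × Enumerates f u
      witness = Sk-witness (Enumeratesᵈ zero (suc zero)) (u ∷ []) (u∈ ∷ [])
        enumeration (Small⇒H Small-enumeration) enumeration-Enumerates
      f : V
      f = proj₁ witness
      enum : Enumerates f u
      enum = proj₂ (proj₂ (proj₂ witness))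
      linked : ∃[ m ] H ω₂ m × m ∈ ω × (∀ z → H ω₂ z → (Linked f m z → z ≈ y) × (z ≈ y → Linked f m z)) → Sk a y
      linked (m , Hm , (k , m≈k) , link) =
        Sk-define (Linkedᵈ (suc (suc zero)) (suc zero) zero) (m ∷ f ∷ [])
          (Sk-resp {a} {numeral k} {m} (≈-sym m≈k) (Sk-numeral k) ∷ proj₁ (proj₂ witness) ∷ []) y Hy
          (proj₂ (link y Hy) ≈-refl) λ z Hz → proj₁ (link z Hz)

    -- With ζ = min(N ∖ β), u ∩ β = u ∩ ζ because u ⊆ N.
    Sk-initial-segment : ∀ {N} → SkClosed N → N ⊆ ω₂ → Sk N u → β ∈ ω₂ → Sk N (u ∩ β)
    Sk-initial-segment {β} {N} closed N⊆ω₂ u∈ β∈ω₂ with em (∃[ ζ ] ζ ∈ N × ζ ∉ β)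
    -- Here all of `N`, and with it `u`, lies below `β`, so the cut is `u` itself.
    ... | inj₂ N⊆β = Sk-resp (⊆-antisym
            (λ z z∈u → ∈-∩⁺ u β z∈u (dne₀ λ z∉β → N⊆β (z , u⊆N z z∈u , z∉β)))
            (λ z z∈ → proj₁ (∈-∩⁻ u β z∈))) u∈
      where
      u⊆N : u ⊆ N
      u⊆N z z∈u = Equivalence.to (closed z) (Sk-countable u∈ z z∈u , u⊆ω₂ z z∈u)
    ... | inj₁ (ζ₀ , ζ₀∈N , ζ₀∉β) with ∈-minimal ω₂ (λ ζ → Lift (lsuc 0ℓ) (ζ ∈ N × ζ ∉ β)) (proj₁ ω₂.oκ⁺)
                                       (N⊆ω₂ ζ₀ ζ₀∈N) (lift (ζ₀∈N , ζ₀∉β))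
    ...   | ζ , ζ∈ω₂ , lift (ζ∈N , ζ∉β) , least = Sk-resp (⊆-antisym
            (λ z z∈ → let (z∈u , z∈ζ) = ∈-∩⁻ u ζ z∈ in
              ∈-∩⁺ u β z∈u (dne₀ λ z∉β → least z z∈ζ (lift (u⊆N z z∈u , z∉β))))
            (λ z z∈ → let (z∈u , z∈β) = ∈-∩⁻ u β z∈ in
              ∈-∩⁺ u ζ z∈u (∈-≤-trans (∈ω₂-Ordinal ζ∈ω₂) z∈β
                (≮⇒≥ (∈ω₂-Ordinal ζ∈ω₂) (∈ω₂-Ordinal β∈ω₂) ζ∉β))))
            (Sk-∩ u ζ (Small⇒H small) u∈ (base ζ∈N))
      where
      u⊆N : u ⊆ N
      u⊆N z z∈u = Equivalence.to (closed z) (Sk-countable u∈ z z∈u , u⊆ω₂ z z∈u)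
      small : Small (u ∩ ζ)
      small = countable⇒Small (λ z z∈ → u⊆ω₂ z (proj₁ (∈-∩⁻ u ζ z∈)))
        (↪-⊆ (λ z z∈ → proj₁ (∈-∩⁻ u ζ z∈)) F)

  module _ {β} (lim : LimitPoint C β) (β∈ω₂ : β ∈ ω₂) where
    private
      oβ : Ordinal β
      oβ = ∈ω₂-Ordinal β∈ω₂

      Below : (V → Set₁) → Set₁
      Below P = ∃[ c ] C c × c ∈ β × P c

      common : {P Q : V → Set₁} → (∀ {c c′} → c ⊆ c′ → P c → P c′) → (∀ {c c′} → c ⊆ c′ → Q c → Q c′) →
               Below P → Below Q → Below (λ c → P c × Q c)
      common P-mono Q-mono (c , Cc , c∈ , p) (c′ , Cc′ , c′∈ , q)
        with trichotomy c c′ (Ordinal-∈ {β} {c} oβ c∈) (Ordinal-∈ {β} {c′} oβ c′∈)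
      ... | inj₁ r = c′ , Cc′ , c′∈ , P-mono (proj₁ (Ordinal-∈ {β} {c′} oβ c′∈) c r) p , q
      ... | inj₂ (inj₁ e) = c′ , Cc′ , c′∈ , P-mono (⊆-reflexive e) p , q
      ... | inj₂ (inj₂ r) = c , Cc , c∈ , p , Q-mono (proj₁ (Ordinal-∈ {β} {c} oβ c∈) c′ r) q

      Sk-below : ∀ {x} → Sk β x → Below λ c → Sk c x
      Sk-below* : ∀ {ρ : Vec V n} → All (Sk β) ρ → Below λ c → All (Sk c) ρ
      Sk-below {x} (base p) = let (c , Cc , c∈ , x∈c) = proj₂ lim x p in c , Cc , c∈ , base x∈c
      Sk-below (step φ ρ ρ∈ s) = let (c , Cc , c∈ , h) = Sk-below* ρ∈ in c , Cc , c∈ , step φ ρ h s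
      Sk-below* [] = let (η , η∈) = proj₁ lim ; (c , Cc , c∈ , _) = proj₂ lim η η∈ in c , Cc , c∈ , []
      Sk-below* (p ∷ ps) =
        let (c , Cc , c∈ , q , qs) = common Sk-mono Sk-mono* (Sk-below p) (Sk-below* ps)
        in c , Cc , c∈ , q ∷ qs

    -- A derivation in Sk(β) uses finitely many members of β. All of them lie below a single c in
    -- `C` with c < β, and the closure of c applies.
    limit-SkClosed : SkClosed β
    limit-SkClosed ξ = mk⇔
      (λ (p , ξ∈ω₂) → let (c , (_ , closed) , c∈ , q) = Sk-below p in
         proj₁ oβ c c∈ ξ (Equivalence.to (closed ξ) (q , ξ∈ω₂)))
      (λ ξ∈β → base ξ∈β , proj₁ ω₂.oκ⁺ β β∈ω₂ ξ ξ∈β)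

-- Comparison points and the union of two conditions with the same trace.

module Amalgamation (lem : ExcludedMiddle (lsuc 0ℓ)) (choice : Choice)
  {ω₁ ω₂ : V} (succ₁ : ω₁ IsSuccessorCardinalOf ω) (succ₂ : ω₂ IsSuccessorCardinalOf ω₁)
  (π : Bijection (elems ω₂) (class (H ω₂))) {𝒴 : V}
  (𝒴-countable : ∀ a → a ∈ 𝒴 → CountableSubset ω₂ a)
  {Γ : V} (Γ⊆Λ : ∀ α → α ∈ Γ → Structure.Λ ω₁ ω₂ π 𝒴 α) where

  open Sets
  open Ordinals lem
  open Cardinals lem choice
  open Regularity lem choice succ₁ succ₂
  open Hereditary lem choice succ₁ succ₂
  open Hulls lem choice succ₁ succ₂ π 𝒴
  open Structure ω₁ ω₂ π 𝒴
  open Forcing Γ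

  private
    variable
      i M N x y z : V

  Γ⊆ω₂ : i ∈ Γ → i ∈ ω₂
  Γ⊆ω₂ {i} i∈Γ = proj₁ (Γ⊆Λ i i∈Γ)

  Γ-Ordinal : ∀ i → i ∈ Γ → Ordinal i
  Γ-Ordinal i i∈Γ = ∈ω₂-Ordinal (Γ⊆ω₂ i∈Γ)

  Γ-Cf : ∀ i → i ∈ Γ → Cf i ω₁
  Γ-Cf i i∈Γ = proj₁ (proj₂ (Γ⊆Λ i i∈Γ))

  𝒴-⊆ : M ∈ 𝒴 → M ⊆ ω₂
  𝒴-⊆ {M} M∈ = proj₁ (𝒴-countable M M∈)

  𝒴-↪ω : M ∈ 𝒴 → (_∈ M) ↪ ω
  𝒴-↪ω {M} M∈ = elems≼⇒↪ ω-Ordinal (proj₂ (𝒴-countable M M∈))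

  ∩-⊆ˡ : ∀ x y → x ∩ y ⊆ x
  ∩-⊆ˡ x y z z∈ = proj₁ (∈-∩⁻ x y z∈)

  ∩-𝒴-⊆ : ∀ M β → M ∈ 𝒴 → M ∩ β ⊆ ω₂
  ∩-𝒴-⊆ M β M∈ z z∈ = 𝒴-⊆ M∈ z (∩-⊆ˡ M β z z∈)

  ∩-𝒴-↪ω : ∀ M β → M ∈ 𝒴 → (_∈ M ∩ β) ↪ ω
  ∩-𝒴-↪ω M β M∈ = ↪-⊆ (∩-⊆ˡ M β) (𝒴-↪ω M∈)

  Small-∩ : ∀ M β → M ∈ 𝒴 → Small (M ∩ β)
  Small-∩ M β M∈ = countable⇒Small (∩-𝒴-⊆ M β M∈) (∩-𝒴-↪ω M β M∈)

  ∩-absorb : ∀ M β β′ → β ⊆ β′ → (M ∩ β′) ∩ β ≈ M ∩ β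
  ∩-absorb M β β′ β⊆β′ = ⊆-antisym
    (λ z z∈ → let (p , q) = ∈-∩⁻ (M ∩ β′) β z∈ in ∈-∩⁺ M β (∩-⊆ˡ M β′ z p) q)
    (λ z z∈ → let (p , q) = ∈-∩⁻ M β z∈ in ∈-∩⁺ (M ∩ β′) β (∈-∩⁺ M β′ p (β⊆β′ z q)) q)

  ≤-respˡ : x ≈ y → x ≤ z → y ≤ z
  ≤-respˡ {z = z} e (inj₁ p) = inj₁ (∈-respˡ z e p)
  ≤-respˡ e (inj₂ p) = inj₂ (≈-trans (≈-sym e) p)

  ⋃-∩-Ordinal : ∀ M β → M ⊆ ω₂ → Ordinal (⋃ (M ∩ β))
  ⋃-∩-Ordinal M β M⊆ = ⋃-Ordinal (M ∩ β) λ y y∈ → ∈ω₂-Ordinal (M⊆ y (∩-⊆ˡ M β y y∈))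

  ⋃-∩-≤ : ∀ M β ζ → M ⊆ ω₂ → Ordinal ζ → (∀ m → m ∈ M → m ∈ β → m ∈ ζ) → ⋃ (M ∩ β) ≤ ζ
  ⋃-∩-≤ M β ζ M⊆ oζ h = ⊆⇒≤ (⋃-∩-Ordinal M β M⊆) oζ λ z z∈ →
    let (m , z∈m , m∈) = ∈-⋃⁻ (M ∩ β) z∈
        (m∈M , m∈β) = ∈-∩⁻ M β m∈
    in proj₁ oζ m (h m m∈M m∈β) z z∈m

  Γ[]-transfer : ∀ M N β → M ∩ β ≈ N ∩ β → Γ[ M ] β → Γ[ N ] β
  Γ[]-transfer M N β e (β∈Γ , h) = β∈Γ , λ ζ ζ∈Γ s≤ζ → h ζ ζ∈Γ (≤-respˡ (⋃-cong (≈-sym e)) s≤ζ)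

  -- If `j` were below `β`, it would be a point of `Γ` in [sup(M ∩ β), β), an interval that `Γ[ M ]`
  -- requires to miss `Γ`.
  Γ[]-≤ : ∀ M β j → M ⊆ ω₂ → j ∈ Γ → (∀ m → m ∈ M → m ∈ β → m ∈ j) → Γ[ M ] β → β ≤ j
  Γ[]-≤ M β j M⊆ j∈Γ h (β∈Γ , gap) =
    ≮⇒≥ (Γ-Ordinal j j∈Γ) (Γ-Ordinal β β∈Γ) (gap j j∈Γ (⋃-∩-≤ M β j M⊆ (Γ-Ordinal j j∈Γ) h))

  -- If Γ_M ∩ Γ_N had no largest element, the least element of Γ that is not
  -- below its supremum δ would belong to it, as M and N are cofinal in δ.
  comparison-exists : ∀ M N i → M ⊆ ω₂ → N ⊆ ω₂ → i ∈ Γ →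
    (∀ ζ → Γ[ M ] ζ → Γ[ N ] ζ → ζ ≤ i) → ∃[ β ] ComparisonPoint M N β
  comparison-exists M N i M⊆ N⊆ i∈Γ below-i = dne no-largest
    where
    Both : Pred V (lsuc 0ℓ)
    Both ζ = Γ[ M ] ζ × Γ[ N ] ζ

    Γ[]-resp : ∀ M {x y} → x ≈ y → Γ[ M ] x → Γ[ M ] y
    Γ[]-resp M e (p , h) = ∈-respˡ Γ e p , λ ζ ζ∈Γ s≤ζ ζ∈y →
      h ζ ζ∈Γ (≤-respˡ (⋃-cong (∩-cong {M} ≈-refl (≈-sym e))) s≤ζ) (∈-respʳ (≈-sym e) ζ∈y)

    Both-resp : Resp Both
    Both-resp e (p , q) = Γ[]-resp M e p , Γ[]-resp N e q

    δ : V
    δ = ⋃ (sep ω₂ Both)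

    ∈δ⁻ : ∀ {z} → z ∈ δ → ∃[ ζ ] z ∈ ζ × Both ζ
    ∈δ⁻ z∈δ = let (ζ , z∈ζ , ζ∈) = ∈-⋃⁻ (sep ω₂ Both) z∈δ in
      ζ , z∈ζ , proj₂ (∈-sep⁻ ω₂ Both Both-resp ζ∈)

    ∈δ⁺ : ∀ {z} ζ → z ∈ ζ → Both ζ → z ∈ δ
    ∈δ⁺ ζ z∈ζ both = ∈-⋃⁺ (sep ω₂ Both) z∈ζ (∈-sep⁺ ω₂ Both Both-resp (Γ⊆ω₂ (proj₁ (proj₁ both))) both)

    oδ : Ordinal δ
    oδ = ⋃-Ordinal (sep ω₂ Both) λ y y∈ → ∈ω₂-Ordinal (proj₁ (∈-sep⁻ ω₂ Both Both-resp y∈))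

    i∉δ : i ∉ δ
    i∉δ i∈δ = let (ζ , i∈ζ , p , q) = ∈δ⁻ i∈δ in ≤⇒≯ (Γ-Ordinal i i∈Γ) (below-i ζ p q) i∈ζ

    no-largest : ¬ ¬ (∃[ β ] ComparisonPoint M N β)
    no-largest none =
      let (ζ , both , β∈ζ) = larger β (in-Γ[] M M⊆ proj₁ , in-Γ[] N N⊆ proj₂)
      in β∉δ (∈δ⁺ ζ β∈ζ both)
      where
      larger : ∀ ζ → Both ζ → ∃[ ζ′ ] Both ζ′ × ζ ∈ ζ′
      larger ζ both@((ζ∈Γ , _) , _) = dne λ absurd → none (ζ , both , λ ζ′ p q →
        ≮⇒≥ (Γ-Ordinal ζ ζ∈Γ) (Γ-Ordinal ζ′ (proj₁ p)) λ ζ∈ζ′ → absurd (ζ′ , (p , q) , ζ∈ζ′))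

      least : ∃[ β ] β ∈ ω₂ × Lift (lsuc 0ℓ) (β ∈ Γ × β ∉ δ) × (∀ z → z ∈ β → ¬ Lift (lsuc 0ℓ) (z ∈ Γ × z ∉ δ))
      least = ∈-minimal ω₂ (λ β → Lift (lsuc 0ℓ) (β ∈ Γ × β ∉ δ)) (proj₁ ω₂.oκ⁺) (Γ⊆ω₂ i∈Γ) (lift (i∈Γ , i∉δ))

      β : V
      β = proj₁ least
      β∈Γ : β ∈ Γ
      β∈Γ = proj₁ (lower (proj₁ (proj₂ (proj₂ least))))
      β∉δ : β ∉ δ
      β∉δ = proj₂ (lower (proj₁ (proj₂ (proj₂ least))))
      δ≤β : δ ≤ β
      δ≤β = ≮⇒≥ (Γ-Ordinal β β∈Γ) oδ β∉δ

      in-Γ[] : ∀ K → K ⊆ ω₂ → (∀ {ζ} → Both ζ → Γ[ K ] ζ) → Γ[ K ] β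
      -- A point ζ of Γ in the forbidden gap below β would lie below δ, so below some common ζ₁,
      -- with a larger common ζ₂. Since ζ₁ is not in the gap of ζ₂, some m in K satisfies ζ₁ < m <
      -- ζ₂. Then m < δ ≤ β, hence ζ < ζ₁ < sup(K ∩ β) ≤ ζ.
      in-Γ[] K K⊆ both⇒ = β∈Γ , λ ζ ζ∈Γ s≤ζ ζ∈β →
        let ζ∈δ = dne₀ λ ζ∉δ → proj₂ (proj₂ (proj₂ least)) ζ ζ∈β (lift (ζ∈Γ , ζ∉δ))
            (ζ₁ , ζ∈ζ₁ , both₁) = ∈δ⁻ ζ∈δ
            (ζ₂ , both₂ , ζ₁∈ζ₂) = larger ζ₁ both₁
            ζ₁∈Γ = proj₁ (proj₁ both₁)
            ζ₁∈sup = dne₀ λ ζ₁∉ → proj₂ (both⇒ both₂) ζ₁ ζ₁∈Γ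
                       (≮⇒≥ (Γ-Ordinal ζ₁ ζ₁∈Γ) (⋃-∩-Ordinal K ζ₂ K⊆) ζ₁∉) ζ₁∈ζ₂
            (m , ζ₁∈m , m∈) = ∈-⋃⁻ (K ∩ ζ₂) ζ₁∈sup
            (m∈K , m∈ζ₂) = ∈-∩⁻ K ζ₂ m∈
            m∈β = ≤⇒⊆ (Γ-Ordinal β β∈Γ) δ≤β m (∈δ⁺ ζ₂ m∈ζ₂ both₂)
            ζ₁∈ζ = ≤⇒⊆ (Γ-Ordinal ζ ζ∈Γ) s≤ζ ζ₁ (∈-⋃⁺ (K ∩ β) ζ₁∈m (∈-∩⁺ K β m∈K m∈β))
        in ∈-asym ζ ζ₁ ζ∈ζ₁ ζ₁∈ζ

  Traced : Pred V (lsuc 0ℓ)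
  Traced i = ∀ γ → γ ∈ i → ∀ a → a ∈ 𝒴 → ∀ ξ → ξ π↦ⱽ (a ∩ γ) → ξ ∈ i

  trace-code : ∀ M β i ξ → M ∈ 𝒴 → i ∈ Γ → Traced i → β ≤ i → ξ π↦ⱽ (M ∩ β) → ξ ∈ i
  trace-code M β i ξ M∈ i∈Γ traced (inj₁ β∈i) ξ↦ = traced β β∈i M M∈ ξ ξ↦
  trace-code M β i ξ M∈ i∈Γ traced (inj₂ β≈i) ξ↦ =
    let (η , η∈i , M∩i⊆η) = countable-bounded-below (Γ⊆ω₂ i∈Γ) (Γ-Cf i i∈Γ) (𝒴-↪ω M∈)
        e : M ∩ β ≈ M ∩ η
        e = ⊆-antisym
          (λ z z∈ → let (p , q) = ∈-∩⁻ M β z∈ in ∈-∩⁺ M η p (M∩i⊆η z (∈-∩⁺ M i p (∈-respʳ β≈i q))))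
          (λ z z∈ → let (p , q) = ∈-∩⁻ M η z∈ in
            ∈-∩⁺ M β p (∈-respʳ (≈-sym β≈i) (proj₁ (Γ-Ordinal i i∈Γ) η η∈i z q)))
    in traced η η∈i M M∈ ξ (π-resp ≈-refl e ξ↦)

  Comparable : V → V → Set₁
  Comparable M N = ∃[ β ] ComparisonPoint M N β ×
    ((M ∩ β ≈ N ∩ β) ⊎ Sk N (M ∩ β) ⊎ Sk M (N ∩ β))

  Comparable-sym : Comparable M N → Comparable N M
  Comparable-sym (β , ((p , q) , h) , c) = β , ((q , p) , λ ζ r s → h ζ s r) ,
    [ (λ e → inj₁ (≈-sym e)) , [ (λ s → inj₂ (inj₂ s)) , (λ s → inj₂ (inj₁ s)) ]′ ]′ c

  module _ {i j} (i∈Γ : i ∈ Γ) (j∈Γ : j ∈ Γ) (i∈j : i ∈ j) (traced : Traced i) where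

    private
      oi = Γ-Ordinal i i∈Γ
      oj = Γ-Ordinal j j∈Γ

    Comparable-transfer : ∀ {M N N′} → 𝒳 M → 𝒳 N → 𝒳 N′ → M ⊆ j → N ∩ j ≈ N′ ∩ i →
                          Comparable M N′ → Comparable M N
    Comparable-transfer {M} {N} {N′} (M∈𝒴 , closedM , _) (N∈𝒴 , _) (N′∈𝒴 , closedN′ , _)
                        M⊆j N≈N′ (β′ , cp′ , cases) =
        β , cp , transfer cases
      where
      -- Two applications of `Γ[]-≤`: first ζ ≤ j because M lies below j. Then N ∩ ζ is part of N ∩
      -- j = N′ ∩ i, so all of it lies below i.
      below-i : ∀ ζ → Γ[ M ] ζ → Γ[ N ] ζ → ζ ≤ i
      below-i ζ p q = Γ[]-≤ N ζ i (𝒴-⊆ N∈𝒴) i∈Γ (λ m m∈N m∈ζ →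
          proj₂ (∈-∩⁻ N′ i (∈-respʳ N≈N′ (∈-∩⁺ N j m∈N (≤⇒⊆ oj ζ≤j m m∈ζ))))) q
        where
        ζ≤j : ζ ≤ j
        ζ≤j = Γ[]-≤ M ζ j (𝒴-⊆ M∈𝒴) j∈Γ (λ m m∈M _ → M⊆j m m∈M) p

      point : ∃[ β ] ComparisonPoint M N β
      point = comparison-exists M N i (𝒴-⊆ M∈𝒴) (𝒴-⊆ N∈𝒴) i∈Γ below-i
      β : V
      β = proj₁ point
      cp : ComparisonPoint M N β
      cp = proj₂ point
      β≤i : β ≤ i
      β≤i = below-i β (proj₁ (proj₁ cp)) (proj₂ (proj₁ cp))
      β∈ω₂ : β ∈ ω₂
      β∈ω₂ = Γ⊆ω₂ (proj₁ (proj₁ (proj₁ cp)))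
      β⊆i : β ⊆ i
      β⊆i = ≤⇒⊆ oi β≤i
      N≈N′-below : N ∩ β ≈ N′ ∩ β
      N≈N′-below = ⊆-antisym
        (λ z z∈ → let (p , q) = ∈-∩⁻ N β z∈ in
          ∈-∩⁺ N′ β (∩-⊆ˡ N′ i z (∈-respʳ N≈N′ (∈-∩⁺ N j p (proj₁ oj i i∈j z (β⊆i z q))))) q)
        (λ z z∈ → let (p , q) = ∈-∩⁻ N′ β z∈ in
          ∈-∩⁺ N β (∩-⊆ˡ N j z (∈-respʳ (≈-sym N≈N′) (∈-∩⁺ N′ i p (β⊆i z q)))) q)
      -- N and N′ coincide below β, so β lies in `Γ[ N′ ]` as well and is at most the largest common
      -- point of M and N′.
      β⊆β′ : β ⊆ β′
      β⊆β′ = ≤⇒⊆ (Γ-Ordinal β′ (proj₁ (proj₁ (proj₁ cp′))))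
        (proj₂ cp′ β (proj₁ (proj₁ cp)) (Γ[]-transfer N N′ β N≈N′-below (proj₂ (proj₁ cp))))

      transfer : (M ∩ β′ ≈ N′ ∩ β′) ⊎ Sk N′ (M ∩ β′) ⊎ Sk M (N′ ∩ β′) →
                 (M ∩ β ≈ N ∩ β) ⊎ Sk N (M ∩ β) ⊎ Sk M (N ∩ β)
      transfer (inj₁ e) = inj₁
        (≈-trans (≈-sym (∩-absorb M β β′ β⊆β′))
        (≈-trans (∩-cong {M ∩ β′} {N′ ∩ β′} e ≈-refl)
        (≈-trans (∩-absorb N′ β β′ β⊆β′) (≈-sym N≈N′-below))))
      transfer (inj₂ (inj₂ s)) = inj₂ (inj₂ (Sk-resp
        (≈-trans (∩-absorb N′ β β′ β⊆β′) (≈-sym N≈N′-below))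
        (Sk-initial-segment (∩-𝒴-⊆ N′ β′ N′∈𝒴) (∩-𝒴-↪ω N′ β′ N′∈𝒴) closedM (𝒴-⊆ M∈𝒴) s β∈ω₂)))
      -- Sk(N′) and Sk(N) need not coincide, so M ∩ β travels as its code ξ: ξ lies in N′ because
      -- Sk(N′) has no new ordinals, and below i because i is traced. Thus ξ is in N′ ∩ i = N ∩ j,
      -- and decoding happens in Sk(N).
      transfer (inj₂ (inj₁ s)) = inj₂ (inj₁ (Sk-π ξ↦ (base ξ∈N)))
        where
        s′ : Sk N′ (M ∩ β)
        s′ = Sk-resp (∩-absorb M β β′ β⊆β′)
          (Sk-initial-segment (∩-𝒴-⊆ M β′ M∈𝒴) (∩-𝒴-↪ω M β′ M∈𝒴) closedN′ (𝒴-⊆ N′∈𝒴) s β∈ω₂)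
        code : ∃[ ξ ] ξ π↦ⱽ (M ∩ β)
        code = π-index (M ∩ β) (Small⇒H (Small-∩ M β M∈𝒴))
        ξ : V
        ξ = proj₁ code
        ξ↦ : ξ π↦ⱽ (M ∩ β)
        ξ↦ = proj₂ code
        ξ∈N′ : ξ ∈ N′
        ξ∈N′ = Equivalence.to (closedN′ ξ) (Sk-π⁻¹ ξ↦ s′ , proj₁ ξ↦)
        ξ∈N : ξ ∈ N
        ξ∈N = ∩-⊆ˡ N j ξ (∈-respʳ (≈-sym N≈N′) (∈-∩⁺ N′ i ξ∈N′
                (trace-code M β i ξ M∈𝒴 i∈Γ traced β≤i ξ↦)))

  ∪-Finite : ∀ x y → Finite x → Finite y → Finite (x ∪ y)
  ∪-Finite x y (zs , h) (ws , k) = zs ++ ws , λ z → mk⇔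
    (λ z∈ → [ (λ p → Any.++⁺ˡ (Equivalence.to (h z) p)) , (λ p → Any.++⁺ʳ zs (Equivalence.to (k z) p)) ]′
              (∈-∪⁻ x y z∈))
    (λ z∈ → [ (λ p → ∈-∪ˡ x y (Equivalence.from (h z) p)) , (λ p → ∈-∪ʳ x y (Equivalence.from (k z) p)) ]′
              (Any.++⁻ zs z∈))

  FirstIn : V → Pred V (lsuc 0ℓ)
  FirstIn i t = ∃[ α ] ∃[ γ ] ∃[ β ] Lift (lsuc 0ℓ) (t ≈ ⟨ α , γ , β ⟩ × α ∈ i)

  -- The traces are taken at different heights, `i` for p and `j` for q. Hence q has no points,
  -- first coordinates or elements of models in [i, j).
  record Agree (p q : Condition) (i j : V) : Set₁ where
    private
      module p = Condition p
      module q = Condition q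
    field
      a-agree  : p.a ∩ i ≈ q.a ∩ j
      x-agreeˡ : ∀ t → t ∈ p.x → FirstIn i t → t ∈ q.x
      x-agreeʳ : ∀ t → t ∈ q.x → FirstIn j t → t ∈ p.x × FirstIn i t
      A-agree  : ∀ N → N ∈ q.A → ∃[ N′ ] N′ ∈ p.A × N ∩ j ≈ N′ ∩ i

  record Bounded (p : Condition) (j : V) : Set₁ where
    private
      module p = Condition p
    field
      a-bounded : p.a ⊆ j
      x-bounded : ∀ t → t ∈ p.x → ∀ α γ β → t ≈ ⟨ α , γ , β ⟩ → α ∈ j
      A-bounded : ∀ M → M ∈ p.A → M ⊆ j

  module Amalgam (p q : Condition) {i j} (i∈Γ : i ∈ Γ) (j∈Γ : j ∈ Γ) (i∈j : i ∈ j) (traced : Traced i)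
                 (agree : Agree p q i j) (bounded : Bounded p j) where
    private
      module p = Condition p
      module q = Condition q
    open Agree agree
    open Bounded bounded

    private
      oi : Ordinal i
      oi = Γ-Ordinal i i∈Γ
      oj : Ordinal j
      oj = Γ-Ordinal j j∈Γ

      p-𝒳 : ∀ M → M ∈ p.A → 𝒳 M
      p-𝒳 = proj₁ p.A-adequate
      q-𝒳 : ∀ M → M ∈ q.A → 𝒳 M
      q-𝒳 = proj₁ q.A-adequate

      a-cof : ∀ ξ → ξ ∈ p.a ⊎ ξ ∈ q.a → ξ ∈ ω₂ × Cf ξ ω
      a-cof ξ = [ p.a-cof ξ , q.a-cof ξ ]′

      cross : ∀ M N → M ∈ p.A → N ∈ q.A → Comparable M N
      cross M N M∈ N∈ =
        let (N′ , N′∈ , e) = A-agree N N∈ in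
        Comparable-transfer i∈Γ j∈Γ i∈j traced (p-𝒳 M M∈) (q-𝒳 N N∈) (p-𝒳 N′ N′∈) (A-bounded M M∈) e
          (proj₂ p.A-adequate M N′ M∈ N′∈)

      comparable : ∀ M N → M ∈ p.A ⊎ M ∈ q.A → N ∈ p.A ⊎ N ∈ q.A → Comparable M N
      comparable M N (inj₁ m) (inj₁ n) = proj₂ p.A-adequate M N m n
      comparable M N (inj₂ m) (inj₂ n) = proj₂ q.A-adequate M N m n
      comparable M N (inj₁ m) (inj₂ n) = cross M N m n
      comparable M N (inj₂ m) (inj₁ n) = Comparable-sym (cross N M n m)

      Disjoint : V → V → V → V → Set₁
      Disjoint γ β γ′ β′ = ∀ ζ → ¬ ((γ ≤ ζ × ζ ∈ β) × (γ′ ≤ ζ × ζ ∈ β′))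

      ⟨⟩-bounded : ∀ α γ β → ⟨ α , γ , β ⟩ ∈ p.x → α ∈ j
      ⟨⟩-bounded α γ β t∈ = x-bounded ⟨ α , γ , β ⟩ t∈ α γ β (≈-refl {⟨ α , γ , β ⟩})

      q-to-p : ∀ α γ β → α ∈ j → ⟨ α , γ , β ⟩ ∈ q.x → ⟨ α , γ , β ⟩ ∈ p.x
      q-to-p α γ β α∈j t∈ = proj₁ (x-agreeʳ ⟨ α , γ , β ⟩ t∈ (α , γ , β , lift (≈-refl {⟨ α , γ , β ⟩} , α∈j)))

      disjoint : ∀ α γ β γ′ β′ → ⟨ α , γ , β ⟩ ∈ p.x ⊎ ⟨ α , γ , β ⟩ ∈ q.x →
        ⟨ α , γ′ , β′ ⟩ ∈ p.x ⊎ ⟨ α , γ′ , β′ ⟩ ∈ q.x →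
        ¬ (⟨ α , γ , β ⟩ ≈ ⟨ α , γ′ , β′ ⟩) → Disjoint γ β γ′ β′
      disjoint α γ β γ′ β′ (inj₁ t) (inj₁ t′) = p.x-disjoint α γ β γ′ β′ t t′
      disjoint α γ β γ′ β′ (inj₂ t) (inj₂ t′) = q.x-disjoint α γ β γ′ β′ t t′
      -- Both triples have first coordinate α, and α < j since one of them is in p. So the triple of
      -- q is in the common trace, and disjointness holds in p.
      disjoint α γ β γ′ β′ (inj₁ t) (inj₂ t′) =
        p.x-disjoint α γ β γ′ β′ t (q-to-p α γ′ β′ (⟨⟩-bounded α γ β t) t′)
      disjoint α γ β γ′ β′ (inj₂ t) (inj₁ t′) =
        p.x-disjoint α γ β γ′ β′ (q-to-p α γ β (⟨⟩-bounded α γ′ β′ t′) t) t′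

      a-A : ∀ ξ M → ξ ∈ p.a ⊎ ξ ∈ q.a → M ∈ p.A ⊎ M ∈ q.A → ⋃ (M ∩ ξ) ≈ ξ →
            (∃[ ζ ] ζ ∈ M × ζ ∉ ξ) → ξ ∈ M
      a-A ξ M (inj₁ ξ∈) (inj₁ M∈) = p.a-A ξ M ξ∈ M∈
      a-A ξ M (inj₂ ξ∈) (inj₂ M∈) = q.a-A ξ M ξ∈ M∈
      a-A ξ M (inj₁ ξ∈) (inj₂ M∈) sup≈ξ above = [ low , (λ ξ∉i → ⊥-elim (high ξ∉i)) ]′ (em₀ (ξ ∈ i))
        where
        ξ∈j : ξ ∈ j
        ξ∈j = a-bounded ξ ξ∈
        oξ : Ordinal ξ
        oξ = Ordinal-∈ {j} {ξ} oj ξ∈j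
        low : ξ ∈ i → ξ ∈ M
        low ξ∈i = q.a-A ξ M (∩-⊆ˡ q.a j ξ (∈-respʳ a-agree (∈-∩⁺ p.a i ξ∈ ξ∈i))) M∈ sup≈ξ above
        -- M ∩ ξ ⊆ M ∩ j is bounded by some η < i ≤ ξ.
        high : ξ ∉ i → ⊥
        high ξ∉i =
          let (M′ , M′∈ , e) = A-agree M M∈
              (η , η∈i , M′∩i⊆η) = countable-bounded-below (Γ⊆ω₂ i∈Γ) (Γ-Cf i i∈Γ)
                                     (𝒴-↪ω (proj₁ (p-𝒳 M′ M′∈)))
              η∈ξ = ∈-≤-trans oξ η∈i (≮⇒≥ oξ oi ξ∉i)
              (m , η∈m , m∈) = ∈-⋃⁻ (M ∩ ξ) (∈-respʳ (≈-sym sup≈ξ) η∈ξ)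
              (m∈M , m∈ξ) = ∈-∩⁻ M ξ m∈
          in ∈-asym η m η∈m (M′∩i⊆η m (∈-respʳ e (∈-∩⁺ M j m∈M (proj₁ oj ξ ξ∈j m m∈ξ))))
      a-A ξ M (inj₂ ξ∈) (inj₁ M∈) sup≈ξ above@(ζ , ζ∈M , ζ∉ξ) =
        [ low , (λ ξ∉j → ⊥-elim (ζ∉ξ (high ξ∉j))) ]′ (em₀ (ξ ∈ j))
        where
        oξ : Ordinal ξ
        oξ = ∈ω₂-Ordinal (proj₁ (q.a-cof ξ ξ∈))
        low : ξ ∈ j → ξ ∈ M
        low ξ∈j = p.a-A ξ M (∩-⊆ˡ p.a i ξ (∈-respʳ (≈-sym a-agree) (∈-∩⁺ q.a j ξ∈ ξ∈j))) M∈ sup≈ξ above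
        -- M lies below j ≤ ξ, which leaves no element of M outside ξ.
        high : ξ ∉ j → ζ ∈ ξ
        high ξ∉j = ∈-≤-trans oξ (A-bounded M M∈ ζ ζ∈M) (≮⇒≥ oξ oj ξ∉j)

      x-A : ∀ M α γ β → M ∈ p.A ⊎ M ∈ q.A → α ∈ M → ⟨ α , γ , β ⟩ ∈ p.x ⊎ ⟨ α , γ , β ⟩ ∈ q.x →
              (Meets M γ β → γ ∈ M × β ∈ M)
            × (¬ Meets M γ β → ⋃ (M ∩ α) ∈ γ)
      x-A M α γ β (inj₁ M∈) α∈M (inj₁ t) = p.x-A M α γ β M∈ α∈M t
      x-A M α γ β (inj₂ M∈) α∈M (inj₂ t) = q.x-A M α γ β M∈ α∈M t
      x-A M α γ β (inj₁ M∈) α∈M (inj₂ t) =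
        p.x-A M α γ β M∈ α∈M (q-to-p α γ β (A-bounded M M∈ α α∈M) t)
      -- α < j as it occurs in p, so α is in M ∩ j = M′ ∩ i and falls below i. The triple thus
      -- belongs to the common trace and the requirement is one of q.
      x-A M α γ β (inj₂ M∈) α∈M (inj₁ t) =
        let (M′ , _ , e) = A-agree M M∈
            α∈i = proj₂ (∈-∩⁻ M′ i (∈-respʳ e (∈-∩⁺ M j α∈M (⟨⟩-bounded α γ β t))))
        in q.x-A M α γ β M∈ α∈M (x-agreeˡ ⟨ α , γ , β ⟩ t (α , γ , β , lift (≈-refl {⟨ α , γ , β ⟩} , α∈i)))

    amalgam : Condition
    amalgam = record
      { a = p.a ∪ q.a
      ; x = p.x ∪ q.x
      ; A = p.A ∪ q.A
      ; a-finite   = ∪-Finite p.a q.a p.a-finite q.a-finite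
      ; a-cof      = λ ξ ξ∈ → a-cof ξ (∈-∪⁻ p.a q.a ξ∈)
      ; x-finite   = ∪-Finite p.x q.x p.x-finite q.x-finite
      ; x-triples  = λ t t∈ → [ p.x-triples t , q.x-triples t ]′ (∈-∪⁻ p.x q.x t∈)
      ; A-finite   = ∪-Finite p.A q.A p.A-finite q.A-finite
      ; A-adequate = (λ M M∈ → [ p-𝒳 M , q-𝒳 M ]′ (∈-∪⁻ p.A q.A M∈))
                   , (λ M N M∈ N∈ → comparable M N (∈-∪⁻ p.A q.A M∈) (∈-∪⁻ p.A q.A N∈))
      ; x-disjoint = λ α γ β γ′ β′ t t′ →
          disjoint α γ β γ′ β′ (∈-∪⁻ {⟨ α , γ , β ⟩} p.x q.x t) (∈-∪⁻ {⟨ α , γ′ , β′ ⟩} p.x q.x t′)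
      ; a-A        = λ ξ M ξ∈ M∈ → a-A ξ M (∈-∪⁻ p.a q.a ξ∈) (∈-∪⁻ p.A q.A M∈)
      ; x-A        = λ M α γ β M∈ α∈M t →
          x-A M α γ β (∈-∪⁻ p.A q.A M∈) α∈M (∈-∪⁻ {⟨ α , γ , β ⟩} p.x q.x t)
      }

    compatible : Compatible ℙ p q
    compatible = amalgam
      , ((λ z → ∈-∪ˡ p.a q.a) , (λ z → ∈-∪ˡ p.x q.x) , (λ z → ∈-∪ˡ p.A q.A))
      , ((λ z → ∈-∪ʳ p.a q.a) , (λ z → ∈-∪ʳ p.x q.x) , (λ z → ∈-∪ʳ p.A q.A))

-- Trace codes, pressing down and the chain condition.

module Chains (lem : ExcludedMiddle (lsuc 0ℓ)) (choice : Choice)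
  {ω₁ ω₂ : V} (succ₁ : ω₁ IsSuccessorCardinalOf ω) (succ₂ : ω₂ IsSuccessorCardinalOf ω₁)
  (π : Bijection (elems ω₂) (class (H ω₂))) {𝒴 : V}
  (𝒴-countable : ∀ a → a ∈ 𝒴 → CountableSubset ω₂ a) (thin : Thin ω₁ ω₂ 𝒴)
  {Γ : V} (Γ⊆Λ : ∀ α → α ∈ Γ → Structure.Λ ω₁ ω₂ π 𝒴 α) (Γ-stationary : Stationary ω₂ Γ) where

  open Sets
  open Ordinals lem
  open Cardinals lem choice
  open Regularity lem choice succ₁ succ₂
  open Hereditary lem choice succ₁ succ₂
  open Hulls lem choice succ₁ succ₂ π 𝒴
  open Amalgamation lem choice succ₁ succ₂ π 𝒴-countable Γ⊆Λ
  open Structure ω₁ ω₂ π 𝒴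
  open Forcing Γ

  private
    variable
      i z : V
    module ℙ = Poset ℙ

  code : Condition → V
  code p = ⟨ a , x , A ⟩
    where open Condition p

  module _ (p : Condition) where
    open Condition p

    A-𝒴 : ∀ M → M ∈ A → M ∈ 𝒴
    A-𝒴 M M∈ = proj₁ (proj₁ A-adequate M M∈)

    Small-code : Small (code p)
    Small-code = Small-closed.Q-⟨⟩ a x A
      (fin a a-finite λ ξ ξ∈ → ∈ω₂⇒Small (proj₁ (a-cof ξ ξ∈)))
      (fin x x-finite triple)
      (fin A A-finite λ M M∈ → countable⇒Small (𝒴-⊆ (A-𝒴 M M∈)) (𝒴-↪ω (A-𝒴 M M∈)))
      where
      fin : ∀ X → Finite X → (∀ z → z ∈ X → Small z) → Small X
      fin = finite-ind Small Small Small-resp Small-∅ Small-cons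
      triple : ∀ t → t ∈ x → Small t
      triple t t∈ =
        let (α , γ , β , e , α∈Γ , γ∈β , β∈α) = x-triples t t∈
            α∈ = Γ⊆ω₂ α∈Γ
            β∈ = proj₁ ω₂.oκ⁺ α α∈ β β∈α
            γ∈ = proj₁ ω₂.oκ⁺ β β∈ γ γ∈β
        in Small-resp {⟨ α , γ , β ⟩} {t} (≈-sym {t} {⟨ α , γ , β ⟩} e)
             (Small-closed.Q-⟨⟩ α γ β (∈ω₂⇒Small α∈) (∈ω₂⇒Small γ∈) (∈ω₂⇒Small β∈))

  FirstIn-resp : Resp (FirstIn i)
  FirstIn-resp {i} {t} {t′} e (α , γ , β , lift (f , α∈i)) =
    α , γ , β , lift (≈-trans {t′} {t} {⟨ α , γ , β ⟩} (≈-sym e) f , α∈i)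

  abstract
    xᵗ : Condition → V → V
    xᵗ p i = sep (Condition.x p) (FirstIn i)

    Aᵗ : Condition → V → V
    Aᵗ p i = img (_∩ i) (Condition.A p)

    ∈-xᵗ⁻ : ∀ p i → z ∈ xᵗ p i → z ∈ Condition.x p × FirstIn i z
    ∈-xᵗ⁻ p i = ∈-sep⁻ (Condition.x p) (FirstIn i) FirstIn-resp

    ∈-xᵗ⁺ : ∀ p i → z ∈ Condition.x p → FirstIn i z → z ∈ xᵗ p i
    ∈-xᵗ⁺ p i = ∈-sep⁺ (Condition.x p) (FirstIn i) FirstIn-resp

    ∈-Aᵗ⁻ : ∀ p i → z ∈ Aᵗ p i → ∃[ M ] M ∈ Condition.A p × z ≈ M ∩ i
    ∈-Aᵗ⁻ p i = ∈-img⁻ (_∩ i) (Condition.A p)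

    ∈-Aᵗ⁺ : ∀ p i M → M ∈ Condition.A p → z ≈ M ∩ i → z ∈ Aᵗ p i
    ∈-Aᵗ⁺ p i M = ∈-img⁺ (_∩ i) (Condition.A p) (λ _ _ e → ∩-cong e (≈-refl {i}))

  trace : Condition → V → V
  trace p i = ⟨ Condition.a p ∩ i , xᵗ p i , Aᵗ p i ⟩

  trace⇒Agree : ∀ p q i j → trace p i ≈ trace q j → Agree p q i j
  trace⇒Agree p q i j e = record
    { a-agree  = a≈
    ; x-agreeˡ = λ t t∈ f → proj₁ (∈-xᵗ⁻ q j (∈-respʳ x≈ (∈-xᵗ⁺ p i t∈ f)))
    ; x-agreeʳ = λ t t∈ f → ∈-xᵗ⁻ p i (∈-respʳ (≈-sym x≈) (∈-xᵗ⁺ q j t∈ f))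
    ; A-agree  = λ N N∈ → ∈-Aᵗ⁻ p i (∈-respʳ (≈-sym A≈) (∈-Aᵗ⁺ q j N N∈ ≈-refl))
    }
    where
    module p = Condition p
    module q = Condition q
    parts : p.a ∩ i ≈ q.a ∩ j × xᵗ p i ≈ xᵗ q j × Aᵗ p i ≈ Aᵗ q j
    parts = ⟨⟩-inj (p.a ∩ i) (xᵗ p i) (Aᵗ p i) (q.a ∩ j) (xᵗ q j) (Aᵗ q j) e
    a≈ : p.a ∩ i ≈ q.a ∩ j
    a≈ = proj₁ parts
    x≈ : xᵗ p i ≈ xᵗ q j
    x≈ = proj₁ (proj₂ parts)
    A≈ : Aᵗ p i ≈ Aᵗ q j
    A≈ = proj₂ (proj₂ parts)

  module _ (p : Condition) {i} (i∈Γ : i ∈ Γ) (traced : Traced i) where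
    open Condition p

    private
      -- `Sk-cons` asks that the new set be in H(ω₂). Carrying `Small` along supplies this, so that
      -- the conjunction is closed under `cons`.
      Visible : Pred V (lsuc 0ℓ)
      Visible z = Small z × Sk i z

      Visible-resp : Resp Visible
      Visible-resp e (s , k) = Small-resp e s , Sk-resp e k

      Visible-∅ : Visible ∅
      Visible-∅ = Small-∅ , Sk-∅

      Visible-cons : ∀ y z → Visible y → Visible z → Visible (cons y z)
      Visible-cons y z (s , k) (s′ , k′) =
        Small-cons y z s s′ , Sk-cons y z (Small⇒H (Small-cons y z s s′)) k k′

      module Visible = Cons-closed Visible Visible-resp Visible-∅ Visible-cons

      listed : ∀ zs X → (∀ z → z ∈ X → Any.Any (z ≈_) zs) → (∀ z → z ∈ X → Visible z) → Visible X
      listed = listed-ind Visible Visible Visible-resp Visible-∅ Visible-cons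

      Visible-∈ : ∀ ξ → ξ ∈ i → Visible ξ
      Visible-∈ ξ ξ∈i = ∈ω₂⇒Small (proj₁ ω₂.oκ⁺ i (Γ⊆ω₂ i∈Γ) ξ ξ∈i) , base ξ∈i

      Visible-a : Visible (a ∩ i)
      Visible-a = listed (proj₁ a-finite) (a ∩ i)
        (λ z z∈ → Equivalence.to (proj₂ a-finite z) (∩-⊆ˡ a i z z∈))
        (λ z z∈ → Visible-∈ z (proj₂ (∈-∩⁻ a i z∈)))

      Visible-x : Visible (xᵗ p i)
      Visible-x = listed (proj₁ x-finite) (xᵗ p i)
        (λ z z∈ → Equivalence.to (proj₂ x-finite z) (proj₁ (∈-xᵗ⁻ p i z∈)))
        λ t t∈ → triple t (proj₁ (∈-xᵗ⁻ p i t∈)) (proj₂ (∈-xᵗ⁻ p i t∈))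
        where
        ti = proj₁ (Γ-Ordinal i i∈Γ)
        triple : ∀ t → t ∈ x → FirstIn i t → Visible t
        triple t t∈ (α′ , γ′ , β′ , lift (e′ , α′∈i)) =
          let (α , γ , β , e , _ , γ∈β , β∈α) = x-triples t t∈
              (α≈ , _) = ⟨⟩-inj α γ β α′ γ′ β′ (≈-trans {⟨ α , γ , β ⟩} {t} {⟨ α′ , γ′ , β′ ⟩}
                           (≈-sym {t} {⟨ α , γ , β ⟩} e) e′)
              α∈i = ∈-respˡ i (≈-sym α≈) α′∈i
              β∈i = ti α α∈i β β∈α
              γ∈i = ti β β∈i γ γ∈β
          in Visible-resp {⟨ α , γ , β ⟩} {t} (≈-sym {t} {⟨ α , γ , β ⟩} e)
               (Visible.Q-⟨⟩ α γ β (Visible-∈ α α∈i) (Visible-∈ γ γ∈i) (Visible-∈ β β∈i))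

      Visible-A : Visible (Aᵗ p i)
      Visible-A = listed (map (_∩ i) (proj₁ A-finite)) (Aᵗ p i)
        (λ z z∈ → let (M , M∈ , e) = ∈-Aᵗ⁻ p i z∈ in
          Any.map⁺ (Any.map (λ f → ≈-trans e (∩-cong f (≈-refl {i}))) (Equivalence.to (proj₂ A-finite M) M∈)))
        (λ z z∈ → let (M , M∈ , e) = ∈-Aᵗ⁻ p i z∈ in Visible-resp (≈-sym e) (visible M (A-𝒴 p M M∈)))
        where
        visible : ∀ M → M ∈ 𝒴 → Visible (M ∩ i)
        visible M M∈𝒴 =
          let small = Small-∩ M i M∈𝒴
              (ξ , ξ↦) = π-index (M ∩ i) (Small⇒H small)
          in small , Sk-π ξ↦ (base (trace-code M i i ξ M∈𝒴 i∈Γ traced (inj₂ ≈-refl) ξ↦))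

      Visible-trace : Visible (trace p i)
      Visible-trace = Visible.Q-⟨⟩ (a ∩ i) (xᵗ p i) (Aᵗ p i) Visible-a Visible-x Visible-A

    abstract
      trace-index : ∃[ ξ ] ξ ∈ i × ξ π↦ⱽ trace p i
      trace-index =
        let (ξ , ξ↦) = π-index (trace p i) (Small⇒H (proj₁ Visible-trace))
            closed = limit-SkClosed (proj₂ (proj₂ (Γ⊆Λ i i∈Γ))) (Γ⊆ω₂ i∈Γ)
        in ξ , Equivalence.to (closed ξ) (Sk-π⁻¹ ξ↦ (proj₂ Visible-trace) , proj₁ ξ↦) , ξ↦

  TraceBound : V → V → Set₁
  TraceBound γ b = ∀ a → a ∈ 𝒴 → ∀ ξ → ξ π↦ⱽ (a ∩ γ) → ξ ∈ b

  abstract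
    -- Thinness leaves at most ω₁ many cuts at `γ`. Each has one code, and regularity of ω₂ bounds
    -- all of them.
    trace-bound : ∀ γ → γ ∈ ω₂ → ∃[ b ] b ∈ ω₂ × TraceBound γ b
    trace-bound γ γ∈ =
      let (b , b∈ , h) = uniform-bound (class≼⇒↪ ω₁.oκ⁺ (thin γ γ∈)) (λ u b → ∀ ξ → ξ π↦ⱽ u → ξ ∈ b)
            (λ e f g ξ ξ↦ → ∈-respʳ f (g ξ (π-resp ≈-refl (≈-sym e) ξ↦)))
            (λ {_} {b} {b′} b′∈ b∈b′ g ξ ξ↦ → proj₁ (∈ω₂-Ordinal b′∈) b b∈b′ ξ (g ξ ξ↦))
            (λ u (a , a∈ , e) →
              let (ξ , ξ↦) = π-index (a ∩ γ) (Small⇒H (Small-∩ a γ a∈))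
              in S ξ , ω₂-S (proj₁ ξ↦) , λ ζ ζ↦ → ∈-consʳ ξ ξ (π-injective ζ↦ ξ↦ e))
      in b , b∈ , λ a a∈ → h (a ∩ γ) (a , a∈ , ≈-refl)

  Finite⇒↪ω₁ : ∀ X → Finite X → (λ z → Lift (lsuc 0ℓ) (z ∈ X)) ↪ ω₁
  Finite⇒↪ω₁ X fin = finite-ind (λ X → (λ z → Lift (lsuc 0ℓ) (z ∈ X)) ↪ ω₁) (λ _ → ⊤)
    (λ e → ↪-⊆ λ z (lift z∈) → lift (∈-respʳ (≈-sym e) z∈))
    (lift↪ (↪-codomain ω⊆ω₁ (↪-⊆ (λ z z∈ → ⊥-elim (∉∅ z z∈)) (↪-refl ω))))
    (λ X y F _ → ↪-⊆ (λ z (lift z∈) → [ (λ p → inj₁ (lift p)) , (λ e → inj₂ (lift e)) ]′ (∈-cons⁻ X y z∈))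
                   (↪-⊎ F (singleton-↪ω₁ y)))
    X fin _

  Bounded-mono : ∀ p {b b′} → Ordinal b′ → b ≤ b′ → Bounded p b → Bounded p b′
  Bounded-mono p ob′ b≤b′ bd = record
    { a-bounded = λ z z∈ → ≤⇒⊆ ob′ b≤b′ z (a-bounded z z∈)
    ; x-bounded = λ t t∈ α γ β e → ≤⇒⊆ ob′ b≤b′ α (x-bounded t t∈ α γ β e)
    ; A-bounded = λ M M∈ z z∈ → ≤⇒⊆ ob′ b≤b′ z (A-bounded M M∈ z z∈)
    }
    where open Bounded bd

  abstract
    bounded : ∀ p → ∃[ b ] b ∈ ω₂ × Bounded p b
    bounded p =
      let (b₁ , b₁∈ , h₁) = ↪ω₁-bounded (↪-⊆ (λ _ → lift) (Finite⇒↪ω₁ a a-finite)) (λ ξ ξ∈ → proj₁ (a-cof ξ ξ∈))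
          (b₂ , b₂∈ , h₂) = uniform-bound (Finite⇒↪ω₁ x x-finite)
            (λ t b → ∀ α γ β → t ≈ ⟨ α , γ , β ⟩ → α ∈ b)
            (λ {t} {t′} e f g α γ β e′ → ∈-respʳ f (g α γ β (≈-trans {t} {t′} {⟨ α , γ , β ⟩} e e′)))
            (λ {_} {b} {b′} b′∈ b∈b′ g α γ β e → proj₁ (∈ω₂-Ordinal b′∈) b b∈b′ α (g α γ β e))
            (λ t (lift t∈) → let (α , γ , β , e , α∈Γ , _) = x-triples t t∈ in
              S α , ω₂-S (Γ⊆ω₂ α∈Γ) , λ α′ γ′ β′ e′ → ∈-consʳ α α (proj₁ (⟨⟩-inj α′ γ′ β′ α γ β
                (≈-trans {⟨ α′ , γ′ , β′ ⟩} {t} {⟨ α , γ , β ⟩} (≈-sym {t} {⟨ α′ , γ′ , β′ ⟩} e′) e))))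
          (b₃ , b₃∈ , h₃) = uniform-bound (Finite⇒↪ω₁ A A-finite) (λ M b → M ⊆ b)
            (λ e f g z z∈ → ∈-respʳ f (g z (∈-respʳ (≈-sym e) z∈)))
            (λ {_} {b} {b′} b′∈ b∈b′ g z z∈ → proj₁ (∈ω₂-Ordinal b′∈) b b∈b′ z (g z z∈))
            (λ M (lift M∈) → countable-bounded (𝒴-⊆ (A-𝒴 p M M∈)) (𝒴-↪ω (A-𝒴 p M M∈)))
          (b₄ , b₄∈ , b₁∈b₄ , b₂∈b₄) = upper-bound ω₂.oκ⁺ ω₂-S b₁∈ b₂∈
          (b₅ , b₅∈ , b₄∈b₅ , b₃∈b₅) = upper-bound ω₂.oκ⁺ ω₂-S b₄∈ b₃∈
          t₅ = proj₁ (∈ω₂-Ordinal b₅∈)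
      in b₅ , b₅∈ , record
        { a-bounded = λ z z∈ → t₅ b₄ b₄∈b₅ z (proj₁ (∈ω₂-Ordinal b₄∈) b₁ b₁∈b₄ z (h₁ z z∈))
        ; x-bounded = λ t t∈ α γ β e → t₅ b₄ b₄∈b₅ α (proj₁ (∈ω₂-Ordinal b₄∈) b₂ b₂∈b₄ α (h₂ t (lift t∈) α γ β e))
        ; A-bounded = λ M M∈ z z∈ → t₅ b₃ b₃∈b₅ z (h₃ M (lift M∈) z z∈)
        }
      where open Condition p

  module _ (P : Pred Condition (lsuc 0ℓ)) (F : elems ω₂ ≼ subset ℙ.Eq.setoid P) where
    private
      cond : i ∈ ω₂ → Condition
      cond {i} i∈ = proj₁ (Injection.to F (i , i∈))

      Fiber : V → V → Set₁
      Fiber ξ i = Σ[ i∈ ∈ i ∈ ω₂ ] i ∈ Γ × Traced i × ξ π↦ⱽ trace (cond i∈) i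

      -- One club for two purposes. A closure point i in `Γ` is traced by the first component, and
      -- so has a trace code ξ < i. The second component then bounds the fiber over ξ by i, although
      -- i is in this fiber.
      Bound : V → V → Set₁
      Bound γ b = TraceBound γ b × (∀ i → Fiber γ i → i ∈ b)

      Bound-resp : ∀ {γ γ′ b b′} → γ ≈ γ′ → b ≈ b′ → Bound γ b → Bound γ′ b′
      Bound-resp e f (g , h) =
          (λ a a∈ ξ ξ↦ → ∈-respʳ f (g a a∈ ξ (π-resp ≈-refl (∩-cong {a} ≈-refl (≈-sym e)) ξ↦)))
        , (λ i (i∈ , i∈Γ , traced , ξ↦) →
             ∈-respʳ f (h i (i∈ , i∈Γ , traced , π-resp (≈-sym e) (≈-refl {trace (cond i∈) i}) ξ↦)))

      Bound-mono : ∀ {γ b b′} → b′ ∈ ω₂ → b ∈ b′ → Bound γ b → Bound γ b′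
      Bound-mono {γ} {b} {b′} b′∈ b∈b′ (g , h) =
          (λ a a∈ ξ ξ↦ → proj₁ (∈ω₂-Ordinal b′∈) b b∈b′ ξ (g a a∈ ξ ξ↦))
        , (λ i fib → proj₁ (∈ω₂-Ordinal b′∈) b b∈b′ i (h i fib))

      abstract
        -- Pressing down: i ↦ π⁻¹(trace p_i i) is regressive on the traced i in Γ.
        unbounded-fiber : ∃[ ξ ] ∀ b → b ∈ ω₂ → ∃[ i ] Fiber ξ i × i ∉ b
        unbounded-fiber = dne λ none →
          let fiber-bound : ∀ ξ → ∃[ b ] b ∈ ω₂ × (∀ i → Fiber ξ i → i ∈ b)
              fiber-bound ξ = dne λ nb → none (ξ , λ b b∈ → dne λ ni →
                nb (b , b∈ , λ i fib → dne₀ λ i∉b → ni (i , fib , i∉b)))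
              Bound-exists : ∀ γ → γ ∈ ω₂ → ∃[ b ] b ∈ ω₂ × Bound γ b
              Bound-exists γ γ∈ =
                let (b₁ , b₁∈ , g) = trace-bound γ γ∈
                    (b₂ , b₂∈ , h) = fiber-bound γ
                    (b , b∈ , b₁∈b , b₂∈b) = upper-bound ω₂.oκ⁺ ω₂-S b₁∈ b₂∈
                    tb = proj₁ (∈ω₂-Ordinal b∈)
                in b , b∈ , (λ a a∈ ξ ξ↦ → tb b₁ b₁∈b ξ (g a a∈ ξ ξ↦)) , (λ i fib → tb b₂ b₂∈b i (h i fib))
              open ClosurePoints Bound Bound-resp Bound-mono Bound-exists
              (i , i∈E , i∈Γ) = proj₂ Γ-stationary E E-club
              closed = proj₂ (∈-sep⁻ ω₂ Closed Closed-resp i∈E)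
              traced : Traced i
              traced = λ γ γ∈i → proj₁ (closed γ γ∈i)
              i∈ = Γ⊆ω₂ i∈Γ
              (ξ , ξ∈i , ξ↦) = trace-index (cond i∈) i∈Γ traced
          in ∈-irrefl i (proj₂ (closed ξ ξ∈i) i (i∈ , i∈Γ , traced , ξ↦))

      fibers-compatible : ∀ ξ i j b → (fib : Fiber ξ i) (fib′ : Fiber ξ j) → b ∈ ω₂ → i ∈ b → j ∉ b →
        Bounded (cond (proj₁ fib)) b → Compatible ℙ (cond (proj₁ fib)) (cond (proj₁ fib′)) × i ∈ j
      fibers-compatible ξ i j b (i∈ , i∈Γ , traced , ξ↦) (j∈ , j∈Γ , _ , ξ↦′) b∈ i∈b j∉b bd =
          Amalgam.compatible (cond i∈) (cond j∈) i∈Γ j∈Γ i∈j traced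
            (trace⇒Agree (cond i∈) (cond j∈) i j
              (π-functional {ξ} {ξ} {trace (cond i∈) i} {trace (cond j∈) j} ξ↦ ξ↦′ ≈-refl))
            (Bounded-mono (cond i∈) oj b≤j bd)
        , i∈j
        where
        oj : Ordinal j
        oj = Γ-Ordinal j j∈Γ
        b≤j : b ≤ j
        b≤j = ≮⇒≥ oj (∈ω₂-Ordinal b∈) j∉b
        i∈j : i ∈ j
        i∈j = ∈-≤-trans oj i∈b b≤j

    not-antichain : ¬ Antichain ℙ P
    not-antichain antichain =
      let (ξ , fiber) = unbounded-fiber
          (i , fib@(i∈ , _) , _) = fiber ∅ ∅∈ω₂
          (b₀ , b₀∈ , bd₀) = bounded (cond i∈)
          -- `b` is also taken above `i`, so that `j ∉ b` yields i < j; as `F` is injective, the two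
          -- conditions are then distinct.
          (b , b∈ , b₀∈b , i∈b) = upper-bound ω₂.oκ⁺ ω₂-S b₀∈ i∈
          (j , fib′@(j∈ , _) , j∉b) = fiber b b∈
          (compat , i∈j) = fibers-compatible ξ i j b fib fib′ b∈ i∈b j∉b
            (Bounded-mono (cond i∈) (∈ω₂-Ordinal b∈) (inj₁ b₀∈b) bd₀)
      in antichain (cond i∈) (cond j∈) (proj₂ (Injection.to F (i , i∈))) (proj₂ (Injection.to F (j , j∈)))
           (λ p≈q → ∈-irrefl j (∈-respˡ j (Injection.injective F p≈q) i∈j)) compat

  -- `≺` also demands an injection of the antichain into ω₂. A condition, as a triple of
  -- hereditarily small sets, lies in H(ω₂) and is sent to its `π`-code.
  chain-condition : ChainCondition ℙ ω₂
  chain-condition P antichain = inclusion , λ F → not-antichain P F antichain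
    where
    index : ∀ p → ∃[ ξ ] ξ π↦ⱽ code p
    index p = π-index (code p) (Small⇒H (Small-code p))
    inclusion : subset ℙ.Eq.setoid P ≼ elems ω₂
    inclusion = record
      { to        = λ (p , _) → proj₁ (index p) , proj₁ (proj₂ (index p))
      ; cong      = λ { {p , _} {q , _} (e , f , g) →
          π-injective {_} {_} {code p} {code q} (proj₂ (index p)) (proj₂ (index q)) (⟨⟩-cong e f g) }
      ; injective = λ { {p , _} {q , _} e →
          ⟨⟩-inj (Condition.a p) (Condition.x p) (Condition.A p) (Condition.a q) (Condition.x q) (Condition.A q)
            (π-functional {_} {_} {code p} {code q} (proj₂ (index p)) (proj₂ (index q)) e) }
      }

proposition6p3 : ExcludedMiddle (lsuc 0ℓ) → Choice →
    (ω₁ ω₂ : V) →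
    ω₁ IsSuccessorCardinalOf ω → ω₂ IsSuccessorCardinalOf ω₁ →
    Bijection (2^ ω₁) (elems ω₂) →
    (π : Bijection (elems ω₂) (class (H ω₂))) →
    (𝒴 : V) →
    StationaryCountable ω₂ 𝒴 → Thin ω₁ ω₂ 𝒴 → ClosedUnderInitialSegments ω₂ 𝒴 →
    let open Structure ω₁ ω₂ π 𝒴 in
    (Γ : V) → (∀ α → α ∈ Γ → Λ α) → Stationary ω₂ Γ →
    let open Forcing Γ in
    ChainCondition ℙ ω₂
proposition6p3 lem choice ω₁ ω₂ succ₁ succ₂ _ π 𝒴 (𝒴-countable , _) thin _ Γ Γ⊆Λ Γ-stationary =
  Chains.chain-condition lem choice succ₁ succ₂ π 𝒴-countable thin Γ⊆Λ Γ-stationary
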